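{- Let $G$ be a $(P_2+P_4,\,K_4-e)$-free graph with $\omega(G)\geq 3$. Then one of the following holds: (i) $G$ is perfect; (ii) if $G$ contains a $C_5$, then either $\chi(G)\leq 6$ or $\chi(G)=\omega(G)$; (iii) if $G$ is $C_5$-free and contains a $C_7$, then $\chi(G)\leq 3$.
   Context: All graphs are finite, simple, undirected. $P_t$ is the chordless path on $t$ vertices, $C_t$ the chordless cycle on $t$ vertices, and $K_4-e$ is $K_4$ minus one edge. $G_1+G_2$ denotes disjoint union. A graph $G$ contains $H$ if $H$ is an induced subgraph of $G$; $G$ is $\mathcal F$-free if it contains no graph of $\mathcal F$. $\chi$ and $\omega$ denote chromatic number and clique number. A graph is perfect if every induced subgraph $H$ satisfies $\chi(H)=\omega(H)$. -}

module Defs where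

open import Data.Bool using (Bool; true; false; _∧_; _∨_; not)
open import Data.Bool.Properties using (∨-comm)
open import Data.Nat using (ℕ; zero; suc; _+_; _∸_; _≤_; _≡ᵇ_)
open import Data.Fin using (Fin; toℕ; splitAt; _≟_)
import Data.Empty
open import Data.Sum using (_⊎_; inj₁; inj₂)
open import Data.Product using (Σ; ∃; _×_; _,_)
open import Function.Definitions using (Injective)
open import Relation.Nullary using (¬_; does)
open import Relation.Binary.PropositionalEquality using (_≡_; _≢_; refl; cong; cong₂)

record Graph (n : ℕ) : Set where
  field
    adj     : Fin n → Fin n → Bool
    adj-sym : ∀ i j → adj i j ≡ adj j i
    adj-irr : ∀ i → adj i i ≡ false
open Graph public

mkGraph : ∀ {n} → (Fin n → Fin n → Bool) → Graph n
mkGraph {n} e = record { adj = a ; adj-sym = s ; adj-irr = r }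
  where
  a : Fin n → Fin n → Bool
  a i j = not (does (i ≟ j)) ∧ (e i j ∨ e j i)
  s : ∀ i j → a i j ≡ a j i
  s i j with i ≟ j | j ≟ i
  ... | Relation.Nullary.yes _ | Relation.Nullary.yes _ = refl
  ... | Relation.Nullary.yes p | Relation.Nullary.no q = Data.Empty.⊥-elim (q (Relation.Binary.PropositionalEquality.sym p))
  ... | Relation.Nullary.no q | Relation.Nullary.yes p = Data.Empty.⊥-elim (q (Relation.Binary.PropositionalEquality.sym p))
  ... | Relation.Nullary.no _ | Relation.Nullary.no _ = ∨-comm (e i j) (e j i)
  r : ∀ i → a i i ≡ false
  r i with i ≟ i
  ... | Relation.Nullary.yes _ = refl
  ... | Relation.Nullary.no q = Data.Empty.⊥-elim (q refl)

P : (t : ℕ) → Graph t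
P t = mkGraph (λ i j → toℕ j ≡ᵇ suc (toℕ i))

-- Chordless cycle C_t (meant for t ≥ 3): edges {k,k+1} and {0,t-1}.
C : (t : ℕ) → Graph t
C t = mkGraph (λ i j → (toℕ j ≡ᵇ suc (toℕ i)) ∨ ((toℕ i ≡ᵇ 0) ∧ (toℕ j ≡ᵇ (t ∸ 1))))

K4-e : Graph 4
K4-e = mkGraph (λ i j → not ((toℕ i ≡ᵇ 2) ∧ (toℕ j ≡ᵇ 3)) ∧ not ((toℕ i ≡ᵇ 3) ∧ (toℕ j ≡ᵇ 2)))

private
  sumAdj : ∀ {m n} → Graph m → Graph n → Fin m ⊎ Fin n → Fin m ⊎ Fin n → Bool
  sumAdj G H (inj₁ i) (inj₁ j) = adj G i j
  sumAdj G H (inj₂ i) (inj₂ j) = adj H i j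
  sumAdj G H (inj₁ _) (inj₂ _) = false
  sumAdj G H (inj₂ _) (inj₁ _) = false

  sumSym : ∀ {m n} (G : Graph m) (H : Graph n) x y → sumAdj G H x y ≡ sumAdj G H y x
  sumSym G H (inj₁ i) (inj₁ j) = adj-sym G i j
  sumSym G H (inj₂ i) (inj₂ j) = adj-sym H i j
  sumSym G H (inj₁ _) (inj₂ _) = refl
  sumSym G H (inj₂ _) (inj₁ _) = refl

  sumIrr : ∀ {m n} (G : Graph m) (H : Graph n) x → sumAdj G H x x ≡ false
  sumIrr G H (inj₁ i) = adj-irr G i
  sumIrr G H (inj₂ i) = adj-irr H i

_⊕_ : ∀ {m n} → Graph m → Graph n → Graph (m + n)
_⊕_ {m} G H = record
  { adj = λ i j → sumAdj G H (splitAt m i) (splitAt m j)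
  ; adj-sym = λ i j → sumSym G H (splitAt m i) (splitAt m j)
  ; adj-irr = λ i → sumIrr G H (splitAt m i) }

Contains : ∀ {n m} → Graph n → Graph m → Set
Contains {n} {m} G H =
  Σ (Fin m → Fin n) λ f → Injective _≡_ _≡_ f × (∀ i j → adj H i j ≡ adj G (f i) (f j))

Free₂ : ∀ {n m₁ m₂} → Graph n → Graph m₁ → Graph m₂ → Set
Free₂ G H₁ H₂ = ¬ Contains G H₁ × ¬ Contains G H₂

Colourable : ∀ {n} → Graph n → ℕ → Set
Colourable {n} G k = Σ (Fin n → Fin k) λ c → ∀ i j → adj G i j ≡ true → c i ≢ c j

HasClique : ∀ {n} → Graph n → ℕ → Set
HasClique {n} G k =
  Σ (Fin k → Fin n) λ f → Injective _≡_ _≡_ f × (∀ i j → i ≢ j → adj G (f i) (f j) ≡ true)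

IsChromaticNumber : ∀ {n} → Graph n → ℕ → Set
IsChromaticNumber G k = Colourable G k × (∀ j → Colourable G j → k ≤ j)

IsCliqueNumber : ∀ {n} → Graph n → ℕ → Set
IsCliqueNumber G k = HasClique G k × (∀ j → HasClique G j → j ≤ k)

ChiEqOmega : ∀ {n} → Graph n → Set
ChiEqOmega G = ∃ λ k → IsChromaticNumber G k × IsCliqueNumber G k

ChiLe : ∀ {n} → Graph n → ℕ → Set
ChiLe G b = ∃ λ k → IsChromaticNumber G k × k ≤ b

OmegaGe : ∀ {n} → Graph n → ℕ → Set
OmegaGe G b = ∃ λ k → IsCliqueNumber G k × b ≤ k

Perfect : ∀ {n} → Graph n → Set
Perfect G = ∀ m (H : Graph m) → Contains G H → ChiEqOmega H

{-# OPTIONS --safe #-}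
module Submission where

-- Let K be a maximum clique. As G is diamond-free, a vertex outside K has at
-- most one neighbour in K. Colourings are built by induction on the number of
-- vertices, so a vertex whose neighbourhood is a small clique can be removed.
--
-- If ω ≥ 6, an induced P₄ outside K would miss two vertices of K. Hence G − K is
-- a diamond-free cograph: it is bipartite, or it has simplicial vertices to
-- work with, and ω colours suffice. If ω ≤ 5, a closer look at the contacts with
-- K (and, for ω = 3, at the triangles anticomplete to an edge) gives six colours.
--
-- Without C₅ and C₇ there are no odd holes. Then, by Kempe chains, a minimal
-- graph that is not ω-colourable has, at each vertex v and for each two
-- colours, an edge with these colours in the neighbourhood of v. For
-- ω = 3, 4, 5 this yields so many triangles on K that P₂+P₄ or C₅ occurs.
--
-- With C₇ but without C₅, each vertex is coloured according to its neighbours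
-- among at most four vertices of some induced subgraph on 7, 8 or 9 vertices.
--
-- Case distinctions about boundedly many vertices are recorded as decision
-- trees with a forbidden subgraph at each leaf, which are checked by evaluation.

-- The vertices nonadjacent to both ends of an edge induce a cograph, and a diamond-free cograph
-- with at least one edge needs no more than ω colours. Hence the aim is to cover the graph by few
-- such sets, with the edges taken from a clique. The threshold ω ≥ 6 arises because the four
-- vertices of a path outside K touch at most four vertices of K. For small ω the bound six has
-- several sources: two cographs with three colours each, four colours of a clique and two more, two
-- anticomplete triangles sharing three colours with three more, or three bipartite parts.
--
-- Vertices introduced by a case distinction may coincide. In all forbidden shapes except K₄ - e, no
-- two vertices have the same neighbours, so the adjacencies alone keep the vertices apart. For K₄ -
-- e the conclusion is instead that two vertices are equal, and this is why the certificates have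
-- rules about equality.

open import Defs
open import Data.Bool using (Bool; true; false; _∧_; not; if_then_else_; T)
import Data.Bool.Properties as 𝔹
open import Data.Empty using (⊥; ⊥-elim)
open import Data.Fin using (Fin; zero; suc; punchIn; punchOut; inject≤; combine; opposite; _≟_)
open import Data.Fin.Patterns
import Data.Fin.Properties as 𝔽
open import Data.List using (List; []; _∷_; [_]; _++_; length; map; filter; lookup; allFin; concatMap; replicate)
import Data.List as List
open import Data.List.Membership.Propositional using (_∈_; _∉_)
open import Data.List.Membership.Propositional.Properties using (∈-filter⁺; ∈-allFin; ∈-map⁺; ∈-lookup)
open import Data.List.Properties using (length-map; length-tabulate; map-applyUpTo)
open import Data.List.Relation.Binary.Pointwise using (Pointwise; []; _∷_)
import Data.List.Relation.Binary.Pointwise as Pointwise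
open import Data.List.Relation.Unary.All using (All; []; _∷_)
import Data.List.Relation.Unary.All as All
import Data.List.Relation.Unary.All.Properties as All
open import Data.List.Relation.Unary.AllPairs using (AllPairs; []; _∷_)
import Data.List.Relation.Unary.AllPairs as AllPairs
import Data.List.Relation.Unary.AllPairs.Properties as AllPairs
open import Data.List.Relation.Unary.Any using (Any; here; there)
import Data.List.Relation.Unary.Any as Any
import Data.List.Relation.Unary.Any.Properties as Any
open import Data.List.Relation.Unary.Unique.Propositional using (Unique)
import Data.List.Relation.Unary.Unique.Propositional.Properties as Unique
open import Data.Maybe using (Maybe; just; nothing; is-just; zipWith; _<∣>_)
import Data.Maybe as Maybe
open import Data.Nat using (ℕ; zero; suc; _+_; _∸_; _≤_; _<_; z≤n; s≤s; s≤s⁻¹; z<s; _<ᵇ_)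
import Data.Nat.Properties as ℕ
open import Data.Product using (Σ; ∃; ∃₂; Σ-syntax; ∃-syntax; _×_; _,_; proj₁; proj₂; uncurry)
import Data.Product.Properties as Product
open import Data.Sum using (_⊎_; inj₁; inj₂; [_,_]′)
import Data.Sum as Sum
open import Data.Unit using (⊤; tt)
open import Data.Vec using (Vec; []; _∷_)
import Data.Vec as Vec
open import Data.Vec.Properties using (lookup∘tabulate)
open import Function using (_∘_; id; case_of_)
open import Function.Definitions using (Injective)
open import Relation.Binary.PropositionalEquality using (_≡_; _≢_; refl; sym; trans; cong; cong₂; subst; subst₂; ≢-sym)
open import Relation.Nullary using (¬_; Dec; yes; no; does; contradiction)
open import Relation.Nullary.Decidable using (_×-dec_; _⊎-dec_; _→-dec_; ¬?; map′; decidable-stable; from-yes; dec-true; dec-false)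

-- Refutation certificates

-- The upper triangle of an adjacency matrix, row by row.
Shape : Set
Shape = List (List Bool)

-- The triple (i , j , b) says that the vertices named i and j are adjacent if
-- b is true, and nonadjacent (possibly equal) otherwise.
Lit : Set
Lit = ℕ × ℕ × Bool

infix 6 _⋯_

_⋯_ : ℕ → ℕ → List ℕ
i ⋯ j = List.applyUpTo (i +_) (suc j ∸ i)

data Hyp : Set where
  shape        : Shape → List ℕ → Hyp
  clique       : List ℕ → Hyp
  star anti    : ℕ → List ℕ → Hyp
  apart        : List ℕ → List ℕ → Hyp
  some         : List Lit → Hyp

data Cert : Set where
  -- i and j are adjacent in the first branch and nonadjacent in the second
  on : (i j : ℕ) → Cert → Cert → Cert
  -- x, y are adjacent common neighbours of the nonadjacent c, d, so that c ≡ d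
  fuse  : (x y c d : ℕ) → Cert → Cert
  -- c and d are fused, but differ in their adjacency to w
  clash : (c d w : ℕ) → Cert
  distinct : (c d : ℕ) → Cert
  -- the k-th forbidden shape, respectively the falsified k-th clause
  occurs : (k : ℕ) → List ℕ → Cert
  clause : (k : ℕ) → Cert

dia : (x y c d w : ℕ) → Cert
dia x y c d w = fuse x y c d (clash c d w)

dia≠ : (x y c d : ℕ) → Cert
dia≠ x y c d = fuse x y c d (distinct c d)

at3 : (k a b c : ℕ) → Cert
at3 k a b c = occurs k (a ∷ b ∷ c ∷ [])

at4 : (k a b c d : ℕ) → Cert
at4 k a b c d = occurs k (a ∷ b ∷ c ∷ d ∷ [])

at5 : (k a b c d e : ℕ) → Cert
at5 k a b c d e = occurs k (a ∷ b ∷ c ∷ d ∷ e ∷ [])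

at6 : (k a b c d e f : ℕ) → Cert
at6 k a b c d e f = occurs k (a ∷ b ∷ c ∷ d ∷ e ∷ f ∷ [])

module Adjacency {n} (G : Graph n) where
  infix 4 _~_ _≁_ _~?_
  _~_ _≁_ : Fin n → Fin n → Set
  x ~ y = adj G x y ≡ true
  x ≁ y = adj G x y ≡ false

  _~?_ : ∀ x y → Dec (x ~ y)
  x ~? y = adj G x y 𝔹.≟ true

  ~-sym : ∀ {x y} → x ~ y → y ~ x
  ~-sym {x} {y} = trans (adj-sym G y x)

  ≁-sym : ∀ {x y} → x ≁ y → y ≁ x
  ≁-sym {x} {y} = trans (adj-sym G y x)

  ¬~⇒≁ : ∀ {x y} → ¬ x ~ y → x ≁ y
  ¬~⇒≁ = 𝔹.¬-not

  ~⇒¬≁ : ∀ {x y} → x ~ y → ¬ x ≁ y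
  ~⇒¬≁ p q = contradiction (trans (sym p) q) λ ()

  ~⇒≢ : ∀ {x y} → x ~ y → x ≢ y
  ~⇒≢ {x} p refl = ~⇒¬≁ p (adj-irr G x)

  Induces : Shape → List (Fin n) → Set
  Induces []       []       = ⊤
  Induces (r ∷ rs) (v ∷ vs) = Pointwise (λ b w → adj G v w ≡ b) r vs × Induces rs vs
  Induces _        _        = ⊥

  Avoids : List Shape → Set
  Avoids = All (λ s → ∀ vs → ¬ Induces s vs)

  -- The tips of K₄ - e are twins, so its adjacencies do not force them apart. The condition is
  -- therefore phrased as an equation, which `fuse` records and `clash` or `distinct` contradicts.
  DiamondFree : Set
  DiamondFree = ∀ {x y c d} → x ~ y → x ~ c → x ~ d → y ~ c → y ~ d → c ≁ d → c ≡ d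

module Refutation {n} (G : Graph n) (df : Adjacency.DiamondFree G)
                  {ps : List Shape} (avoids : Adjacency.Avoids G ps) (env : ℕ → Fin n) where

  open Adjacency G

  private
    Adj Eq : Lit → Set
    Adj (i , j , b) = adj G (env i) (env j) ≡ b
    Eq (i , j , b) = if b then env i ≡ env j else env i ≢ env j

    same : ∀ x y i j → Maybe (x ≡ i × y ≡ j ⊎ x ≡ j × y ≡ i)
    same x y i j with x ℕ.≟ i
    ... | yes p with y ℕ.≟ j
    ...   | yes q = just (inj₁ (p , q))
    ...   | no _  = nothing
    same x y i j | no _ with x ℕ.≟ j
    ...   | no _  = nothing
    ...   | yes p with y ℕ.≟ i
    ...     | yes q = just (inj₂ (p , q))
    ...     | no _  = nothing

    findAdj : ∀ Γ i j b → Maybe (All Adj Γ → Adj (i , j , b))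
    findAdj [] i j true = nothing
    findAdj [] i j false with i ℕ.≟ j
    ... | yes refl = just λ _ → adj-irr G (env i)
    ... | no _     = nothing
    findAdj ((x , y , b′) ∷ Γ) i j b with same x y i j
    ... | nothing = Maybe.map (_∘ All.tail) (findAdj Γ i j b)
    ... | just p with b′ 𝔹.≟ b
    ...   | no _ = nothing
    findAdj ((x , y , _) ∷ Γ) i j b | just (inj₁ (refl , refl)) | yes refl = just All.head
    findAdj ((x , y , _) ∷ Γ) i j b | just (inj₂ (refl , refl)) | yes refl =
      just λ as → trans (adj-sym G (env i) (env j)) (All.head as)

    findEq : ∀ Δ i j b → Maybe (All Eq Δ → Eq (i , j , b))
    findEq [] i j b = nothing
    findEq ((x , y , b′) ∷ Δ) i j b with same x y i j | b′ 𝔹.≟ b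
    ... | nothing | _    = Maybe.map (_∘ All.tail) (findEq Δ i j b)
    ... | just _  | no _ = Maybe.map (_∘ All.tail) (findEq Δ i j b)
    findEq ((x , y , b′)    ∷ Δ) i j b | just (inj₁ (refl , refl)) | yes refl = just All.head
    findEq ((x , y , true)  ∷ Δ) i j b | just (inj₂ (refl , refl)) | yes refl = just (sym ∘ All.head)
    findEq ((x , y , false) ∷ Δ) i j b | just (inj₂ (refl , refl)) | yes refl = just (λ es → ≢-sym (All.head es))

    row : ∀ Γ i r js → Maybe (All Adj Γ → Pointwise (λ b w → adj G (env i) w ≡ b) r (map env js))
    row Γ i []      []       = just λ _ → []
    row Γ i (b ∷ r) (j ∷ js) = zipWith (λ f g as → f as ∷ g as) (findAdj Γ i j b) (row Γ i r js)
    row Γ i _       _        = nothing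

    induces : ∀ Γ s js → Maybe (All Adj Γ → Induces s (map env js))
    induces Γ []       []       = just λ _ → tt
    induces Γ (r ∷ rs) (j ∷ js) = zipWith (λ f g as → f as , g as) (row Γ j r js) (induces Γ rs js)
    induces Γ _        _        = nothing

    forbidden : ∀ Γ {ps} → Avoids ps → ℕ → List ℕ → Maybe (All Adj Γ → ⊥)
    forbidden Γ {[]}     av k       js = nothing
    forbidden Γ {s ∷ ps} av zero    js = Maybe.map (All.head av (map env js) ∘_) (induces Γ s js)
    forbidden Γ {s ∷ ps} av (suc k) js = forbidden Γ (All.tail av) k js

    falsified : ∀ Γ c → Maybe (All Adj Γ → Any Adj c → ⊥)
    falsified Γ [] = just λ _ ()
    falsified Γ ((i , j , b) ∷ c) =
      zipWith (λ f g as → λ { (here r) → 𝔹.not-¬ r (f as) ; (there r) → g as r })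
              (findAdj Γ i j (not b)) (falsified Γ c)

    clauseAt : ∀ Γ cs → ℕ → Maybe (All Adj Γ → All (Any Adj) cs → ⊥)
    clauseAt Γ []       k       = nothing
    clauseAt Γ (c ∷ cs) zero    = Maybe.map (λ f as ds → f as (All.head ds)) (falsified Γ c)
    clauseAt Γ (c ∷ cs) (suc k) = Maybe.map (λ f as ds → f as (All.tail ds)) (clauseAt Γ cs k)

    Refuted : List Lit → List Lit → List (List Lit) → Set
    Refuted Γ Δ cs = All Adj Γ → All Eq Δ → All (Any Adj) cs → ⊥

    diamond : ∀ Γ x y c d → Maybe (All Adj Γ → env c ≡ env d)
    diamond Γ x y c d =
      Maybe.map (λ f as → case f as of λ
        { ((xy ∷ xc ∷ xd ∷ []) , (yc ∷ yd ∷ []) , (cd ∷ []) , [] , tt) → df xy xc xd yc yd cd })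
      (induces Γ ((true ∷ true ∷ true ∷ []) ∷ (true ∷ true ∷ []) ∷ (false ∷ []) ∷ [] ∷ [])
                 (x ∷ y ∷ c ∷ d ∷ []))

    differ : ∀ Γ c d w → Bool → Maybe (All Adj Γ → env c ≡ env d → ⊥)
    differ Γ c d w b =
      zipWith (λ f g as e → 𝔹.not-¬ (f as) (trans (cong (λ u → adj G u (env w)) e) (g as)))
              (findAdj Γ c w b) (findAdj Γ d w (not b))

    -- Every rule returns the refutation itself, so a successful run carries its own soundness
    -- proof. Only names and literals are inspected, never the vertices behind them, so the run
    -- evaluates for a variable graph.
    check : ∀ Γ Δ cs → Cert → Maybe (Refuted Γ Δ cs)
    check Γ Δ cs (on i j p q) =
      zipWith (λ f g as es ds → by-cases f g as es ds (adj G (env i) (env j)) refl)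
              (check ((i , j , true) ∷ Γ) Δ cs p) (check ((i , j , false) ∷ Γ) Δ cs q)
      where
      by-cases : Refuted ((i , j , true) ∷ Γ) Δ cs → Refuted ((i , j , false) ∷ Γ) Δ cs →
                 All Adj Γ → All Eq Δ → All (Any Adj) cs → ∀ b → adj G (env i) (env j) ≡ b → ⊥
      by-cases f g as es ds true  e = f (e ∷ as) es ds
      by-cases f g as es ds false e = g (e ∷ as) es ds
    check Γ Δ cs (fuse x y c d p) =
      zipWith (λ f g as es ds → g as (f as ∷ es) ds) (diamond Γ x y c d) (check Γ ((c , d , true) ∷ Δ) cs p)
    check Γ Δ cs (clash c d w) =
      zipWith (λ f g as es ds → f as (g es)) (differ Γ c d w true <∣> differ Γ c d w false) (findEq Δ c d true)
    check Γ Δ cs (distinct c d) =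
      zipWith (λ f g as es ds → f es (g es)) (findEq Δ c d false) (findEq Δ c d true)
    check Γ Δ cs (occurs k js) = Maybe.map (λ f as es ds → f as) (forbidden Γ avoids k js)
    check Γ Δ cs (clause k) = Maybe.map (λ f as es ds → f as ds) (clauseAt Γ cs k)

  ⟦_⟧ : Hyp → Set
  ⟦ shape s is ⟧ = Induces s (map env is)
  ⟦ clique is ⟧ = AllPairs _~_ (map env is)
  ⟦ star i js ⟧ = All (env i ~_) (map env js)
  ⟦ anti i js ⟧ = All (env i ≁_) (map env js)
  ⟦ apart is js ⟧ = All (λ x → All (x ≢_) (map env js)) (map env is)
  ⟦ some c ⟧ = Any (λ (i , j , b) → adj G (env i) (env j) ≡ b) c

  private
    shapeLits : Shape → List ℕ → List Lit
    shapeLits (r ∷ rs) (i ∷ is) = List.zipWith (λ b j → i , j , b) r is ++ shapeLits rs is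
    shapeLits _ _ = []

    cliqueLits : List ℕ → List Lit
    cliqueLits [] = []
    cliqueLits (i ∷ is) = map (λ j → i , j , true) is ++ cliqueLits is

    adjLits eqLits : List Hyp → List Lit
    adjLits [] = []
    adjLits (shape s is ∷ hs) = shapeLits s is ++ adjLits hs
    adjLits (clique is ∷ hs) = cliqueLits is ++ adjLits hs
    adjLits (star i js ∷ hs) = map (λ j → i , j , true) js ++ adjLits hs
    adjLits (anti i js ∷ hs) = map (λ j → i , j , false) js ++ adjLits hs
    adjLits (_ ∷ hs) = adjLits hs

    apartLits : List ℕ → List ℕ → List Lit
    apartLits is js = concatMap (λ i → map (λ j → i , j , false) js) is

    eqLits [] = []
    eqLits (apart is js ∷ hs) = apartLits is js ++ eqLits hs
    eqLits (_ ∷ hs) = eqLits hs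

    clauses : List Hyp → List (List Lit)
    clauses [] = []
    clauses (some c ∷ hs) = c ∷ clauses hs
    clauses (_ ∷ hs) = clauses hs

    shapeLits-hold : ∀ s is → Induces s (map env is) → All Adj (shapeLits s is)
    shapeLits-hold [] [] _ = []
    shapeLits-hold (r ∷ rs) (i ∷ is) (p , q) = All.++⁺ (go r is p) (shapeLits-hold rs is q)
      where
      go : ∀ r is → Pointwise (λ b w → adj G (env i) w ≡ b) r (map env is) →
           All Adj (List.zipWith (λ b j → i , j , b) r is)
      go []      []       []       = []
      go (b ∷ r) (j ∷ is) (p ∷ ps) = p ∷ go r is ps

    cliqueLits-hold : ∀ is → AllPairs _~_ (map env is) → All Adj (cliqueLits is)
    cliqueLits-hold [] _ = []
    cliqueLits-hold (i ∷ is) (p ∷ ps) = All.++⁺ (All.map⁺ (All.map⁻ p)) (cliqueLits-hold is ps)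

    apartLits-hold : ∀ is js → All (λ x → All (x ≢_) (map env js)) (map env is) → All Eq (apartLits is js)
    apartLits-hold [] js _ = []
    apartLits-hold (i ∷ is) js (p ∷ ps) = All.++⁺ (All.map⁺ (All.map⁻ p)) (apartLits-hold is js ps)

    adjLits-hold : ∀ {hs} → All ⟦_⟧ hs → All Adj (adjLits hs)
    adjLits-hold {[]} _ = []
    adjLits-hold {shape s is ∷ hs} (p ∷ ps) = All.++⁺ (shapeLits-hold s is p) (adjLits-hold ps)
    adjLits-hold {clique is ∷ hs}  (p ∷ ps) = All.++⁺ (cliqueLits-hold is p) (adjLits-hold ps)
    adjLits-hold {star i js ∷ hs}  (p ∷ ps) = All.++⁺ (All.map⁺ (All.map⁻ p)) (adjLits-hold ps)
    adjLits-hold {anti i js ∷ hs}  (p ∷ ps) = All.++⁺ (All.map⁺ (All.map⁻ p)) (adjLits-hold ps)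
    adjLits-hold {apart _ _ ∷ hs}  (p ∷ ps) = adjLits-hold ps
    adjLits-hold {some _ ∷ hs}     (p ∷ ps) = adjLits-hold ps

    eqLits-hold : ∀ {hs} → All ⟦_⟧ hs → All Eq (eqLits hs)
    eqLits-hold {[]} _ = []
    eqLits-hold {apart is js ∷ hs} (p ∷ ps) = All.++⁺ (apartLits-hold is js p) (eqLits-hold ps)
    eqLits-hold {shape _ _ ∷ hs}   (p ∷ ps) = eqLits-hold ps
    eqLits-hold {clique _ ∷ hs}    (p ∷ ps) = eqLits-hold ps
    eqLits-hold {star _ _ ∷ hs}    (p ∷ ps) = eqLits-hold ps
    eqLits-hold {anti _ _ ∷ hs}    (p ∷ ps) = eqLits-hold ps
    eqLits-hold {some _ ∷ hs}      (p ∷ ps) = eqLits-hold ps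

    clauses-hold : ∀ {hs} → All ⟦_⟧ hs → All (Any Adj) (clauses hs)
    clauses-hold {[]} _ = []
    clauses-hold {some c ∷ hs}    (p ∷ ps) = p ∷ clauses-hold ps
    clauses-hold {shape _ _ ∷ hs} (p ∷ ps) = clauses-hold ps
    clauses-hold {clique _ ∷ hs}  (p ∷ ps) = clauses-hold ps
    clauses-hold {star _ _ ∷ hs}  (p ∷ ps) = clauses-hold ps
    clauses-hold {anti _ _ ∷ hs}  (p ∷ ps) = clauses-hold ps
    clauses-hold {apart _ _ ∷ hs} (p ∷ ps) = clauses-hold ps

  checks : List Hyp → Cert → Bool
  checks hs c = is-just (check (adjLits hs) (eqLits hs) (clauses hs) c)

  -- For concrete `hs` and `c` the implicit argument evaluates to the unit type and is filled in
  -- silently; this is where a certificate gets checked.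
  refute : ∀ hs c → {T (checks hs c)} → All ⟦_⟧ hs → ⊥
  refute hs c {ok} ps with just f ← check (adjLits hs) (eqLits hs) (clauses hs) c =
    f (adjLits-hold ps) (eqLits-hold ps) (clauses-hold ps)

-- Shapes of the forbidden graphs

P₂+P₄ : Shape
P₂+P₄ = (true ∷ false ∷ false ∷ false ∷ false ∷ []) ∷ (false ∷ false ∷ false ∷ false ∷ [])
      ∷ (true ∷ false ∷ false ∷ []) ∷ (true ∷ false ∷ []) ∷ (true ∷ []) ∷ [] ∷ []

path : ℕ → Shape
path zero          = []
path (suc zero)    = [] ∷ []
path (suc (suc n)) = (true ∷ replicate n false) ∷ path (suc n)

cycle : ℕ → Shape
cycle zero          = []
cycle (suc zero)    = [] ∷ []
cycle (suc (suc n)) = (true ∷ (replicate (n ∸ 1) false List.∷ʳ true)) ∷ path (suc n)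

complete : ℕ → Shape
complete zero    = []
complete (suc n) = replicate n true ∷ complete n

-- The default value makes the lookup total, so that an environment is a plain function on names.
at : ∀ {a} {A : Set a} → List A → A → ℕ → A
at []       d _       = d
at (x ∷ xs) d zero    = x
at (x ∷ xs) d (suc i) = at xs d i

-- Deleting and restricting

infixl 9 _[_↦_]

_[_↦_] : ∀ {n} {A : Set} → (Fin n → A) → Fin n → A → Fin n → A
(c [ v ↦ q ]) x with x ≟ v
... | yes _ = q
... | no _  = c x

update-same : ∀ {n} {A : Set} (c : Fin n → A) v q → (c [ v ↦ q ]) v ≡ q
update-same c v q with v ≟ v
... | yes _  = refl
... | no v≢v = contradiction refl v≢v

update-other : ∀ {n} {A : Set} (c : Fin n → A) {v x} q → x ≢ v → (c [ v ↦ q ]) x ≡ c x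
update-other c {v} {x} q x≢v with x ≟ v
... | yes x≡v = contradiction x≡v x≢v
... | no _    = refl

delete : ∀ {n} → Graph (suc n) → Fin (suc n) → Graph n
delete G v = record
  { adj     = λ i j → adj G (punchIn v i) (punchIn v j)
  ; adj-sym = λ i j → adj-sym G (punchIn v i) (punchIn v j)
  ; adj-irr = λ i → adj-irr G (punchIn v i) }

-- The vertices outside p are kept, but isolated.
restrict : ∀ {n} → Graph n → (Fin n → Bool) → Graph n
restrict G p = record
  { adj     = λ i j → adj G i j ∧ (p i ∧ p j)
  ; adj-sym = λ i j → cong₂ _∧_ (adj-sym G i j) (𝔹.∧-comm (p i) (p j))
  ; adj-irr = λ i → cong (_∧ (p i ∧ p i)) (adj-irr G i) }

Induces-map : ∀ {m n} (H : Graph m) (G : Graph n) (f : Fin m → Fin n) →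
  (∀ i j → adj H i j ≡ adj G (f i) (f j)) →
  ∀ s vs → Adjacency.Induces H s vs → Adjacency.Induces G s (map f vs)
Induces-map H G f e []       []       _       = tt
Induces-map H G f e (r ∷ rs) (v ∷ vs) (p , q) = go r vs p , Induces-map H G f e rs vs q
  where
  go : ∀ r vs → Pointwise (λ b w → adj H v w ≡ b) r vs → Pointwise (λ b w → adj G (f v) w ≡ b) r (map f vs)
  go []      []       []       = []
  go (b ∷ r) (w ∷ vs) (p ∷ ps) = trans (sym (e v w)) p ∷ go r vs ps

module _ {m n} (H : Graph m) (G : Graph n) (f : Fin m → Fin n)
         (f-inj : Injective _≡_ _≡_ f) (e : ∀ i j → adj H i j ≡ adj G (f i) (f j)) where

  embedded-DiamondFree : Adjacency.DiamondFree G → Adjacency.DiamondFree H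
  embedded-DiamondFree df xy xc xd yc yd cd =
    f-inj (df (t xy) (t xc) (t xd) (t yc) (t yd) (t cd))
    where
    t : ∀ {i j b} → adj H i j ≡ b → adj G (f i) (f j) ≡ b
    t {i} {j} = trans (sym (e i j))

  embedded-Avoids : ∀ {ps} → Adjacency.Avoids G ps → Adjacency.Avoids H ps
  embedded-Avoids = All.map λ {s} av vs ind → av (map f vs) (Induces-map H G f e s vs ind)

-- Colourings

module _ {n} (G : Graph n) where

  open Adjacency G

  ProperOff : ∀ {k} → Fin n → (Fin n → Fin k) → Set
  ProperOff v c = ∀ {x y} → x ≢ v → y ≢ v → x ~ y → c x ≢ c y

  -- Contrary to usage, `G` itself may be `k`-colourable. This is what the induction on the number
  -- of vertices supplies; a proof then extends one of these colourings or builds another.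
  Critical : ℕ → Set
  Critical k = ∀ v → Σ[ c ∈ (Fin n → Fin k) ] ProperOff v c

  Simplicial NonSimplicial : Fin n → Set
  Simplicial v = ∀ {x y} → v ~ x → v ~ y → x ≢ y → x ~ y
  NonSimplicial v = ∃₂ λ x y → v ~ x × v ~ y × x ≢ y × x ≁ y

module _ {n} {G : Graph n} where

  open Adjacency G

  extend : ∀ {k v} {c : Fin n → Fin k} → ProperOff G v c →
           ∀ q → (∀ {w} → v ~ w → c w ≢ q) → Colourable G k
  extend {v = v} {c} off q free = c [ v ↦ q ] , proper
    where
    proper : ∀ x y → x ~ y → (c [ v ↦ q ]) x ≢ (c [ v ↦ q ]) y
    proper x y xy with x ≟ v | y ≟ v
    ... | yes refl | yes refl = contradiction refl (~⇒≢ xy)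
    ... | yes refl | no _     = ≢-sym (free xy)
    ... | no _     | yes refl = free (~-sym xy)
    ... | no x≢v   | no y≢v   = off x≢v y≢v xy

-- If every colour occurred in `L`, two colours would share a position by the pigeonhole principle.
free-colour : ∀ {k} (L : List (Fin k)) → length L < k → ∃[ q ] q ∉ L
free-colour {k} L L<k with 𝔽.any? (λ q → ¬? (Any.any? (q ≟_) L))
... | yes p = p
... | no none = case 𝔽.pigeonhole L<k (Any.index ∘ occurrence) of λ
  { (i , j , i<j , e) → contradiction (trans (Any.lookup-index (occurrence i))
      (trans (cong (lookup L) e) (sym (Any.lookup-index (occurrence j))))) (𝔽.<⇒≢ i<j) }
  where
  occurrence : ∀ q → q ∈ L
  occurrence q = decidable-stable (Any.any? (q ≟_) L) λ q∉L → none (q , q∉L)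

module _ {n} {G : Graph n} where

  open Adjacency G

  extend-few : ∀ {k v} {c : Fin n → Fin k} → ProperOff G v c →
               (L : List (Fin k)) → length L < k → (∀ {w} → v ~ w → c w ∈ L) → Colourable G k
  extend-few off L L<k cover with q , q∉L ← free-colour L L<k =
    extend {G = G} off q λ vw e → q∉L (subst (_∈ L) e (cover vw))

-- Diamond-freeness and the absence of shapes pass to `delete G v`, so all these graphs are
-- colourable by induction. At least one colour is assumed because the deleted vertex must be given
-- some value.
critical-induction : ∀ ps k →
  (∀ {n} (G : Graph n) → Adjacency.DiamondFree G → Adjacency.Avoids G ps → Critical G (suc k) → Colourable G (suc k)) →
  ∀ {n} (G : Graph n) → Adjacency.DiamondFree G → Adjacency.Avoids G ps → Colourable G (suc k)
critical-induction ps k step {zero}  G df av = step G df av λ ()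
critical-induction ps k step {suc n} G df av = step G df av λ v → fromDelete v
  (critical-induction ps k step (delete G v)
    (embedded-DiamondFree (delete G v) G (punchIn v) (𝔽.punchIn-injective v _ _) (λ _ _ → refl) df)
    (embedded-Avoids (delete G v) G (punchIn v) (𝔽.punchIn-injective v _ _) (λ _ _ → refl) av))
  where
  fromDelete : ∀ v → Colourable (delete G v) (suc k) → Σ[ c ∈ _ ] ProperOff G v c
  fromDelete v (c₀ , proper) = c , off
    where
    c : Fin (suc n) → Fin (suc k)
    c x with v ≟ x
    ... | yes _  = zero
    ... | no v≢x = c₀ (punchOut v≢x)
    off : ProperOff G v c
    off {x} {y} x≢v y≢v xy with v ≟ x | v ≟ y
    ... | yes v≡x | _       = contradiction (sym v≡x) x≢v
    ... | no _    | yes v≡y = contradiction (sym v≡y) y≢v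
    ... | no v≢x  | no v≢y  = proper _ _
      (subst₂ (λ a b → adj G a b ≡ true) (sym (𝔽.punchIn-punchOut v≢x)) (sym (𝔽.punchIn-punchOut v≢y)) xy)

-- Cliques

module _ {n} (G : Graph n) where

  open Adjacency G

  clique-≤ : ∀ {j k} → j ≤ k → HasClique G k → HasClique G j
  clique-≤ j≤k (f , f-inj , f-adj) =
      (λ i → f (inject≤ i j≤k)) , (λ e → 𝔽.inject≤-injective j≤k j≤k _ _ (f-inj e))
    , λ i j i≢j → f-adj _ _ λ e → i≢j (𝔽.inject≤-injective j≤k j≤k _ _ e)

  list-clique : ∀ xs → AllPairs _~_ xs → HasClique G (length xs)
  list-clique xs ps = lookup xs , inj , λ i j i≢j → pairs ps i j i≢j
    where
    pairs : ∀ {xs} → AllPairs _~_ xs → ∀ i j → i ≢ j → lookup xs i ~ lookup xs j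
    pairs (p ∷ ps) zero    zero    i≢j = contradiction refl i≢j
    pairs (p ∷ ps) zero    (suc j) i≢j = All.lookup p (∈-lookup j)
    pairs (p ∷ ps) (suc i) zero    i≢j = ~-sym (All.lookup p (∈-lookup i))
    pairs (p ∷ ps) (suc i) (suc j) i≢j = pairs ps i j (i≢j ∘ cong suc)
    inj : Injective _≡_ _≡_ (lookup xs)
    inj {i} {j} e with i ≟ j
    ... | yes i≡j = i≡j
    ... | no i≢j  = contradiction e (~⇒≢ (pairs ps i j i≢j))

  clique-list : ∀ {k} → HasClique G k → ∃[ xs ] AllPairs _~_ xs × length xs ≡ k
  clique-list (f , _ , f-adj) = List.tabulate f , AllPairs.tabulate⁺ (f-adj _ _) , length-tabulate f

  complete⇒pairs : ∀ k vs → Induces (complete k) vs → AllPairs _~_ vs × length vs ≡ k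
  complete⇒pairs zero    []       _       = [] , refl
  complete⇒pairs (suc k) (v ∷ vs) (p , q) with ps , refl ← complete⇒pairs k vs q = row vs p ∷ ps , refl
    where
    row : ∀ vs → Pointwise (λ b w → adj G v w ≡ b) (replicate (length vs) true) vs → All (v ~_) vs
    row []       []       = []
    row (w ∷ vs) (p ∷ ps) = p ∷ row vs ps

  pairs⇒complete : ∀ vs → AllPairs _~_ vs → Induces (complete (length vs)) vs
  pairs⇒complete []       []       = tt
  pairs⇒complete (v ∷ vs) (p ∷ ps) = row vs p , pairs⇒complete vs ps
    where
    row : ∀ vs → All (v ~_) vs → Pointwise (λ b w → adj G v w ≡ b) (replicate (length vs) true) vs
    row []       []       = []
    row (w ∷ vs) (p ∷ ps) = p ∷ row vs ps

  complete⇒clique : ∀ {k vs} → Induces (complete k) vs → HasClique G k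
  complete⇒clique {k} {vs} ind with ps , refl ← complete⇒pairs k vs ind = list-clique vs ps

  clique⇒complete : ∀ {k} → HasClique G k → ∃[ vs ] Induces (complete k) vs
  clique⇒complete K with xs , ps , refl ← clique-list K = xs , pairs⇒complete xs ps

  no-clique⇒avoids : ∀ {k} → ¬ HasClique G k → ∀ vs → ¬ Induces (complete k) vs
  no-clique⇒avoids none vs = none ∘ complete⇒clique

  avoids⇒no-clique : ∀ {k} → (∀ vs → ¬ Induces (complete k) vs) → ¬ HasClique G k
  avoids⇒no-clique av K = uncurry av (clique⇒complete K)

  neighbours : Fin n → List (Fin n)
  neighbours v = filter (v ~?_) (allFin n)

  ∈-neighbours : ∀ {v w} → v ~ w → w ∈ neighbours v
  ∈-neighbours {v} vw = ∈-filter⁺ (v ~?_) (∈-allFin _) vw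

  simplicial-clique : ∀ {v} → Simplicial G v → AllPairs _~_ (v ∷ neighbours v)
  simplicial-clique {v} simp = all ∷ go (neighbours v) all (Unique.filter⁺ (v ~?_) (Unique.allFin⁺ n))
    where
    all : All (v ~_) (neighbours v)
    all = All.all-filter (v ~?_) (allFin n)
    go : ∀ xs → All (v ~_) xs → Unique xs → AllPairs _~_ xs
    go []       _        _        = []
    go (x ∷ xs) (p ∷ ps) (u ∷ us) = All.zipWith (λ (vy , x≢y) → simp p vy x≢y) (ps , u) ∷ go xs ps us

  simplicial-degree : ∀ {v k} → ¬ HasClique G (suc k) → Simplicial G v → length (neighbours v) < k
  simplicial-degree none simp = ℕ.≰⇒> λ k≤d →
    none (clique-≤ (s≤s k≤d) (list-clique _ (simplicial-clique simp)))

  -- The neighbours of a simplicial vertex form a clique with it, so there are fewer than `k` of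
  -- them and a colour remains.
  remove-simplicial : ∀ {v k} → Critical G k → ¬ HasClique G (suc k) → Simplicial G v → Colourable G k
  remove-simplicial {v} crit none simp with c , off ← crit v =
    extend-few {G = G} off (map c (neighbours v))
      (subst (_< _) (sym (length-map c (neighbours v))) (simplicial-degree none simp))
      (λ vw → ∈-map⁺ c (∈-neighbours vw))

  -- Searching for subgraphs

  -- Case distinctions on the existence of a subgraph are decided by exhaustive search.
  ∃list? : ∀ {P : List (Fin n) → Set} → (∀ vs → Dec (P vs)) → ∀ m → Dec (∃[ vs ] length vs ≡ m × P vs)
  ∃list? P? zero = map′ (λ p → [] , refl , p) (λ { ([] , _ , p) → p }) (P? [])
  ∃list? P? (suc m) = map′ (λ { (v , vs , e , p) → v ∷ vs , cong suc e , p })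
                           (λ { (v ∷ vs , e , p) → v , vs , ℕ.suc-injective e , p })
                           (𝔽.any? λ v → ∃list? (P? ∘ (v ∷_)) m)

  induces? : ∀ s vs → Dec (Induces s vs)
  induces? []       []       = yes tt
  induces? []       (_ ∷ _)  = no λ ()
  induces? (_ ∷ _)  []       = no λ ()
  induces? (r ∷ rs) (v ∷ vs) = Pointwise.decidable (λ b w → adj G v w 𝔹.≟ b) r vs ×-dec induces? rs vs

  induces-length : ∀ s vs → Induces s vs → length vs ≡ length s
  induces-length []       []       _       = refl
  induces-length (r ∷ rs) (v ∷ vs) (_ , p) = cong suc (induces-length rs vs p)

  occurs? : ∀ s → Dec (∃[ vs ] Induces s vs)
  occurs? s = map′ (λ (vs , _ , p) → vs , p) (λ (vs , p) → vs , induces-length s vs p , p)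
                   (∃list? (induces? s) (length s))

  hasClique? : ∀ k → Dec (HasClique G k)
  hasClique? k = map′ (λ (_ , p) → complete⇒clique p) clique⇒complete (occurs? (complete k))

-- Cographs

Colourable-≤ : ∀ {n j k} {G : Graph n} → j ≤ k → Colourable G j → Colourable G k
Colourable-≤ j≤k (c , proper) =
  (λ x → inject≤ (c x) j≤k) , λ x y xy e → proper x y xy (𝔽.inject≤-injective j≤k j≤k _ _ e)

module _ {n} {G : Graph n} where

  open Adjacency G

  simplicial-or-not : ∀ v → Simplicial G v ⊎ NonSimplicial G v
  simplicial-or-not v
    with 𝔽.any? (λ x → 𝔽.any? λ y → (v ~? x) ×-dec (v ~? y) ×-dec ¬? (x ≟ y) ×-dec (adj G x y 𝔹.≟ false))
  ... | yes p = inj₂ p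
  ... | no ¬p = inj₁ λ {x} {y} vx vy x≢y → decidable-stable (x ~? y) λ x≁y → ¬p (x , y , vx , vy , x≢y , ¬~⇒≁ x≁y)

  module _ (df : DiamondFree) (av : Avoids (path 4 ∷ [])) where

    -- If neither end is simplicial, diamond-freeness gives a neighbour u of x off y and a neighbour
    -- u′ of y off x, both nonadjacent to z. The path u x y u′ must be closed by an edge u u′, and
    -- then z x u u′ is an induced path.
    edge-simplicial : ∀ {x y z} → x ~ y → x ~ z → y ~ z → Simplicial G x ⊎ Simplicial G y
    edge-simplicial {x} {y} {z} xy xz yz with simplicial-or-not x | simplicial-or-not y
    ... | inj₁ p | _      = inj₁ p
    ... | inj₂ _ | inj₁ p = inj₂ p
    ... | inj₂ (u , w , xu , xw , u≢w , uw) | inj₂ (u′ , w′ , yu , yw , u′≢w′ , uw′) = ⊥-elim (refute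
      (clique (0 ⋯ 2) ∷ star 0 (3 ∷ 4 ∷ []) ∷ anti 3 [ 4 ] ∷ apart [ 3 ] [ 4 ]
        ∷ star 1 (5 ∷ 6 ∷ []) ∷ anti 5 [ 6 ] ∷ apart [ 5 ] [ 6 ] ∷ [])
      (on 0 5 (on 0 6 (dia≠ 0 1 6 5) (on 2 6 (dia 2 1 6 0 5) (on 1 3 (on 1 4 (dia≠ 1 0 4 3) (on 2 4 (dia
      2 0 4 1 3) (on 4 6 (at4 0 4 6 1 2) (at4 0 4 0 1 6)))) (on 3 6 (on 2 3 (fuse 0 2 1 3 (on 1 4 (clash 3 1
      4) (on 2 4 (dia≠ 2 0 4 3) (on 4 6 (at4 0 4 6 1 2) (at4 0 4 0 1 6))))) (at4 0 2 0 3 6)) (at4 0 3 0 1 6)))))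
      (on 1 3 (on 1 4 (dia≠ 1 0 4 3) (on 2 4 (dia 2 0 4 1 3) (on 4 5 (on 2 5 (fuse 1 2 0 5 (on 0 6
      (clash 5 0 6) (on 2 6 (dia≠ 2 1 6 5) (on 4 6 (at4 0 4 6 1 2) (at4 0 4 0 1 6))))) (at4 0 2 1 5 4)) (at4 0 4 0 1
      5)))) (on 3 5 (on 3 6 (on 4 5 (on 4 6 (on 1 4 (dia≠ 1 4 5 6) (on 2 4 (on 2 3 (dia≠ 2 0 3 4)
      (on 2 5 (on 2 6 (dia≠ 2 1 6 5) (at4 0 2 1 6 3)) (at4 0 2 1 5 3))) (on 2 5 (on 2 6 (dia≠ 2 1 6 5) (at4 0
      2 1 6 4)) (at4 0 2 1 5 4)))) (at4 0 4 5 3 6)) (at4 0 4 0 3 5)) (at4 0 3 5 1 6)) (at4 0 3 0 1 5))))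
      (((xy ∷ xz ∷ []) ∷ (yz ∷ []) ∷ [] ∷ []) ∷ (xu ∷ xw ∷ []) ∷ (uw ∷ []) ∷ ((u≢w ∷ []) ∷ [])
        ∷ (yu ∷ yw ∷ []) ∷ (uw′ ∷ []) ∷ ((u′≢w′ ∷ []) ∷ []) ∷ []))
      where open Refutation G df av (at (x ∷ y ∷ z ∷ u ∷ w ∷ u′ ∷ w′ ∷ []) x)

    -- At most one vertex of the triangle fails to be simplicial. An adjacent pair is supplied
    -- because the exchange of colours next to a maximum clique needs two simplicial vertices.
    triangle-simplicial : ∀ {x y z} → x ~ y → x ~ z → y ~ z →
      ∃₂ λ u w → u ~ w × Simplicial G u × Simplicial G w × (∃[ t ] u ~ t × w ~ t)
    triangle-simplicial xy xz yz with edge-simplicial xy xz yz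
    ... | inj₁ sx with edge-simplicial yz (~-sym xy) (~-sym xz)
    ...   | inj₁ sy = _ , _ , xy , sx , sy , _ , xz , yz
    ...   | inj₂ sz = _ , _ , xz , sx , sz , _ , xy , ~-sym yz
    triangle-simplicial xy xz yz | inj₂ sy with edge-simplicial xz xy (~-sym yz)
    ...   | inj₁ sx = _ , _ , xy , sx , sy , _ , xz , yz
    ...   | inj₂ sz = _ , _ , yz , sy , sz , _ , ~-sym xy , ~-sym xz

  module _ (df : DiamondFree) (av : Avoids (path 4 ∷ complete 3 ∷ [])) where

    -- If `w` has a second neighbour `x`, each neighbour u of `v` is adjacent to `x`, since
    -- otherwise u v w x is an induced path; so `v` can be coloured like `x`. If not, `w` is a leaf
    -- at `v`.
    two-colour-step : Critical G 2 → Colourable G 2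
    two-colour-step crit with 𝔽.any? (λ v → 𝔽.any? (v ~?_))
    ... | no none = (λ _ → zero) , λ x y xy → contradiction (x , y , xy) none
    ... | yes (v , w , vw) with 𝔽.any? (λ x → ¬? (x ≟ v) ×-dec (x ~? w))
    ...   | yes (x , x≢v , xw) = let c , off = crit v in
      extend {G = G} off (c x) λ {u} vu → off (≢-sym (~⇒≢ vu)) x≢v (twin vu)
      where
      twin : ∀ {u} → v ~ u → u ~ x
      twin {u} vu = decidable-stable (u ~? x) λ u≁x → refute
        (star 0 [ 1 ] ∷ star 1 [ 2 ] ∷ star 2 [ 3 ] ∷ anti 0 [ 3 ] ∷ [])
        (on 0 2 (at3 1 0 2 1) (on 1 3 (at3 1 1 3 2) (at4 0 3 2 1 0)))
        ((~-sym vu ∷ []) ∷ (vw ∷ []) ∷ (~-sym xw ∷ []) ∷ (¬~⇒≁ u≁x ∷ []) ∷ [])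
        where open Refutation G df av (at (u ∷ v ∷ w ∷ x ∷ []) u)
    ...   | no none = let c , off = crit w in
      extend-few {G = G} off (c v ∷ []) (s≤s (s≤s z≤n)) λ {u} wu →
        here (cong c (decidable-stable (u ≟ v) λ u≢v → none (u , u≢v , ~-sym wu)))

cograph-colourable : ∀ j {n} (G : Graph n) → Adjacency.DiamondFree G →
  Adjacency.Avoids G (path 4 ∷ complete (3 + j) ∷ []) → Colourable G (2 + j)
cograph-colourable j = critical-induction _ (suc j) step
  where
  step : ∀ {n} (G : Graph n) → Adjacency.DiamondFree G → Adjacency.Avoids G (path 4 ∷ complete (3 + j) ∷ []) →
         Critical G (2 + j) → Colourable G (2 + j)
  step G df av@(p4 ∷ km ∷ []) crit with occurs? G (complete 3)
  ... | no none = Colourable-≤ {G = G} (s≤s (s≤s z≤n))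
    (critical-induction _ 1 (λ G → two-colour-step {G = G}) G df (p4 ∷ (λ vs ind → none (vs , ind)) ∷ []))
  ... | yes (x ∷ y ∷ z ∷ [] , ind) with (xy ∷ xz ∷ []) ∷ (yz ∷ []) ∷ [] ∷ [] , _ ← complete⇒pairs G 3 _ ind
    with _ , _ , _ , su , _ ← triangle-simplicial {G = G} df (p4 ∷ []) xy xz yz =
    remove-simplicial G crit (avoids⇒no-clique G km) su

-- Colouring the subgraph induced by a decidable set

module _ {n} {G : Graph n} {P : Fin n → Set} (P? : ∀ x → Dec (P x)) where

  open Adjacency G

  private
    G∣P : Graph n
    G∣P = restrict G (does ∘ P?)

    holds : ∀ {x} → does (P? x) ≡ true → P x
    holds {x} e with P? x
    ... | yes p = p

  restricted-edge : ∀ {x y} → Adjacency._~_ G∣P x y → x ~ y × P x × P y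
  restricted-edge {x} {y} e with adj G x y | does (P? x) in p | does (P? y) in q
  ... | true | true | true = refl , holds p , holds q

  restrict-edge : ∀ {x y} → P x → P y → x ~ y → Adjacency._~_ G∣P x y
  restrict-edge {x} {y} px py xy rewrite xy | dec-true (P? x) px | dec-true (P? y) py = refl

  restrict-DiamondFree : DiamondFree → Adjacency.DiamondFree G∣P
  restrict-DiamondFree df xy xc xd yc yd cd =
    df (e xy) (e xc) (e xd) (e yc) (e yd)
       (¬~⇒≁ λ c~d → Adjacency.~⇒¬≁ G∣P (restrict-edge (end xc) (end xd) c~d) cd)
    where
    e : ∀ {x y} → Adjacency._~_ G∣P x y → x ~ y
    e = proj₁ ∘ restricted-edge
    end : ∀ {x y} → Adjacency._~_ G∣P x y → P y
    end = proj₂ ∘ proj₂ ∘ restricted-edge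

  restrict-Induces : ∀ s vs → All P vs → Adjacency.Induces G∣P s vs → Induces s vs
  restrict-Induces []       []       _        _       = tt
  restrict-Induces (r ∷ rs) (v ∷ vs) (p ∷ ps) (q , i) = go r vs ps q , restrict-Induces rs vs ps i
    where
    go : ∀ r vs → All P vs → Pointwise (λ b w → adj G∣P v w ≡ b) r vs → Pointwise (λ b w → adj G v w ≡ b) r vs
    go []      []       _        _       = []
    go (b ∷ r) (w ∷ vs) (q ∷ qs) (e ∷ es) = trans (sym same) e ∷ go r vs qs es
      where
      same : adj G∣P v w ≡ adj G v w
      same rewrite dec-true (P? v) p | dec-true (P? w) q = 𝔹.∧-identityʳ (adj G v w)

  restrict-path : (∀ {a b c d} → All P (a ∷ b ∷ c ∷ d ∷ []) → ¬ Induces (path 4) (a ∷ b ∷ c ∷ d ∷ [])) →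
                  ∀ vs → ¬ Adjacency.Induces G∣P (path 4) vs
  restrict-path none vs@(a ∷ b ∷ c ∷ d ∷ []) i@((ab ∷ _) , (bc ∷ _) , (cd ∷ _) , _) =
    none ps (restrict-Induces (path 4) vs ps i)
    where
    ps : All P vs
    ps with _ , pa , pb ← restricted-edge ab | _ , pc , pd ← restricted-edge cd = pa ∷ pb ∷ pc ∷ pd ∷ []

  restrict-complete : ∀ k → (∀ vs → All P vs → ¬ Induces (complete (2 + k)) vs) →
                      ∀ vs → ¬ Adjacency.Induces G∣P (complete (2 + k)) vs
  restrict-complete k none vs@(v ∷ w ∷ ws) i with pv ∷ _ , _ ← complete⇒pairs G∣P (2 + k) vs i =
    none vs ps (restrict-Induces (complete (2 + k)) vs ps i)
    where
    ps : All P vs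
    ps = proj₁ (proj₂ (restricted-edge (All.head pv))) ∷ All.map (proj₂ ∘ proj₂ ∘ restricted-edge) pv

  -- The colouring is defined everywhere but proper only inside `P`, so colourings of several parts
  -- combine without renaming vertices.
  colour-within : ∀ j → DiamondFree →
    (∀ {a b c d} → All P (a ∷ b ∷ c ∷ d ∷ []) → ¬ Induces (path 4) (a ∷ b ∷ c ∷ d ∷ [])) →
    (∀ vs → All P vs → ¬ Induces (complete (3 + j)) vs) →
    Σ[ c ∈ (Fin n → Fin (2 + j)) ] (∀ {x y} → P x → P y → x ~ y → c x ≢ c y)
  colour-within j df p4 km =
    let c , proper = cograph-colourable j G∣P (restrict-DiamondFree df)
                       (restrict-path p4 ∷ restrict-complete (suc j) km ∷ [])
    in c , λ px py xy → proper _ _ (restrict-edge px py xy)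

-- A maximum clique whose complement induces a cograph

module MaximumClique {n} {G : Graph n} (df : Adjacency.DiamondFree G)
                     {m} (maximum : ¬ HasClique G (suc m)) (K : HasClique G m) where

  open Adjacency G

  κ : Fin m → Fin n
  κ = proj₁ K

  κ-~ : ∀ {i j} → i ≢ j → κ i ~ κ j
  κ-~ = proj₂ (proj₂ K) _ _

  κ-injective : ∀ {i j} → κ i ≡ κ j → i ≡ j
  κ-injective = proj₁ (proj₂ K)

  Outside : Fin n → Set
  Outside x = ∀ i → x ≢ κ i

  position : ∀ x → (∃[ i ] x ≡ κ i) ⊎ Outside x
  position x with 𝔽.any? (λ i → x ≟ κ i)
  ... | yes p   = inj₁ p
  ... | no none = inj₂ λ i e → none (i , e)

  outside? : ∀ x → Dec (Outside x)
  outside? x = 𝔽.all? λ i → ¬? (x ≟ κ i)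

  -- With two contacts `κ i` and `κ j`, the vertex `x` and any third `κ l` are common neighbours of
  -- an edge, hence adjacent. Then `x` would enlarge the maximum clique.
  unique-contact : ∀ {x i j} → Outside x → x ~ κ i → x ~ κ j → i ≡ j
  unique-contact {x} {i} {j} out xi xj = decidable-stable (i ≟ j) λ i≢j → maximum (bigger i≢j)
    where
    meets : i ≢ j → ∀ l → x ~ κ l
    meets i≢j l with l ≟ i | l ≟ j
    ... | yes refl | _        = xi
    ... | no _     | yes refl = xj
    ... | no l≢i   | no l≢j   = decidable-stable (x ~? κ l) λ x≁l →
      out l (df (κ-~ i≢j) (~-sym xi) (κ-~ (≢-sym l≢i)) (~-sym xj) (κ-~ (≢-sym l≢j)) (¬~⇒≁ x≁l))
    bigger : i ≢ j → HasClique G (suc m)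
    bigger i≢j = subst (HasClique G ∘ suc) (length-tabulate κ)
      (list-clique G (x ∷ List.tabulate κ) (All.tabulate⁺ (meets i≢j) ∷ AllPairs.tabulate⁺ κ-~))

  contact : ∀ x → (∃[ i ] x ~ κ i) ⊎ (∀ i → x ≁ κ i)
  contact x with 𝔽.any? (λ i → x ~? κ i)
  ... | yes p   = inj₁ p
  ... | no none = inj₂ λ i → ¬~⇒≁ λ e → none (i , e)

  module _ (cograph : ∀ {a b c d} → All Outside (a ∷ b ∷ c ∷ d ∷ []) → ¬ Induces (path 4) (a ∷ b ∷ c ∷ d ∷ [])) where

    private
      H : Graph n
      H = restrict G (does ∘ outside?)

      open Adjacency H using () renaming (_~_ to _≈_)

      H⇒G : ∀ {x y} → x ≈ y → x ~ y
      H⇒G = proj₁ ∘ restricted-edge {G = G} outside?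

      outsideˡ : ∀ {x y} → x ≈ y → Outside x
      outsideˡ = proj₁ ∘ proj₂ ∘ restricted-edge {G = G} outside?

      outsideʳ : ∀ {x y} → x ≈ y → Outside y
      outsideʳ = proj₂ ∘ proj₂ ∘ restricted-edge {G = G} outside?

      G⇒H : ∀ {x y} → Outside x → Outside y → x ~ y → x ≈ y
      G⇒H = restrict-edge {G = G} outside?

      maximum-H : ¬ HasClique H (suc m)
      maximum-H (f , inj , a) = maximum (f , inj , λ i j i≢j → H⇒G (a i j i≢j))

      by-contact : ∀ {y} {P : Fin n → Set} → Outside y →
                   (∀ {w} → y ≈ w → P w) → (∀ {i} → y ~ κ i → P (κ i)) → ∀ {w} → y ~ w → P w
      by-contact out p q {w} yw with position w
      ... | inj₁ (i , refl) = q yw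
      ... | inj₂ out′       = p (G⇒H out out′ yw)

    module _ {k} (m≤k : m ≤ k) (crit : Critical G k) where

      private
        -- Enough if y has no neighbour in K, or if its neighbour in K repeats a colour.
        few : ∀ {y} → Outside y → Simplicial H y →
              (∀ {i} → y ~ κ i → proj₁ (crit y) (κ i) ∈ map (proj₁ (crit y)) (neighbours H y)) → Colourable G k
        few {y} out simp repeats = let c , off = crit y in
          extend-few {G = G} off (map c (neighbours H y))
            (subst (_< k) (sym (length-map c (neighbours H y)))
              (ℕ.<-≤-trans (simplicial-degree H maximum-H simp) m≤k))
            (by-contact out (λ e → ∈-map⁺ c (∈-neighbours H e)) repeats)

        -- Uncolour y′, give its colour to y, and colour y′ like the neighbour of y in K.
        swap : ∀ {y y′ i i′} → y ≈ y′ → Simplicial H y → Simplicial H y′ → y ~ κ i → y′ ~ κ i′ → i ≢ i′ →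
               proj₁ (crit y) (κ i) ∉ map (proj₁ (crit y)) (neighbours H y) → Colourable G k
        swap {y} {y′} {i} {i′} yy′ simp simp′ yi yi′ i≢i′ fresh = extend {G = G} off₁ (c (κ i)) free
          where
          c = proj₁ (crit y)
          off = proj₂ (crit y)
          out = outsideˡ yy′
          out′ = outsideʳ yy′
          y′≢y : y′ ≢ y
          y′≢y = ≢-sym (~⇒≢ (H⇒G yy′))
          new : ∀ {w} → y ≈ w → c w ≢ c (κ i)
          new yw e = fresh (subst (_∈ map c (neighbours H y)) e (∈-map⁺ c (∈-neighbours H yw)))
          c₁ = c [ y ↦ c y′ ]
          c₁y = update-same c y (c y′)
          c₁≢ : ∀ {x} → x ≢ y → c₁ x ≡ c x
          c₁≢ = update-other c (c y′)
          -- At `y` the colour of `y′` causes no clash: a neighbour outside K is adjacent to `y′`,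
          -- since `y` is simplicial in `H`, and the contact `κ i` has a colour absent from the
          -- neighbours of `y` in `H`, among them `y′`.
          clear : ∀ {w} → y ~ w → w ≢ y′ → c w ≢ c y′
          clear yw w≢y′ = by-contact {P = λ w → w ≢ y′ → c w ≢ c y′} out
            (λ {w} yw w≢y′ → off (≢-sym (~⇒≢ (H⇒G yw))) y′≢y (H⇒G (simp yw yy′ w≢y′)))
            (λ yj _ e → new yy′ (trans (sym e) (cong (c ∘ κ) (unique-contact out yj yi)))) yw w≢y′
          off₁ : ProperOff G y′ c₁
          off₁ {x} {z} x≢ z≢ xz with x ≟ y | z ≟ y
          ... | yes refl | yes refl = contradiction refl (~⇒≢ xz)
          ... | yes refl | no _     = ≢-sym (clear xz z≢)
          ... | no _     | yes refl = clear (~-sym xz) x≢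
          ... | no x≢y   | no z≢y   = off x≢y z≢y xz
          -- A neighbour of `y′` in `H` other than `y` is also a neighbour of `y`, so it lacks the
          -- fresh colour; the contact of `y′` is not `κ i`.
          free : ∀ {w} → y′ ~ w → c₁ w ≢ c (κ i)
          free = by-contact out′
            (λ {w} y′w → λ e → case w ≟ y of λ
              { (yes refl) → new yy′ (trans (sym c₁y) e)
              ; (no w≢y) → new (Adjacency.~-sym H (simp′ y′w (Adjacency.~-sym H yy′) w≢y)) (trans (sym (c₁≢ w≢y)) e) })
            (λ {j} y′j e → off (≢-sym (out j)) (≢-sym (out i))
              (κ-~ λ { refl → i≢i′ (unique-contact out′ y′j yi′) })
              (trans (sym (c₁≢ (≢-sym (out j)))) e))

        -- Any further neighbour `w` of `y` outside K is adjacent to `y′`, so `κ i` and `w` are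
        -- common neighbours of an edge. Thus `κ i` extends the clique around `y`, which makes `y`
        -- simplicial in `G`.
        joins : ∀ {y y′ i w} → y ≈ y′ → Simplicial H y → y ~ κ i → y′ ~ κ i → Outside w → y ~ w → κ i ~ w
        joins {y} {y′} {i} {w} yy′ simp yi y′i ow yw with w ≟ y′
        ... | yes refl = ~-sym y′i
        ... | no w≢y′  = decidable-stable (κ i ~? w) λ i≁w → ow i (sym
          (df (H⇒G yy′) yi yw y′i (H⇒G (simp yy′ (G⇒H (outsideˡ yy′) ow yw) (≢-sym w≢y′))) (¬~⇒≁ i≁w)))

        shared : ∀ {y y′ i} → y ≈ y′ → Simplicial H y → y ~ κ i → y′ ~ κ i → Simplicial G y
        shared {y} {y′} {i} yy′ simp yi y′i {u} {w} yu yw u≢w with position u | position w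
        ... | inj₁ (a , refl) | inj₁ (b , refl) = κ-~ λ { refl → u≢w refl }
        ... | inj₁ (a , refl) | inj₂ ow with refl ← unique-contact (outsideˡ yy′) yu yi = joins yy′ simp yi y′i ow yw
        shared yy′ simp yi y′i yu yw u≢w | inj₂ ou | inj₁ (b , refl)
          with refl ← unique-contact (outsideˡ yy′) yw yi = ~-sym (joins yy′ simp yi y′i ou yu)
        shared yy′ simp yi y′i yu yw u≢w | inj₂ ou | inj₂ ow =
          H⇒G (simp (G⇒H (outsideˡ yy′) ou yu) (G⇒H (outsideˡ yy′) ow yw) u≢w)

        -- A vertex of the pair without contact has a free colour; a common contact makes `y`
        -- simplicial in `G`; distinct contacts either repeat a colour or allow the exchange.
        with-triangle : ∀ {y y′} → y ≈ y′ → Simplicial H y → Simplicial H y′ → Colourable G k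
        with-triangle {y} {y′} yy′ simp simp′ with contact y | contact y′
        ... | inj₂ none | _ = few (outsideˡ yy′) simp λ yi → contradiction (none _) (~⇒¬≁ yi)
        ... | inj₁ _ | inj₂ none = few (outsideʳ yy′) simp′ λ yi → contradiction (none _) (~⇒¬≁ yi)
        ... | inj₁ (i , yi) | inj₁ (i′ , y′i′) with i ≟ i′
        ...   | yes refl = remove-simplicial G crit (λ big → maximum (clique-≤ G (s≤s m≤k) big)) (shared yy′ simp yi y′i′)
        ...   | no i≢i′ with Any.any? (proj₁ (crit y) (κ i) ≟_) (map (proj₁ (crit y)) (neighbours H y))
        ...     | yes old  = few (outsideˡ yy′) simp λ yj →
          subst (λ l → proj₁ (crit y) (κ l) ∈ map (proj₁ (crit y)) (neighbours H y))
                (unique-contact (outsideˡ yy′) yi yj) old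
        ...     | no fresh = swap yy′ simp simp′ yi y′i′ i≢i′ fresh

      -- Without triangles outside K, one side of the bipartition uses the
      -- colours of κ 0 and κ 1, the other those of κ 2 and κ 3.
      cograph-outside⇒colourable : 4 ≤ m → Colourable G k
      cograph-outside⇒colourable 4≤m with occurs? H (complete 3)
      ... | yes (x ∷ y ∷ z ∷ [] , ind) with (xy ∷ xz ∷ []) ∷ (yz ∷ []) ∷ [] ∷ [] , _ ← complete⇒pairs H 3 _ ind
        with _ , _ , uw , su , sw , _ ← triangle-simplicial {G = H} (restrict-DiamondFree {G = G} outside? df)
               (restrict-path {G = G} outside? cograph ∷ []) xy xz yz = with-triangle uw su sw
      ... | no none = Colourable-≤ {G = G} m≤k (c , proper)
        where
        bip : Σ[ s ∈ (Fin n → Fin 2) ] (∀ {x y} → Outside x → Outside y → x ~ y → s x ≢ s y)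
        bip = colour-within {G = G} outside? 0 df cograph λ
          { (x ∷ y ∷ z ∷ []) (ox ∷ oy ∷ oz ∷ []) ((xy ∷ xz ∷ []) , (yz ∷ []) , _) →
            none (x ∷ y ∷ z ∷ [] , (G⇒H ox oy xy ∷ G⇒H ox oz xz ∷ []) , (G⇒H oy oz yz ∷ []) , [] , tt) }
        s = proj₁ bip
        -- A vertex outside K touches at most one of `κ i` and `κ j`, so one of their colours is
        -- free for it. Two such pairs, one per side, account for the assumption 4 ≤ m.
        choose : (i j : Fin m) → Fin n → Fin m
        choose i j x = if does (x ~? κ i) then j else i
        choose-free : ∀ {i j x} → i ≢ j → Outside x → x ≁ κ (choose i j x)
        choose-free {i} {j} {x} i≢j out with x ~? κ i
        ... | yes xi = ¬~⇒≁ λ xj → i≢j (unique-contact out xi xj)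
        ... | no x≁i = ¬~⇒≁ x≁i
        choose-disjoint : ∀ {i j i′ j′ x y} → i ≢ i′ → i ≢ j′ → j ≢ i′ → j ≢ j′ → choose i j x ≢ choose i′ j′ y
        choose-disjoint {i} {j} {i′} {j′} {x} {y} p q r t with does (x ~? κ i) | does (y ~? κ i′)
        ... | false | false = p
        ... | false | true  = q
        ... | true  | false = r
        ... | true  | true  = t
        ι : Fin 4 → Fin m
        ι i = inject≤ i 4≤m
        ι-≢ : ∀ {i j} → i ≢ j → ι i ≢ ι j
        ι-≢ i≢j e = i≢j (𝔽.inject≤-injective 4≤m 4≤m _ _ e)
        slot : Fin 2 → Fin n → Fin m
        slot 0F = choose (ι 0F) (ι 1F)
        slot 1F = choose (ι 2F) (ι 3F)
        slot-free : ∀ q {x} → Outside x → x ≁ κ (slot q x)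
        slot-free 0F = choose-free (ι-≢ λ ())
        slot-free 1F = choose-free (ι-≢ λ ())
        slot-disjoint : ∀ {x y} → slot 0F x ≢ slot 1F y
        slot-disjoint {x} {y} = choose-disjoint {x = x} {y} (ι-≢ λ ()) (ι-≢ λ ()) (ι-≢ λ ()) (ι-≢ λ ())
        slot-≢ : ∀ {q r x y} → q ≢ r → slot q x ≢ slot r y
        slot-≢ {0F} {0F} q≢r = contradiction refl q≢r
        slot-≢ {0F} {1F} {x} {y} _ = slot-disjoint {x} {y}
        slot-≢ {1F} {0F} {x} {y} _ = ≢-sym (slot-disjoint {y} {x})
        slot-≢ {1F} {1F} q≢r = contradiction refl q≢r
        c : Fin n → Fin m
        c x with position x
        ... | inj₁ (i , _) = i
        ... | inj₂ _       = slot (s x) x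
        proper : ∀ x y → x ~ y → c x ≢ c y
        proper x y xy with position x | position y
        ... | inj₁ (i , refl) | inj₁ (j , refl) = λ { refl → ~⇒≢ xy refl }
        ... | inj₁ (i , refl) | inj₂ oy = λ { refl → ~⇒¬≁ (~-sym xy) (slot-free (s y) oy) }
        ... | inj₂ ox | inj₁ (j , refl) = λ { refl → ~⇒¬≁ xy (slot-free (s x) ox) }
        ... | inj₂ ox | inj₂ oy = slot-≢ {x = x} {y} (proj₂ bip ox oy xy)

  -- Paths outside large cliques

  Path : (a b c d : Fin n) → Set
  Path a b c d = Induces (path 4) (a ∷ b ∷ c ∷ d ∷ [])

  reverse-path : ∀ {a b c d} → Path a b c d → Path d c b a
  reverse-path ((ab ∷ ac ∷ ad ∷ []) , (bc ∷ bd ∷ []) , (cd ∷ []) , _) =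
    (~-sym cd ∷ ≁-sym bd ∷ ≁-sym ad ∷ []) , (~-sym bc ∷ ≁-sym ac ∷ []) , (~-sym ab ∷ []) , [] , tt

  -- `i₀` stands in for the contact of a vertex that has none.
  sole-contact : Fin m → ∀ x → Outside x → ∃[ i ] (∀ l → l ≢ i → x ≁ κ l)
  sole-contact i₀ x out with contact x
  ... | inj₁ (i , xi) = i , λ l l≢i → ¬~⇒≁ λ xl → l≢i (unique-contact out xl xi)
  ... | inj₂ none     = i₀ , λ l _ → none l

  Path₄ : (Fin 4 → Fin n) → Set
  Path₄ x = Path (x 0F) (x 1F) (x 2F) (x 3F)

  module _ (av : Avoids (P₂+P₄ ∷ [])) where

    -- `L` lists all vertices of K that the path may touch. Two vertices of K off this list supply
    -- the P₂.
    few-contacts : ∀ {x} → Path₄ x → (L : List (Fin m)) → 1 + length L < m →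
                   (∀ l → l ∉ L → ∀ q → x q ≁ κ l) → ⊥
    few-contacts {x} p L L<m clear
      with i , i∉L ← free-colour L (ℕ.<-trans (ℕ.n<1+n _) L<m)
      with j , j∉iL ← free-colour (i ∷ L) L<m =
      All.head av (κ i ∷ κ j ∷ x 0F ∷ x 1F ∷ x 2F ∷ x 3F ∷ [])
        ( (κ-~ (λ { refl → j∉iL (here refl) }) ∷ miss i∉L 0F ∷ miss i∉L 1F ∷ miss i∉L 2F ∷ miss i∉L 3F ∷ [])
        , (miss (j∉iL ∘ there) 0F ∷ miss (j∉iL ∘ there) 1F ∷ miss (j∉iL ∘ there) 2F ∷ miss (j∉iL ∘ there) 3F ∷ []) , p)
      where
      miss : ∀ {l} → l ∉ L → ∀ q → κ l ≁ x q
      miss l∉L q = ≁-sym (clear _ l∉L q)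

    no-path-outside : 6 ≤ m → ∀ {x} → (∀ q → Outside (x q)) → ¬ Path₄ x
    no-path-outside 6≤m {x} out p = few-contacts p (map t (allFin 4)) 6≤m
      λ l l∉ q → proj₂ (sole q) l λ { refl → l∉ (∈-map⁺ t (∈-allFin q)) }
      where
      sole : ∀ q → ∃[ i ] (∀ l → l ≢ i → x q ≁ κ l)
      sole q = sole-contact (inject≤ {6} 0F 6≤m) (x q) (out q)
      t : Fin 4 → Fin m
      t = proj₁ ∘ sole

    -- If two contacts coincided or one were missing, the path would touch at most three vertices of
    -- K and leave two for the P₂.
    path-contacts : 5 ≤ m → ∀ {x} → (∀ q → Outside (x q)) → Path₄ x →
                    Σ[ t ∈ (Fin 4 → Fin m) ] Injective _≡_ _≡_ t × (∀ q → x q ~ κ (t q))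
    path-contacts 5≤m {x} out p = t , injective , touches
      where
      sole : ∀ q → ∃[ i ] (∀ l → l ≢ i → x q ≁ κ l)
      sole q = sole-contact (inject≤ {5} 0F 5≤m) (x q) (out q)
      t : Fin 4 → Fin m
      t = proj₁ ∘ sole
      others : Fin 4 → List (Fin m)
      others q = map (t ∘ punchIn q) (allFin 3)
      ∈-others : ∀ {q r} → q ≢ r → t r ∈ others q
      ∈-others {q} {r} q≢r = subst (λ s → t s ∈ others q) (𝔽.punchIn-punchOut q≢r)
        (∈-map⁺ (t ∘ punchIn q) (∈-allFin (punchOut q≢r)))
      essential : ∀ q → ¬ (∀ l → l ∉ others q → x q ≁ κ l)
      essential q miss = few-contacts p (others q) 5≤m λ l l∉ r → case q ≟ r of λ
        { (yes refl) → miss l l∉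
        ; (no q≢r)   → proj₂ (sole r) l λ { refl → l∉ (∈-others q≢r) } }
      injective : Injective _≡_ _≡_ t
      injective {q} {r} e = decidable-stable (q ≟ r) λ q≢r → essential q λ l l∉ →
        proj₂ (sole q) l λ { refl → l∉ (subst (_∈ others q) (sym e) (∈-others q≢r)) }
      touches : ∀ q → x q ~ κ (t q)
      touches q = decidable-stable (x q ~? κ (t q)) λ x≁t → essential q λ l _ → case l ≟ t q of λ
        { (yes refl) → ¬~⇒≁ x≁t
        ; (no l≢t)   → proj₂ (sole q) l l≢t }

    -- Names in the certificates: 0 to 3 are the contacts of the path, 4 is a vertex of K that the
    -- path misses, 5 to 8 are the path, and further vertices start at 9.
    module _ {x : Fin 4 → Fin n} (out : ∀ q → Outside (x q)) (p : Path₄ x)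
             {t : Fin 4 → Fin m} (t-injective : Injective _≡_ _≡_ t) (touches : ∀ q → x q ~ κ (t q))
             {e : Fin m} (t≢e : ∀ q → t q ≢ e) where

      private
        env : Fin n → Fin n → Fin n → ℕ → Fin n
        env y z w = at (κ (t 0F) ∷ κ (t 1F) ∷ κ (t 2F) ∷ κ (t 3F) ∷ κ e ∷ x 0F ∷ x 1F ∷ x 2F ∷ x 3F ∷ y ∷ z ∷ w ∷ []) y

        open module R y z w = Refutation G df av (env y z w) using () renaming (⟦_⟧ to Holds)

        frame : List Hyp
        frame = clique (0 ⋯ 4) ∷ shape (path 4) (5 ⋯ 8)
              ∷ star 5 [ 0 ] ∷ anti 5 (1 ⋯ 4) ∷ star 6 [ 1 ] ∷ anti 6 (0 ∷ 2 ∷ 3 ∷ 4 ∷ [])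
              ∷ star 7 [ 2 ] ∷ anti 7 (0 ∷ 1 ∷ 3 ∷ 4 ∷ []) ∷ star 8 [ 3 ] ∷ anti 8 (0 ∷ 1 ∷ 2 ∷ 4 ∷ []) ∷ []

        misses : ∀ {y i l} → Outside y → y ~ κ i → i ≢ l → y ≁ κ l
        misses out yi i≢l = ¬~⇒≁ λ yl → i≢l (unique-contact out yi yl)

        t-≢ : ∀ {q r} → q ≢ r → t q ≢ t r
        t-≢ q≢r e = q≢r (t-injective e)

        frame-holds : ∀ y z w → All (Holds y z w) frame
        frame-holds y z w =
            ((k₁ (λ ()) ∷ k₁ (λ ()) ∷ k₁ (λ ()) ∷ k₂ ∷ []) ∷ (k₁ (λ ()) ∷ k₁ (λ ()) ∷ k₂ ∷ []) ∷
             (k₁ (λ ()) ∷ k₂ ∷ []) ∷ (k₂ ∷ []) ∷ [] ∷ [])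
          ∷ p ∷ (touches 0F ∷ []) ∷ (m₁ (λ ()) ∷ m₁ (λ ()) ∷ m₁ (λ ()) ∷ m₂ ∷ [])
          ∷ (touches 1F ∷ []) ∷ (m₁ (λ ()) ∷ m₁ (λ ()) ∷ m₁ (λ ()) ∷ m₂ ∷ [])
          ∷ (touches 2F ∷ []) ∷ (m₁ (λ ()) ∷ m₁ (λ ()) ∷ m₁ (λ ()) ∷ m₂ ∷ [])
          ∷ (touches 3F ∷ []) ∷ (m₁ (λ ()) ∷ m₁ (λ ()) ∷ m₁ (λ ()) ∷ m₂ ∷ []) ∷ []
          where
          m₁ : ∀ {q r} → q ≢ r → x q ≁ κ (t r)
          m₁ {q} q≢r = misses (out q) (touches q) (t-≢ q≢r)
          m₂ : ∀ {q} → x q ≁ κ e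
          m₂ {q} = misses (out q) (touches q) (t≢e q)
          k₁ : ∀ {q r} → q ≢ r → κ (t q) ~ κ (t r)
          k₁ q≢r = κ-~ (t-≢ q≢r)
          k₂ : ∀ {q} → κ (t q) ~ κ e
          k₂ {q} = κ-~ (t≢e q)

      -- Together with the next two lemmas and the reversed path, this makes the outside neighbours
      -- of every `κ i` independent: `κ i` is the contact of an end, the contact of an inner vertex,
      -- or untouched by the path.
      no-edge-end : ∀ {y z} → Outside y → Outside z → y ~ κ (t 0F) → z ~ κ (t 0F) → ¬ y ~ z
      no-edge-end {y} {z} oy oz yi zi yz = R.refute y z y
        (frame ++ star 9 (0 ∷ 10 ∷ []) ∷ star 10 [ 0 ] ∷ anti 9 (1 ⋯ 4) ∷ anti 10 (1 ⋯ 4) ∷ [])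
        (on 6 9 (on 5 9 (dia 5 9 0 6 2) (on 6 10 (dia 10 9 6 0 7) (on 5 10 (on 7 10 (on 8 10 (at6 0 2 4 8
        10 5 6) (at6 0 1 4 8 7 10 5)) (at6 0 3 4 7 6 5 10)) (at6 0 2 3 5 6 9 10)))) (on 5 9 (on 7 9 (on 8 9 (at6 0
        2 4 8 9 5 6) (at6 0 1 4 8 7 9 5)) (at6 0 3 4 7 6 5 9)) (on 5 10 (dia 10 0 5 9 6) (on 6 10 (at6 0 2 3 5 6 10 9)
        (at6 0 10 9 5 6 1 2)))))
        (All.++⁺ (frame-holds y z y)
          ((yi ∷ yz ∷ []) ∷ (zi ∷ []) ∷ miss oy yi ∷ miss oz zi ∷ []))
        where
        miss : ∀ {y} → Outside y → y ~ κ (t 0F) → All (y ≁_) (κ (t 1F) ∷ κ (t 2F) ∷ κ (t 3F) ∷ κ e ∷ [])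
        miss o yi = misses o yi (t-≢ λ ()) ∷ misses o yi (t-≢ λ ()) ∷ misses o yi (t-≢ λ ()) ∷ misses o yi (t≢e 0F) ∷ []

      no-edge-middle : ∀ {y z} → Outside y → Outside z → y ~ κ (t 1F) → z ~ κ (t 1F) → ¬ y ~ z
      no-edge-middle {y} {z} oy oz yi zi yz = R.refute y z y
        (frame ++ star 9 (1 ∷ 10 ∷ []) ∷ star 10 [ 1 ] ∷ anti 9 (0 ∷ 2 ∷ 3 ∷ 4 ∷ []) ∷ anti 10 (0 ∷ 2 ∷ 3 ∷ 4 ∷ []) ∷ [])
        (on 5 9 (on 5 10 (dia 10 9 5 1 2) (on 6 9 (dia 6 9 1 5 2) (on 6 10 (on 7 10 (dia 10 6 7 1 8) (on 8
        10 (at6 0 2 4 8 10 6 5) (at6 0 0 4 8 7 6 10))) (at6 0 2 3 6 5 9 10)))) (on 7 9 (on 6 9 (dia 6 9 1 7 0) (at6 0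
        3 4 9 7 6 5)) (on 8 9 (on 6 9 (at6 0 2 4 5 6 9 8) (at6 0 0 4 6 7 8 9)) (at6 0 8 7 9 1 0 5))))
        (All.++⁺ (frame-holds y z y)
          ((yi ∷ yz ∷ []) ∷ (zi ∷ []) ∷ miss oy yi ∷ miss oz zi ∷ []))
        where
        miss : ∀ {y} → Outside y → y ~ κ (t 1F) → All (y ≁_) (κ (t 0F) ∷ κ (t 2F) ∷ κ (t 3F) ∷ κ e ∷ [])
        miss o yi = misses o yi (t-≢ λ ()) ∷ misses o yi (t-≢ λ ()) ∷ misses o yi (t-≢ λ ()) ∷ misses o yi (t≢e 1F) ∷ []

      no-edge-off : ∀ {y z} → Outside y → Outside z → y ~ κ e → z ~ κ e → ¬ y ~ z
      no-edge-off {y} {z} oy oz yi zi yz = R.refute y z y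
        (frame ++ star 9 (4 ∷ 10 ∷ []) ∷ star 10 [ 4 ] ∷ anti 9 (0 ⋯ 3) ∷ anti 10 (0 ⋯ 3) ∷ [])
        (on 8 9 (on 8 10 (dia 10 9 8 4 7) (on 5 10 (on 5 9 (dia 9 10 5 4 6) (at6 0 1 2 5 10 9 8)) (on 6 10
        (on 6 9 (dia 9 10 6 4 5) (at6 0 0 2 6 10 9 8)) (at6 0 6 5 10 4 3 8)))) (on 7 9 (on 7 10 (dia 10 9 7 4 6)
        (on 8 10 (on 5 9 (on 5 10 (dia 10 9 5 4 6) (at6 0 1 2 5 9 10 8)) (on 5 10 (at6 0 1 3 5 10 9 7) (on 6
        10 (on 6 9 (dia 6 9 7 10 2) (at6 0 2 3 9 10 6 5)) (at6 0 6 5 8 10 4 2)))) (at6 0 0 1 8 7 9 10))) (on 5 9 (at6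
        0 7 8 5 9 4 1) (at6 0 7 8 5 0 4 9))))
        (All.++⁺ (frame-holds y z y)
          ((yi ∷ yz ∷ []) ∷ (zi ∷ []) ∷ miss oy yi ∷ miss oz zi ∷ []))
        where
        miss : ∀ {y} → Outside y → y ~ κ e → All (y ≁_) (κ (t 0F) ∷ κ (t 1F) ∷ κ (t 2F) ∷ κ (t 3F) ∷ [])
        miss o yi = misses o yi (≢-sym (t≢e 0F)) ∷ misses o yi (≢-sym (t≢e 1F)) ∷ misses o yi (≢-sym (t≢e 2F)) ∷ misses o yi (≢-sym (t≢e 3F)) ∷ []

      -- The later colouring assigns colours by contacts and cannot treat these vertices; being
      -- simplicial, they are removed by induction.
      no-contact-simplicial : ∀ {y} → (∀ i → y ≁ κ i) → Simplicial G y
      no-contact-simplicial {y} none {z} {w} yz yw z≢w = decidable-stable (z ~? w) λ z≁w → R.refute y z w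
        (frame ++ star 9 (10 ∷ 11 ∷ []) ∷ anti 9 (0 ⋯ 4) ∷ anti 10 [ 11 ] ∷ apart [ 10 ] [ 11 ]
           ∷ apart (10 ∷ 11 ∷ []) (0 ⋯ 4) ∷ [])
        (on 5 9 (on 7 9 (on 6 9 (dia 6 9 5 7 0) (on 8 9 (at6 0 2 4 8 9 5 6) (at6 0 1 4 8 7 9 5))) (on 6 9
        (on 8 9 (at6 0 1 4 7 8 9 5) (at6 0 0 4 8 7 6 9)) (at6 0 3 4 9 5 6 7))) (on 8 9 (on 6 9 (at6 0 2 4 5 6 9 8)
        (at6 0 6 5 9 8 3 2)) (on 6 9 (on 7 9 (on 6 10 (on 6 11 (dia≠ 6 9 11 10) (on 7 11 (dia 7 9 11 6 10)
        (on 8 11 (on 0 11 (on 3 11 (dia 3 11 0 8 1) (on 1 11 (dia≠ 1 0 11 3) (on 2 11 (dia≠ 2 0 11 1) (on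
        4 11 (dia≠ 4 0 11 1) (at6 0 4 2 8 11 9 6))))) (on 2 11 (on 4 11 (dia≠ 4 2 11 0) (at6 0 4 0 11 8 7 6)) (at6 0 2
        0 8 11 9 6))) (on 4 11 (on 5 11 (on 0 11 (dia 0 11 4 5 1) (on 1 11 (dia≠ 1 4 11 0) (at6 0 7 8 1 4 11
        5))) (at6 0 11 4 5 6 7 8)) (on 0 11 (on 1 11 (dia≠ 1 0 11 4) (at6 0 1 4 11 9 7 8)) (at6 0 0 4 11 9 7 8))))))
        (on 7 10 (fuse 7 9 6 10 (on 6 11 (clash 10 6 11) (on 7 11 (dia≠ 7 9 11 10) (on 0 11 (on 3 11 (on 1
        11 (on 4 11 (on 5 11 (dia 11 0 5 1 2) (on 8 11 (dia 11 3 8 0 7) (at6 0 11 4 8 7 6 5))) (dia≠ 0 1 4 11))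
        (dia≠ 0 3 1 11)) (on 1 11 (dia≠ 1 0 11 3) (on 2 11 (dia≠ 2 0 11 1) (on 5 11 (at6 0 1 3 5 11 9 7) (at6 0 2 3
        5 6 9 11))))) (on 4 11 (on 1 11 (dia≠ 1 4 11 0) (on 2 11 (dia≠ 2 4 11 0) (on 3 11 (dia≠ 3 4 11 0) (on
        5 11 (at6 0 1 3 5 11 9 7) (at6 0 2 3 5 6 9 11))))) (on 8 11 (at6 0 0 4 8 11 9 6) (at6 0 0 4 8 7 9 11)))))))
        (on 8 10 (on 0 10 (on 3 10 (dia 3 10 0 8 1) (on 1 10 (dia≠ 1 0 10 3) (on 2 10 (dia≠ 2 0 10 1) (on
        4 10 (dia≠ 4 0 10 1) (at6 0 4 2 8 10 9 6))))) (on 2 10 (on 4 10 (dia≠ 4 2 10 0) (at6 0 4 0 10 8 7 6)) (at6 0 2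
        0 8 10 9 6))) (on 4 10 (on 5 10 (on 0 10 (dia 0 10 4 5 1) (on 1 10 (dia≠ 1 4 10 0) (at6 0 7 8 1 4 10
        5))) (at6 0 10 4 5 6 7 8)) (on 0 10 (on 1 10 (dia≠ 1 0 10 4) (at6 0 1 4 10 9 7 8)) (at6 0 0 4 10 9 7 8))))))
        (at6 0 0 4 9 6 7 8)) (on 7 9 (at6 0 3 4 9 7 6 5) (on 2 11 (on 3 11 (on 0 11 (on 1 11 (on 5 11 (dia
        11 0 5 1 2) (on 6 11 (dia 11 1 6 0 7) (on 8 11 (dia 11 3 8 0 7) (at6 0 5 6 8 3 11 9)))) (dia≠ 0 2 1 11)) (dia≠
        2 3 0 11)) (on 0 11 (dia≠ 0 2 11 3) (on 1 11 (dia≠ 1 2 11 0) (on 7 11 (on 6 11 (dia 11 7 6 2 5) (at6 0 0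
        3 6 7 11 9)) (on 6 11 (at6 0 0 3 7 6 11 9) (at6 0 11 9 7 6 1 0)))))) (on 3 11 (on 0 11 (dia≠ 0 3 11 2)
        (on 1 11 (dia≠ 1 3 11 0) (on 8 11 (on 7 11 (dia 11 8 7 3 6) (at6 0 0 1 7 8 11 9)) (on 7 11 (at6 0 0 1 8
        7 11 9) (at6 0 11 9 8 7 2 0))))) (on 6 11 (on 5 11 (on 0 11 (dia 11 5 0 6 2) (on 7 11 (dia 11 6 7 5 2)
        (at6 0 0 3 7 6 11 9))) (at6 0 2 3 5 6 11 9)) (on 5 11 (at6 0 2 3 6 5 11 9) (on 0 11 (on 1 11 (dia≠ 1 0 11
        2) (at6 0 11 9 2 1 6 5)) (at6 0 11 9 2 0 5 6))))))))))
        (All.++⁺ (frame-holds y z w)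
          ((yz ∷ yw ∷ []) ∷ (none _ ∷ none _ ∷ none _ ∷ none _ ∷ none _ ∷ []) ∷ (¬~⇒≁ z≁w ∷ []) ∷ ((z≢w ∷ []) ∷ [])
           ∷ ((apart-K yz) ∷ (apart-K yw) ∷ []) ∷ []))
        where
        apart-K : ∀ {z} → y ~ z → All (z ≢_) (κ (t 0F) ∷ κ (t 1F) ∷ κ (t 2F) ∷ κ (t 3F) ∷ κ e ∷ [])
        apart-K yz = f ∷ f ∷ f ∷ f ∷ f ∷ []
          where
          f : ∀ {i} → _ ≢ κ i
          f refl = ~⇒¬≁ yz (none _)

    module _ (5≤m : 5 ≤ m) {x : Fin 4 → Fin n} (out : ∀ q → Outside (x q)) (p : Path₄ x) where

      private
        fresh : ∀ (t : Fin 4 → Fin m) → ∃[ e ] (∀ q → t q ≢ e)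
        fresh t with e , e∉ ← free-colour (map t (allFin 4)) 5≤m =
          e , λ q e′ → e∉ (subst (_∈ map t (allFin 4)) e′ (∈-map⁺ t (∈-allFin q)))

        reversed : Path₄ (x ∘ opposite)
        reversed = reverse-path p

        Contacts : (Fin 4 → Fin n) → Set
        Contacts x = Σ[ t ∈ (Fin 4 → Fin m) ] Injective _≡_ _≡_ t × (∀ q → x q ~ κ (t q))

        forward : Contacts x
        forward = path-contacts 5≤m out p

        backward : Contacts (x ∘ opposite)
        backward = path-contacts 5≤m (out ∘ opposite) reversed

        Independent : Fin m → Set
        Independent i = ∀ {y z} → Outside y → Outside z → y ~ κ i → z ~ κ i → ¬ y ~ z

        at-end : ∀ {x} (out : ∀ q → Outside (x q)) → Path₄ x → ((t , _) : Contacts x) → Independent (t 0F)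
        at-end {x} out p (t , inj , touches) = no-edge-end {x} out p {t} inj touches {proj₁ (fresh t)} (proj₂ (fresh t))

        at-middle : ∀ {x} (out : ∀ q → Outside (x q)) → Path₄ x → ((t , _) : Contacts x) → Independent (t 1F)
        at-middle {x} out p (t , inj , touches) = no-edge-middle {x} out p {t} inj touches {proj₁ (fresh t)} (proj₂ (fresh t))

        elsewhere : ((t , _) : Contacts x) → ∀ {i} → (∀ q → t q ≢ i) → Independent i
        elsewhere (t , inj , touches) {i} ≢i = no-edge-off {x} out p {t} inj touches {i} ≢i

        -- The contacts of the reversed path come from a second construction; uniqueness identifies
        -- them with the first ones.
        same-contact : (c : Contacts x) (c′ : Contacts (x ∘ opposite)) → ∀ q → proj₁ c (opposite q) ≡ proj₁ c′ q
        same-contact (_ , _ , touches) (_ , _ , touches′) q = unique-contact (out (opposite q)) (touches (opposite q)) (touches′ q)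

        independent : Contacts x → Contacts (x ∘ opposite) → ∀ i → Independent i
        independent c c′ i with 𝔽.any? (λ q → proj₁ c q ≟ i)
        ... | yes (0F , refl) = at-end {x} out p c
        ... | yes (1F , refl) = at-middle {x} out p c
        ... | yes (2F , refl) = subst Independent (sym (same-contact c c′ 1F)) (at-middle {x ∘ opposite} (out ∘ opposite) reversed c′)
        ... | yes (3F , refl) = subst Independent (sym (same-contact c c′ 0F)) (at-end {x ∘ opposite} (out ∘ opposite) reversed c′)
        ... | no ≢i = elsewhere c λ q e → ≢i (q , e)

        simplicial : Contacts x → ∀ {y} → (∀ i → y ≁ κ i) → Simplicial G y
        simplicial (t , inj , touches) = no-contact-simplicial {x} out p {t} inj touches {proj₁ (fresh t)} (proj₂ (fresh t))

      contacts-independent : ∀ i → Independent i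
      contacts-independent = independent forward backward

      contactless-simplicial : ∀ {y} → (∀ i → y ≁ κ i) → Simplicial G y
      contactless-simplicial = simplicial forward

  -- From paths outside the clique to colourings

  path-outside? : Dec (∃[ x ] (∀ q → Outside (x q)) × Path₄ x)
  path-outside? = map′
    (λ { (a ∷ b ∷ c ∷ d ∷ [] , _ , (oa ∷ ob ∷ oc ∷ od ∷ []) , p) →
         (λ { 0F → a ; 1F → b ; 2F → c ; 3F → d }) , (λ { 0F → oa ; 1F → ob ; 2F → oc ; 3F → od }) , p })
    (λ (x , out , p) → x 0F ∷ x 1F ∷ x 2F ∷ x 3F ∷ [] , refl , (out 0F ∷ out 1F ∷ out 2F ∷ out 3F ∷ []) , p)
    (∃list? G (λ vs → All.all? outside? vs ×-dec induces? G (path 4) vs) 4)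

  module _ (av : Avoids (P₂+P₄ ∷ [])) {k} (m≤k : m ≤ k) (crit : Critical G k) where

    private
      cograph : ¬ (∃[ x ] (∀ q → Outside (x q)) × Path₄ x) →
                ∀ {a b c d} → All Outside (a ∷ b ∷ c ∷ d ∷ []) → ¬ Path a b c d
      cograph none {a} {b} {c} {d} (oa ∷ ob ∷ oc ∷ od ∷ []) p = none
        ( (λ { 0F → a ; 1F → b ; 2F → c ; 3F → d }) , (λ { 0F → oa ; 1F → ob ; 2F → oc ; 3F → od }) , p)

    no-path⇒colourable : 4 ≤ m → ¬ (∃[ x ] (∀ q → Outside (x q)) × Path₄ x) → Colourable G k
    no-path⇒colourable 4≤m none = cograph-outside⇒colourable (cograph none) m≤k crit 4≤m

    six⇒colourable : 6 ≤ m → Colourable G k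
    six⇒colourable 6≤m = no-path⇒colourable (ℕ.≤-trans (ℕ.m≤n+m 4 2) 6≤m)
      λ (x , out , p) → no-path-outside av 6≤m out p

  -- The neighbours of κ i outside K are coloured like κ (i + 1).
  five⇒colourable : m ≡ 5 → Avoids (P₂+P₄ ∷ []) → ∀ {k} → m ≤ k → Critical G k → Colourable G k
  five⇒colourable refl av {k} m≤k crit with path-outside?
  ... | no none = no-path⇒colourable av m≤k crit (ℕ.n≤1+n 4) none
  ... | yes (x , out , p) with 𝔽.any? (λ y → 𝔽.all? λ i → adj G y (κ i) 𝔹.≟ false)
  ...   | yes (y , none) = remove-simplicial G crit (λ big → maximum (clique-≤ G (s≤s m≤k) big))
                             (contactless-simplicial av ℕ.≤-refl out p none)
  ...   | no meets = Colourable-≤ {G = G} m≤k (c , proper)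
    where
    -- Since `σ` has no fixed point, a vertex avoids the colour of its contact; since it is
    -- injective, equally coloured outside vertices share their contact.
    σ : Fin 5 → Fin 5
    σ 0F = 1F
    σ 1F = 2F
    σ 2F = 3F
    σ 3F = 4F
    σ 4F = 0F
    σ-injective : ∀ i j → σ i ≡ σ j → i ≡ j
    σ-injective = from-yes (𝔽.all? λ i → 𝔽.all? λ j → (σ i ≟ σ j) →-dec (i ≟ j))
    σ-moves : ∀ i → σ i ≢ i
    σ-moves = from-yes (𝔽.all? λ i → ¬? (σ i ≟ i))
    touch : ∀ y → ∃[ i ] y ~ κ i
    touch y with contact y
    ... | inj₁ c    = c
    ... | inj₂ none = contradiction (y , none) meets
    c : Fin n → Fin 5
    c y with position y
    ... | inj₁ (i , _) = i
    ... | inj₂ _       = σ (proj₁ (touch y))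
    clear : ∀ {y i} → Outside y → σ (proj₁ (touch y)) ≡ i → y ≁ κ i
    clear {y} o refl = ¬~⇒≁ λ yσ → σ-moves _ (unique-contact o yσ (proj₂ (touch y)))
    proper : ∀ y z → y ~ z → c y ≢ c z
    proper y z yz with position y | position z
    ... | inj₁ (i , refl) | inj₁ (j , refl) = λ { refl → ~⇒≢ yz refl }
    ... | inj₁ (i , refl) | inj₂ oz = λ e → ~⇒¬≁ (~-sym yz) (clear oz (sym e))
    ... | inj₂ oy | inj₁ (j , refl) = λ e → ~⇒¬≁ yz (clear oy e)
    ... | inj₂ oy | inj₂ oz = λ e → contacts-independent av ℕ.≤-refl out p _ oy oz (proj₂ (touch y))
      (subst (λ i → z ~ κ i) (sym (σ-injective _ _ e)) (proj₂ (touch z))) yz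

-- Two disjoint 4-cliques

swap-to-front : Fin 4 → Fin 4 → Fin 4
swap-to-front j i = if does (i ≟ 0F) then j else if does (i ≟ j) then 0F else i

swap-to-front-injective : ∀ j {i i′} → swap-to-front j i ≡ swap-to-front j i′ → i ≡ i′
swap-to-front-injective j {i} {i′} = from-yes
  (𝔽.all? λ j → 𝔽.all? λ i → 𝔽.all? λ i′ → (swap-to-front j i ≟ swap-to-front j i′) →-dec (i ≟ i′)) j i i′

swap-to-front-involutive : ∀ j i → swap-to-front j (swap-to-front j i) ≡ i
swap-to-front-involutive = from-yes
  (𝔽.all? λ j → 𝔽.all? λ i → swap-to-front j (swap-to-front j i) ≟ i)

-- Exchanges 0 with 1 and 2 with 3. The pair missed by the second clique is preserved, so lemmas
-- about 0 and 2 also serve 1 and 3.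
cross : Fin 4 → Fin 4
cross 0F = 1F
cross 1F = 0F
cross 2F = 3F
cross 3F = 2F

cross-injective : ∀ {i j} → cross i ≡ cross j → i ≡ j
cross-injective {i} {j} = from-yes (𝔽.all? λ i → 𝔽.all? λ j → (cross i ≟ cross j) →-dec (i ≟ j)) i j

module TwoCliques {n} {G : Graph n} (df : Adjacency.DiamondFree G)
                  (av : Adjacency.Avoids G (P₂+P₄ ∷ complete 5 ∷ [])) {k l : Fin 4 → Fin n}
                  (k-~ : ∀ {i j} → i ≢ j → adj G (k i) (k j) ≡ true)
                  (l-~ : ∀ {i j} → i ≢ j → adj G (l i) (l j) ≡ true)
                  (k₂≁l : ∀ j → adj G (k 2F) (l j) ≡ false)
                  (k₃≁l : ∀ j → adj G (k 3F) (l j) ≡ false) where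

  open Adjacency G

  Far : Fin n → Set
  Far w = (∀ i → w ≢ k i) × (∀ j → w ≢ l j)

  Only : Fin n → (Fin 4 → Fin n) → Fin 4 → Set
  Only w k i = w ~ k i × (∀ j → j ≢ i → w ≁ k j)

  private
    env : Fin n → Fin n → ℕ → Fin n
    env w x = at (k 0F ∷ k 1F ∷ k 2F ∷ k 3F ∷ l 0F ∷ l 1F ∷ l 2F ∷ l 3F ∷ w ∷ x ∷ []) w

    open module R w x = Refutation G df av (env w x) using () renaming (⟦_⟧ to Holds)

    frame : List Hyp
    frame = clique (0 ⋯ 3) ∷ clique (4 ⋯ 7)
          ∷ anti 2 (4 ⋯ 7) ∷ anti 3 (4 ⋯ 7)
          ∷ apart (8 ∷ 9 ∷ []) (0 ⋯ 7) ∷ star 8 [ 9 ] ∷ []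

    all₄ : ∀ {P : Fin n → Set} {f : Fin 4 → Fin n} → (∀ i → P (f i)) → All P (f 0F ∷ f 1F ∷ f 2F ∷ f 3F ∷ [])
    all₄ p = p 0F ∷ p 1F ∷ p 2F ∷ p 3F ∷ []

    frame-holds : ∀ {w x} → Far w → Far x → w ~ x → All (Holds w x) frame
    frame-holds {w} {x} (wk , wl) (xk , xl) wx =
        AllPairs.tabulate⁺ k-~ ∷ AllPairs.tabulate⁺ l-~ ∷ all₄ k₂≁l ∷ all₄ k₃≁l
      ∷ (All.++⁺ (all₄ wk) (all₄ wl) ∷ All.++⁺ (all₄ xk) (all₄ xl) ∷ []) ∷ (wx ∷ []) ∷ []

    meets : ∀ {w x} u → ∃[ j ] env w x u ~ l j →
            Holds w x (some ((u , 4 , true) ∷ (u , 5 , true) ∷ (u , 6 , true) ∷ (u , 7 , true) ∷ []))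
    meets _ (0F , p) = here p
    meets _ (1F , p) = there (here p)
    meets _ (2F , p) = there (there (here p))
    meets _ (3F , p) = there (there (there (here p)))

  module _ {w x} (far-w : Far w) (far-x : Far x) (wx : w ~ x) where

    -- Among the vertices off both cliques, no edge leaves the neighbourhood of `k 0F`. The index 0
    -- of the second clique is reserved for the one vertex that `k 0F` may touch there.
    contact₀ : (∀ j → j ≢ 0F → k 0F ≁ l j) → Only w k 0F → x ~ k 0F
    contact₀ k₀≁l (wk , w≁k) = decidable-stable (x ~? k 0F) λ x≁k → R.refute w x
      (frame ++ star 8 [ 0 ] ∷ anti 0 (5 ⋯ 7) ∷ anti 8 (1 ⋯ 3) ∷ anti 9 [ 0 ] ∷ [])
      (on 4 8 (on 5 8 (on 6 8 (on 7 8 (at5 1 7 8 4 5 6) (dia≠ 4 5 7 8)) (dia≠ 4 5 6 8)) (on 6 8 (dia≠ 6 4 8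
      5) (on 7 8 (dia≠ 7 4 8 5) (on 3 9 (on 2 9 (dia≠ 2 3 9 0) (on 6 9 (on 4 9 (dia≠ 4 9 6 8) (on 5 9
      (dia≠ 5 6 9 4) (on 7 9 (dia≠ 7 6 9 4) (at6 0 7 5 8 9 3 2)))) (on 5 9 (on 4 9 (dia≠ 4 9 5 8) (on 7 9
      (dia≠ 7 5 9 4) (at6 0 7 6 8 9 3 2))) (at6 0 5 6 8 9 3 2)))) (on 5 9 (on 4 9 (dia≠ 4 9 5 8) (on 6 9 (dia≠ 6
      5 9 4) (on 2 9 (on 7 9 (dia≠ 7 5 9 4) (at6 0 7 6 8 9 2 3)) (at6 0 2 3 8 9 5 6)))) (on 6 9 (on 2 9 (on
      4 9 (dia≠ 4 9 6 8) (on 7 9 (dia≠ 7 6 9 4) (at6 0 7 5 8 9 2 3))) (at6 0 2 3 8 9 6 5)) (at6 0 6 5 9 8 0 3)))))))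
      (on 6 8 (on 5 8 (dia≠ 5 6 8 4) (on 7 8 (dia≠ 7 6 8 4) (on 6 9 (on 4 9 (dia≠ 9 6 4 8) (on 5 9 (dia≠
      5 6 9 4) (on 7 9 (dia≠ 7 6 9 4) (on 2 9 (on 3 9 (dia≠ 3 2 9 0) (at6 0 4 5 3 2 9 8)) (at6 0 5 7 2 0 8 9)))))
      (on 4 9 (on 5 9 (dia≠ 5 4 9 6) (on 7 9 (dia≠ 7 4 9 5) (on 2 9 (on 3 9 (dia≠ 3 2 9 0) (at6 0 5 7 3 2 9
      8)) (at6 0 5 7 2 0 8 9)))) (on 2 9 (on 3 9 (dia≠ 3 2 9 0) (on 5 9 (on 7 9 (dia≠ 7 5 9 4) (at6 0 7 4 8 9
      2 3)) (at6 0 5 4 8 9 2 3))) (on 3 9 (on 5 9 (on 7 9 (dia≠ 7 5 9 4) (at6 0 7 4 8 9 3 2)) (at6 0 5 4 8 9 3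
      2)) (at6 0 3 2 9 8 6 4))))))) (on 3 9 (on 2 9 (dia≠ 2 3 9 0) (on 4 9 (on 7 9 (on 5 9 (on 6 9 (at5
      1 6 9 4 5 7) (dia≠ 4 5 6 9)) (dia≠ 4 7 5 9)) (on 5 9 (dia≠ 5 4 9 7) (on 6 9 (dia≠ 6 4 9 5) (on 5 8 (on 7
      8 (dia≠ 7 5 8 4) (at6 0 7 6 9 8 0 2)) (at6 0 5 6 9 8 0 2))))) (on 6 9 (on 5 9 (dia≠ 5 6 9 4) (on 5 8 (on
      7 8 (dia≠ 7 5 8 4) (on 7 9 (dia≠ 7 6 9 4) (at6 0 7 4 8 9 3 2))) (at6 0 5 4 8 9 3 2))) (at6 0 6 4 8 9 3 2))))
      (on 7 8 (on 5 8 (dia≠ 5 7 8 4) (on 6 9 (on 7 9 (dia≠ 7 9 6 8) (on 4 9 (dia≠ 4 6 9 7) (on 2 9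
      (on 5 9 (dia≠ 5 6 9 4) (at6 0 5 4 8 9 2 3)) (at6 0 2 3 8 9 6 4)))) (on 5 9 (on 2 9 (on 4 9 (dia≠ 4 5 9
      6) (at6 0 4 6 8 9 2 3)) (at6 0 2 3 8 9 5 6)) (at6 0 5 6 9 8 0 3)))) (on 6 9 (on 7 9 (on 4 9 (on 5 9 (at5
      1 5 9 4 6 7) (dia≠ 4 6 5 9)) (dia≠ 6 7 4 9)) (on 2 9 (on 4 9 (dia≠ 4 6 9 7) (at6 0 4 7 8 9 2 3)) (at6 0 2 3 8
      9 6 7))) (on 7 9 (on 2 9 (on 4 9 (dia≠ 4 7 9 6) (at6 0 4 6 8 9 2 3)) (at6 0 2 3 8 9 7 6)) (at6 0 7 6 9 8 0
      3)))))))
      (All.++⁺ (frame-holds far-w far-x wx)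
        ((wk ∷ []) ∷ (k₀≁l 1F (λ ()) ∷ k₀≁l 2F (λ ()) ∷ k₀≁l 3F (λ ()) ∷ [])
         ∷ (w≁k 1F (λ ()) ∷ w≁k 2F (λ ()) ∷ w≁k 3F (λ ()) ∷ []) ∷ (¬~⇒≁ x≁k ∷ []) ∷ []))

    both-contact₀ : (∀ j → j ≢ 0F → k 0F ≁ l j) → Only w k 0F → Only x k 0F →
      ∀ {i j} → Only w l i → k 0F ≁ l i → Only x l j → k 0F ≁ l j → ⊥
    both-contact₀ k₀≁l (wk , w≁k) (xk , x≁k) {i} {j} (wl , w≁l) k≁i (xl , x≁l) k≁j = R.refute w x
      (frame ++ star 8 [ 0 ] ∷ star 9 [ 0 ] ∷ anti 0 (5 ⋯ 7) ∷ anti 8 (1 ⋯ 3) ∷ anti 9 (1 ⋯ 3)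
         ∷ some ((8 , 4 , true) ∷ (8 , 5 , true) ∷ (8 , 6 , true) ∷ (8 , 7 , true) ∷ [])
         ∷ some ((9 , 4 , true) ∷ (9 , 5 , true) ∷ (9 , 6 , true) ∷ (9 , 7 , true) ∷ [])
         ∷ some ((8 , 4 , false) ∷ (0 , 4 , false) ∷ []) ∷ some ((9 , 4 , false) ∷ (0 , 4 , false) ∷ []) ∷ [])
      (on 5 9 (on 5 8 (dia 8 9 5 0 6) (on 4 9 (on 4 8 (dia≠ 4 9 8 5) (on 6 9 (on 6 8 (dia≠ 6 9 8 4)
      (on 7 8 (on 7 9 (dia≠ 7 9 4 8) (dia≠ 4 5 7 9)) (clause 0))) (dia≠ 4 5 6 9))) (on 4 8 (on 6 8 (dia≠ 6 4 8
      5) (on 6 9 (dia≠ 6 5 9 4) (at6 0 2 3 6 5 9 8))) (at6 0 2 3 4 5 9 8)))) (on 4 9 (on 0 4 (clause 3) (on 4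
      8 (dia 8 9 4 0 5) (on 5 8 (on 6 8 (dia≠ 6 5 8 4) (on 6 9 (dia≠ 6 4 9 5) (at6 0 2 3 6 4 9 8))) (at6 0 2 3 5
      4 9 8)))) (on 7 9 (on 7 8 (dia 8 9 7 0 5) (on 4 8 (on 5 8 (dia≠ 5 4 8 7) (at6 0 2 3 5 4 8 9)) (at6 0 2 3
      4 7 9 8))) (on 6 9 (on 6 8 (dia 8 9 6 0 5) (on 4 8 (on 5 8 (dia≠ 5 4 8 6) (at6 0 2 3 5 4 8 9)) (at6 0 2
      3 4 6 9 8))) (clause 1)))))
      (All.++⁺ (frame-holds far-w far-x wx)
        ((wk ∷ []) ∷ (xk ∷ []) ∷ (k₀≁l 1F (λ ()) ∷ k₀≁l 2F (λ ()) ∷ k₀≁l 3F (λ ()) ∷ [])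
         ∷ (w≁k 1F (λ ()) ∷ w≁k 2F (λ ()) ∷ w≁k 3F (λ ()) ∷ []) ∷ (x≁k 1F (λ ()) ∷ x≁k 2F (λ ()) ∷ x≁k 3F (λ ()) ∷ [])
         ∷ meets {w} {x} 8 (i , wl) ∷ meets {w} {x} 9 (j , xl)
         ∷ either 8 i k≁i w≁l ∷ either 9 j k≁j x≁l ∷ []))
      where
      either : ∀ u i → k 0F ≁ l i → (∀ j → j ≢ i → env w x u ≁ l j) →
               Holds w x (some ((u , 4 , false) ∷ (0 , 4 , false) ∷ []))
      either u 0F      k≁l _   = there (here k≁l)
      either u (suc i) _   u≁l = here (u≁l 0F λ ())

    contact₂ : Only w k 2F → (∀ j → w ≁ l j) → x ~ k 2F
    contact₂ (wk , w≁k) w≁l = decidable-stable (x ~? k 2F) λ x≁k → R.refute w x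
      (frame ++ star 8 [ 2 ] ∷ anti 8 (0 ∷ 1 ∷ 3 ∷ 4 ∷ 5 ∷ 6 ∷ 7 ∷ []) ∷ anti 9 [ 2 ] ∷ [])
      (on 3 9 (on 0 9 (dia≠ 0 3 9 2) (on 1 9 (dia≠ 1 3 9 0) (on 0 4 (on 1 4 (dia 1 0 4 2 5) (on 0 7
      (on 0 5 (on 0 6 (at5 1 0 6 4 5 7) (dia 4 5 0 6 2)) (dia 4 7 0 5 2)) (on 0 5 (dia 5 4 0 7 2) (on 0 6 (dia
      6 4 0 5 2) (on 1 7 (on 1 5 (dia 5 7 1 4 2) (on 1 6 (dia 6 7 1 4 2) (on 6 9 (on 5 9 (on 4 9 (on
      7 9 (at5 1 7 9 4 5 6) (dia≠ 4 5 7 9)) (dia≠ 5 6 4 9)) (at6 0 0 1 5 6 9 8)) (on 4 9 (on 5 9 (dia≠ 5 4 9 6) (at6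
      0 5 6 8 9 3 0)) (at6 0 4 6 8 9 3 1))))) (on 7 9 (on 5 9 (on 4 9 (on 6 9 (at5 1 6 9 4 5 7) (dia≠ 4 5 6
      9)) (dia≠ 5 7 4 9)) (on 1 5 (on 1 6 (dia 6 5 1 4 2) (on 6 9 (dia≠ 6 7 9 5) (at6 0 0 1 6 7 9 8))) (at6 0 1 0
      5 7 9 8))) (on 4 9 (on 5 9 (dia≠ 5 4 9 7) (at6 0 5 7 8 9 3 0)) (at6 0 4 7 8 9 3 1)))))))) (on 0 5 (on 0
      6 (dia 6 5 0 4 2) (on 0 7 (dia 7 5 0 4 2) (on 4 9 (on 6 9 (on 5 9 (on 7 9 (at5 1 7 9 4 5 6) (dia≠ 4 5
      7 9)) (dia≠ 4 6 5 9)) (on 5 9 (dia≠ 5 4 9 6) (on 7 9 (dia≠ 7 4 9 5) (at6 0 7 6 8 9 3 0)))) (on 6 9 (on 7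
      9 (dia≠ 7 6 9 4) (at6 0 7 4 8 9 3 0)) (at6 0 6 4 8 9 3 0))))) (on 0 6 (on 0 7 (dia 7 6 0 4 2) (on 5 9
      (on 4 9 (on 6 9 (on 7 9 (at5 1 7 9 4 5 6) (dia≠ 4 5 7 9)) (dia≠ 4 5 6 9)) (on 7 9 (dia≠ 7 5 9 4) (at6 0
      7 4 8 9 3 0))) (on 4 9 (on 7 9 (dia≠ 7 4 9 5) (at6 0 7 5 8 9 3 0)) (at6 0 4 5 8 9 3 0)))) (on 5 9 (on 6
      9 (on 4 9 (on 7 9 (at5 1 7 9 4 5 6) (dia≠ 4 5 7 9)) (dia≠ 5 6 4 9)) (on 4 9 (dia≠ 4 5 9 6) (at6 0 4 6 8 9 3
      0))) (on 4 9 (on 6 9 (dia≠ 6 4 9 5) (at6 0 6 5 8 9 3 0)) (at6 0 4 5 8 9 3 0)))))))) (on 5 9 (on 6 9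
      (on 4 9 (on 7 9 (at5 1 7 9 4 5 6) (dia≠ 4 5 7 9)) (dia≠ 5 6 4 9)) (on 4 9 (dia≠ 4 5 9 6) (at6 0 4 6 9 8 2
      3))) (on 4 9 (on 6 9 (dia≠ 6 4 9 5) (at6 0 6 5 9 8 2 3)) (at6 0 4 5 9 8 2 3))))
      (All.++⁺ (frame-holds far-w far-x wx)
        ((wk ∷ []) ∷ (w≁k 0F (λ ()) ∷ w≁k 1F (λ ()) ∷ w≁k 3F (λ ()) ∷ all₄ w≁l) ∷ (¬~⇒≁ x≁k ∷ []) ∷ []))

    -- By diamonds and K₅, `x` touches at most one `l j`. Two of the others form an edge
    -- anticomplete to the path w, x, `k 2F`, `k 3F`.
    no-contact₂ : (∀ i → w ≁ k i) → (∀ j → w ≁ l j) → ¬ Only x k 2F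
    no-contact₂ w≁k w≁l (xk , x≁k) = R.refute w x
      (frame ++ star 9 [ 2 ] ∷ anti 8 (0 ⋯ 7) ∷ anti 9 (0 ∷ 1 ∷ 3 ∷ []) ∷ [])
      (on 4 9 (on 5 9 (on 6 9 (on 7 9 (at5 1 7 9 4 5 6) (dia≠ 4 5 7 9)) (dia≠ 4 5 6 9)) (on 6 9 (dia≠ 6 4 9
      5) (at6 0 6 5 8 9 2 3))) (on 5 9 (on 6 9 (dia≠ 6 5 9 4) (at6 0 6 4 8 9 2 3)) (at6 0 5 4 8 9 2 3)))
      (All.++⁺ (frame-holds far-w far-x wx)
        ((xk ∷ []) ∷ All.++⁺ (all₄ w≁k) (all₄ w≁l) ∷ (x≁k 0F (λ ()) ∷ x≁k 1F (λ ()) ∷ x≁k 3F (λ ()) ∷ []) ∷ []))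

    both-contact₂ : Only w k 2F → Only x k 2F → Only w l 0F → ∃[ j ] x ~ l j → ⊥
    both-contact₂ (wk , w≁k) (xk , x≁k) (wl , w≁l) meet = R.refute w x
      (frame ++ star 9 [ 2 ] ∷ star 8 (2 ∷ 4 ∷ []) ∷ anti 8 (0 ∷ 1 ∷ 3 ∷ []) ∷ anti 9 (0 ∷ 1 ∷ 3 ∷ []) ∷ anti 8 (5 ⋯ 7)
         ∷ some ((9 , 4 , true) ∷ (9 , 5 , true) ∷ (9 , 6 , true) ∷ (9 , 7 , true) ∷ []) ∷ [])
      (on 4 9 (dia 9 8 4 2 5) (on 5 9 (on 6 9 (dia≠ 6 5 9 4) (on 7 9 (dia≠ 7 5 9 4) (on 0 7 (on 0 6
      (on 0 4 (on 0 5 (at5 1 0 5 4 6 7) (dia 4 6 0 5 2)) (dia 6 7 0 4 2)) (at6 0 8 9 6 7 0 3)) (on 0 4 (on 0 5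
      (dia 5 4 0 7 2) (at6 0 0 3 7 5 9 8)) (at6 0 0 3 7 4 8 9))))) (on 0 5 (on 1 5 (dia 1 0 5 2 4) (on 1 4 (on
      0 4 (dia 0 4 1 5 2) (on 0 6 (dia 6 5 0 4 2) (on 1 6 (dia 6 4 1 5 2) (on 6 9 (at6 0 1 3 5 6 9 8) (at6 0 0 3
      6 4 8 9))))) (at6 0 1 3 5 4 8 9))) (on 0 4 (on 0 6 (dia 6 4 0 5 2) (on 0 7 (dia 7 4 0 5 2) (on 7 9 (at6
      0 0 3 5 7 9 8) (on 6 9 (at6 0 0 3 5 6 9 8) (clause 0))))) (at6 0 0 3 5 4 8 9)))))
      (All.++⁺ (frame-holds far-w far-x wx)
        ((xk ∷ []) ∷ (wk ∷ wl ∷ []) ∷ (w≁k 0F (λ ()) ∷ w≁k 1F (λ ()) ∷ w≁k 3F (λ ()) ∷ []) ∷ (x≁k 0F (λ ()) ∷ x≁k 1F (λ ()) ∷ x≁k 3F (λ ()) ∷ [])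
         ∷ (w≁l 1F (λ ()) ∷ w≁l 2F (λ ()) ∷ w≁l 3F (λ ()) ∷ []) ∷ meets {w} {x} 9 meet ∷ []))

    l-contact₀ : (∀ i → w ≁ k i) → Only w l 0F → x ~ l 0F
    l-contact₀ w≁k (wl , w≁l) = decidable-stable (x ~? l 0F) λ x≁l → R.refute w x
      (frame ++ star 8 [ 4 ] ∷ anti 8 (0 ∷ 1 ∷ 2 ∷ 3 ∷ 5 ∷ 6 ∷ 7 ∷ []) ∷ anti 9 [ 4 ] ∷ [])
      (on 6 9 (on 5 9 (dia≠ 5 6 9 4) (on 7 9 (dia≠ 7 6 9 4) (on 3 9 (on 2 9 (on 0 9 (on 1 9 (at5 1 1 9
      0 2 3) (dia≠ 0 2 1 9)) (dia≠ 2 3 0 9)) (at6 0 5 7 2 3 9 8)) (on 2 9 (at6 0 5 7 3 2 9 8) (at6 0 2 3 8 9 6 5)))))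
      (on 2 9 (on 3 9 (on 0 9 (on 1 9 (at5 1 1 9 0 2 3) (dia≠ 0 2 1 9)) (dia≠ 2 3 0 9)) (on 5 9 (on 7 9
      (dia≠ 7 5 9 4) (at6 0 7 6 8 9 2 3)) (at6 0 5 6 8 9 2 3))) (on 3 9 (on 5 9 (on 7 9 (dia≠ 7 5 9 4) (at6 0 7 6
      8 9 3 2)) (at6 0 5 6 8 9 3 2)) (at6 0 3 2 9 8 4 6))))
      (All.++⁺ (frame-holds far-w far-x wx)
        ((wl ∷ []) ∷ All.++⁺ (all₄ w≁k) (w≁l 1F (λ ()) ∷ w≁l 2F (λ ()) ∷ w≁l 3F (λ ()) ∷ []) ∷ (¬~⇒≁ x≁l ∷ []) ∷ []))

-- Six colours when the clique number is four

module _ {n} {G : Graph n} where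

  open Adjacency G

  simplicial? : ∀ v → Dec (Simplicial G v)
  simplicial? v with simplicial-or-not {G = G} v
  ... | inj₁ s = yes s
  ... | inj₂ (x , y , vx , vy , x≢y , x≁y) = no λ s → ~⇒¬≁ (s vx vy x≢y) x≁y

  find-simplicial : (∃[ v ] Simplicial G v) ⊎ (∀ v → NonSimplicial G v)
  find-simplicial with 𝔽.any? simplicial?
  ... | yes s   = inj₁ s
  ... | no none = inj₂ λ v → [ (λ s → contradiction (v , s) none) , id ]′ (simplicial-or-not {G = G} v)

  -- Two nonadjacent neighbours of `w` cannot both be adjacent to `u`, as this would be a diamond on
  -- the edge w u.
  escape : DiamondFree → ∀ {w u} → w ~ u → NonSimplicial G w →
           ∃[ y ] w ~ y × y ≢ u × y ≁ u
  escape df {w} {u} wu (x , y , wx , wy , x≢y , x≁y) with x ≟ u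
  ... | yes refl = y , wy , ≢-sym x≢y , ≁-sym x≁y
  ... | no x≢u with x ~? u
  ...   | no x≁u = x , wx , x≢u , ¬~⇒≁ x≁u
  ...   | yes xu = y , wy , (λ { refl → ~⇒¬≁ xu x≁y }) , ¬~⇒≁ λ yu → x≢y (df wu wx wy (~-sym xu) (~-sym yu) x≁y)

module FourCliques {n} {G : Graph n} (df : Adjacency.DiamondFree G)
                   (av : Adjacency.Avoids G (P₂+P₄ ∷ complete 5 ∷ [])) (K : HasClique G 4) where

  open Adjacency G

  private
    maximum : ¬ HasClique G 5
    maximum = avoids⇒no-clique G (All.head (All.tail av))

  open MaximumClique {G = G} df maximum K

  -- Each vertex of K is adjacent to `κ 2F` or `κ 3F`, so `A` lies outside K. `A` is anticomplete to
  -- the edge of these two, and `B` to the edge of `κ 0F` and `κ 1F`, so both induce cographs.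
  A B : Fin n → Set
  A x = x ≁ κ 2F × x ≁ κ 3F
  B x = Outside x × (x ~ κ 2F ⊎ x ~ κ 3F)

  A? : ∀ x → Dec (A x)
  A? x = (adj G x (κ 2F) 𝔹.≟ false) ×-dec (adj G x (κ 3F) 𝔹.≟ false)

  B? : ∀ x → Dec (B x)
  B? x = outside? x ×-dec ((x ~? κ 2F) ⊎-dec (x ~? κ 3F))

  -- `A` and `B` get three colours each. `κ 2F` and `κ 3F` borrow from the palette of `A`, to which
  -- they are anticomplete, and likewise `κ 0F` and `κ 1F` from that of `B`.
  module Groups (no-A : ∀ vs → All A vs → ¬ Induces (complete 4) vs) where

    private
      beside : ∀ {i j} → i ≢ j → ∀ {a b c d} → All (λ x → x ≁ κ i × x ≁ κ j) (a ∷ b ∷ c ∷ d ∷ []) →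
               ¬ Induces (path 4) (a ∷ b ∷ c ∷ d ∷ [])
      beside {i} {j} i≢j {a} {b} {c} {d} ((ai , aj) ∷ (bi , bj) ∷ (ci , cj) ∷ (di , dj) ∷ []) p =
        All.head av (κ i ∷ κ j ∷ a ∷ b ∷ c ∷ d ∷ [])
          ( (κ-~ i≢j ∷ ≁-sym ai ∷ ≁-sym bi ∷ ≁-sym ci ∷ ≁-sym di ∷ [])
          , (≁-sym aj ∷ ≁-sym bj ∷ ≁-sym cj ∷ ≁-sym dj ∷ []) , p)

      B-misses : ∀ {x} → B x → x ≁ κ 0F × x ≁ κ 1F
      B-misses (out , inj₁ x2) = ¬~⇒≁ (λ x0 → case unique-contact out x0 x2 of λ ()) , ¬~⇒≁ (λ x1 → case unique-contact out x1 x2 of λ ())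
      B-misses (out , inj₂ x3) = ¬~⇒≁ (λ x0 → case unique-contact out x0 x3 of λ ()) , ¬~⇒≁ (λ x1 → case unique-contact out x1 x3 of λ ())

      -- A vertex seeing two members of a 4-clique sees all four, by diamond-freeness, and then
      -- there is a K₅. So `κ 2F` and `κ 3F` see at most one member each, too few to reach all four.
      no-B : ∀ vs → All B vs → ¬ Induces (complete 4) vs
      no-B (a ∷ b ∷ c ∷ d ∷ []) (pa ∷ pb ∷ pc ∷ pd ∷ []) ind = refute
        (clique (0 ∷ 1 ∷ []) ∷ shape (complete 4) (2 ⋯ 5)
          ∷ apart (0 ∷ 1 ∷ []) (2 ⋯ 5)
          ∷ some (here₂ 2) ∷ some (not-both 2) ∷ some (here₂ 3) ∷ some (not-both 3)
          ∷ some (here₂ 4) ∷ some (not-both 4) ∷ some (here₂ 5) ∷ some (not-both 5) ∷ [])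
        (on 0 2 (on 1 2 (clause 1) (on 0 3 (on 0 4 (on 0 5 (at5 0 0 5 2 3 4) (dia≠ 2 3 0 5)) (dia≠ 2 3 0 4))
        (on 0 5 (dia≠ 5 2 0 3) (on 1 5 (on 1 3 (dia≠ 3 5 1 2) (clause 2)) (clause 6))))) (on 1 2 (on 1 3
        (on 1 4 (on 1 5 (at5 0 1 5 2 3 4) (dia≠ 2 3 1 5)) (dia≠ 2 3 1 4)) (on 0 3 (on 0 5 (dia≠ 5 3 0 2) (on
        1 5 (dia≠ 5 2 1 3) (clause 6))) (clause 2))) (clause 0)))
        (((κ-~ (λ ()) ∷ []) ∷ [] ∷ []) ∷ ind
          ∷ ((off pa ∷ off pb ∷ off pc ∷ off pd ∷ []) ∷ (off pa ∷ off pb ∷ off pc ∷ off pd ∷ []) ∷ [])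
          ∷ one 2 pa ∷ other 2 pa ∷ one 3 pb ∷ other 3 pb ∷ one 4 pc ∷ other 4 pc ∷ one 5 pd ∷ other 5 pd ∷ [])
        where
        env : ℕ → Fin n
        env = at (κ 2F ∷ κ 3F ∷ a ∷ b ∷ c ∷ d ∷ []) a
        open Refutation G df (All.tail av) env
        here₂ not-both : ℕ → List Lit
        here₂ i = (i , 0 , true) ∷ (i , 1 , true) ∷ []
        not-both i = (i , 0 , false) ∷ (i , 1 , false) ∷ []
        off : ∀ {x i} → B x → κ i ≢ x
        off (out , _) = ≢-sym (out _)
        one : ∀ i → B (env i) → ⟦ some (here₂ i) ⟧
        one i (_ , inj₁ p) = here p
        one i (_ , inj₂ p) = there (here p)
        other : ∀ i → B (env i) → ⟦ some (not-both i) ⟧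
        other i (out , inj₁ x2) = there (here (¬~⇒≁ λ x3 → case unique-contact out x2 x3 of λ ()))
        other i (out , inj₂ x3) = here (¬~⇒≁ λ x2 → case unique-contact out x2 x3 of λ ())

      in-A = colour-within {G = G} A? 1 df (beside λ ()) no-A
      in-B = colour-within {G = G} B? 1 df
        (λ ps → beside {0F} {1F} (λ ()) (All.map B-misses ps)) no-B

      data Kind (x : Fin n) : Set where
        inK : ∀ i → x ≡ κ i → Kind x
        inA : Outside x → A x → Kind x
        inB : B x → Kind x

      kind : ∀ x → Kind x
      kind x with position x
      ... | inj₁ (i , e) = inK i e
      ... | inj₂ out with x ~? κ 2F | x ~? κ 3F
      ...   | yes p | _     = inB (out , inj₁ p)
      ...   | no _  | yes q = inB (out , inj₂ q)
      ...   | no p  | no q  = inA out (¬~⇒≁ p , ¬~⇒≁ q)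

      k-colour : Fin 4 → Fin 2 × Fin 3
      k-colour 0F = 1F , 0F
      k-colour 1F = 1F , 1F
      k-colour 2F = 0F , 0F
      k-colour 3F = 0F , 1F

      k-colour-injective : ∀ i j → k-colour i ≡ k-colour j → i ≡ j
      k-colour-injective = from-yes (𝔽.all? λ i → 𝔽.all? λ j → (Product.≡-dec _≟_ _≟_ (k-colour i) (k-colour j)) →-dec (i ≟ j))

      colour : ∀ {x} → Kind x → Fin 2 × Fin 3
      colour (inK i _)     = k-colour i
      colour {x} (inA _ _) = 0F , proj₁ in-A x
      colour {x} (inB _)   = 1F , proj₁ in-B x

      A-misses : ∀ {x c} i → A x → κ i ~ x → k-colour i ≢ (0F , c)
      A-misses 0F a ix ()
      A-misses 1F a ix ()
      A-misses 2F (a , _) ix _ = ~⇒¬≁ (~-sym ix) a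
      A-misses 3F (_ , a) ix _ = ~⇒¬≁ (~-sym ix) a

      B-misses′ : ∀ {x c} i → B x → κ i ~ x → k-colour i ≢ (1F , c)
      B-misses′ 0F b ix _ = ~⇒¬≁ (~-sym ix) (proj₁ (B-misses b))
      B-misses′ 1F b ix _ = ~⇒¬≁ (~-sym ix) (proj₂ (B-misses b))
      B-misses′ 2F b ix ()
      B-misses′ 3F b ix ()

      differ : ∀ {x y} (p : Kind x) (q : Kind y) → x ~ y → colour p ≢ colour q
      differ (inK i refl) (inK j refl) xy e with refl ← k-colour-injective i j e = ~⇒≢ xy refl
      differ (inK i refl) (inA _ a)    xy e = A-misses i a xy e
      differ (inK i refl) (inB b)      xy e = B-misses′ i b xy e
      differ (inA _ a)    (inK i refl) xy e = A-misses i a (~-sym xy) (sym e)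
      differ (inB b)      (inK i refl) xy e = B-misses′ i b (~-sym xy) (sym e)
      differ (inA _ a)    (inA _ b)    xy e = proj₂ in-A a b xy (cong proj₂ e)
      differ (inB a)      (inB b)      xy e = proj₂ in-B a b xy (cong proj₂ e)
      differ (inA _ _)    (inB _)      xy ()
      differ (inB _)      (inA _ _)    xy ()

    colourable : Colourable G 6
    colourable = (λ x → uncurry combine (colour (kind x))) , λ x y xy e →
      differ (kind x) (kind y) xy (let p , q = 𝔽.combine-injective _ _ _ _ e in cong₂ _,_ p q)

  module Pair (nonsimplicial : ∀ v → NonSimplicial G v)
              (L : HasClique G 4) (L-A : ∀ j → A (proj₁ L j)) where

    private
      module M = MaximumClique {G = G} df maximum L
      open M using () renaming (κ to ℓ; κ-~ to ℓ-~)

      Far : Fin n → Set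
      Far w = Outside w × M.Outside w

      only : ∀ {w i} → Outside w → w ~ κ i → w ~ κ i × (∀ j → j ≢ i → w ≁ κ j)
      only out wi = wi , λ j j≢i → ¬~⇒≁ λ wj → j≢i (unique-contact out wj wi)

      L-outside : ∀ i → M.Outside (κ i)
      L-outside 2F j e = ~⇒¬≁ (subst (_~ κ 3F) e (κ-~ λ ())) (proj₂ (L-A j))
      L-outside 0F j e = ~⇒¬≁ (subst (_~ κ 2F) e (κ-~ λ ())) (proj₁ (L-A j))
      L-outside 1F j e = ~⇒¬≁ (subst (_~ κ 2F) e (κ-~ λ ())) (proj₁ (L-A j))
      L-outside 3F j e = ~⇒¬≁ (subst (_~ κ 2F) e (κ-~ λ ())) (proj₁ (L-A j))

      κ₂≁ : ∀ j → κ 2F ≁ ℓ j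
      κ₂≁ j = ≁-sym (proj₁ (L-A j))

      κ₃≁ : ∀ j → κ 3F ≁ ℓ j
      κ₃≁ j = ≁-sym (proj₂ (L-A j))

      -- TwoCliques distinguishes the vertices k 0F and l 0F; the others are reached
      -- by permuting K with π and L with swap-to-front.
      module At (π : Fin 4 → Fin 4) (π-injective : ∀ {i j} → π i ≡ π j → i ≡ j)
                (π₂ : ∀ j → κ (π 2F) ≁ ℓ j) (π₃ : ∀ j → κ (π 3F) ≁ ℓ j) where

        module T (j : Fin 4) = TwoCliques {G = G} df av {κ ∘ π} {ℓ ∘ swap-to-front j}
          (λ i≢j → κ-~ (i≢j ∘ π-injective)) (λ i≢j → ℓ-~ (i≢j ∘ swap-to-front-injective j))
          (λ i → π₂ (swap-to-front j i)) (λ i → π₃ (swap-to-front j i))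

        far : ∀ j {w} → Far w → T.Far j w
        far j (p , q) = (p ∘ π) , λ i → q _

        onlyπ : ∀ j {w i} → Outside w → w ~ κ (π i) → T.Only j w (κ ∘ π) i
        onlyπ _ out wi = wi , λ j j≢i → proj₂ (only out wi) (π j) (j≢i ∘ π-injective)

        onlyℓ : ∀ {w} j → M.Outside w → w ~ ℓ j → T.Only j w (ℓ ∘ swap-to-front j) 0F
        onlyℓ j out wj = wj , λ i i≢0 → ¬~⇒≁ λ wi →
          i≢0 (swap-to-front-injective j (M.unique-contact out wi wj))

        private
          -- The only vertex of L that `κ (π 0F)` can touch, or 0 if it touches none; it is moved to
          -- the front.
          j₀ : Fin 4
          j₀ = proj₁ (M.sole-contact 0F (κ (π 0F)) (L-outside (π 0F)))

          κ₀≁ : ∀ i → i ≢ 0F → κ (π 0F) ≁ ℓ (swap-to-front j₀ i)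
          κ₀≁ i i≢0 = proj₂ (M.sole-contact 0F (κ (π 0F)) (L-outside (π 0F))) _
            λ e → i≢0 (swap-to-front-injective j₀ e)

        near₀ : ∀ {w x} → Far w → Far x → w ~ x → w ~ κ (π 0F) → x ~ κ (π 0F)
        near₀ fw fx wx w0 = T.contact₀ j₀ (far j₀ fw) (far j₀ fx) wx κ₀≁ (onlyπ j₀ (proj₁ fw) w0)

        -- The neighbour that `escape` provides is not in K, where `w` has only one contact, and not
        -- outside both cliques, by `near₀`; so it lies in L. The other uses of `escape` follow this
        -- pattern.
        escapes₀ : ∀ {w} → Far w → w ~ κ (π 0F) → ∃[ j ] w ~ ℓ j × κ (π 0F) ≁ ℓ j
        escapes₀ {w} fw w0 with y , wy , y≢ , y≁ ← escape {G = G} df w0 (nonsimplicial w) | position y | M.position y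
        ... | inj₁ (i , refl) | _ = contradiction (cong κ (unique-contact (proj₁ fw) wy w0)) y≢
        ... | inj₂ _ | inj₁ (j , refl) = j , wy , ≁-sym y≁
        ... | inj₂ oy | inj₂ oy′ = contradiction y≁ (~⇒¬≁ (near₀ fw (oy , oy′) wy w0))

        apart₀ : ∀ {w x} → Far w → Far x → w ~ κ (π 0F) → x ~ κ (π 0F) → ¬ w ~ x
        apart₀ fw fx w0 x0 wx with i , wi , 0≁i ← escapes₀ fw w0 | j , xj , 0≁j ← escapes₀ fx x0 =
          T.both-contact₀ j₀ (far j₀ fw) (far j₀ fx) wx κ₀≁ (onlyπ j₀ (proj₁ fw) w0) (onlyπ j₀ (proj₁ fx) x0)
            (front fw wi) (subst (λ j → κ (π 0F) ≁ ℓ j) (sym (front-back i)) 0≁i)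
            (front fx xj) (subst (λ j → κ (π 0F) ≁ ℓ j) (sym (front-back j)) 0≁j)
          where
          back : Fin 4 → Fin 4
          back = swap-to-front j₀
          front-back : ∀ i → swap-to-front j₀ (back i) ≡ i
          front-back i = swap-to-front-involutive j₀ i
          front : ∀ {w i} → Far w → w ~ ℓ i → T.Only j₀ w (ℓ ∘ swap-to-front j₀) (back i)
          front {w} {i} fw wi = subst (λ j → w ~ ℓ j) (sym (front-back i)) wi , λ j j≢ → ¬~⇒≁ λ wj →
            j≢ (swap-to-front-injective j₀ (trans (M.unique-contact (proj₂ fw) wj wi) (sym (front-back i))))

        meets₂ : ∀ {w} → Far w → w ~ κ (π 2F) → ∃[ j ] w ~ ℓ j
        meets₂ {w} fw w2 with M.contact w
        ... | inj₁ c = c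
        ... | inj₂ none with y , wy , y≢ , y≁ ← escape {G = G} df w2 (nonsimplicial w) | position y | M.position y
        ...   | inj₁ (i , refl) | _ = contradiction (cong κ (unique-contact (proj₁ fw) wy w2)) y≢
        ...   | inj₂ _ | inj₁ (j , refl) = contradiction (none j) (~⇒¬≁ wy)
        ...   | inj₂ oy | inj₂ oy′ = contradiction y≁
          (~⇒¬≁ (T.contact₂ 0F (far 0F fw) (far 0F (oy , oy′)) wy (onlyπ 0F (proj₁ fw) w2) λ j → none _))

        apart₂ : ∀ {w x} → Far w → Far x → w ~ κ (π 2F) → x ~ κ (π 2F) → ¬ w ~ x
        apart₂ fw fx w2 x2 wx with i , wi ← meets₂ fw w2 | j , xj ← meets₂ fx x2 =
          T.both-contact₂ i (far i fw) (far i fx) wx (onlyπ i (proj₁ fw) w2) (onlyπ i (proj₁ fx) x2) (onlyℓ i (proj₂ fw) wi)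
            (swap-to-front i j , subst (λ j → _ ~ ℓ j) (sym (swap-to-front-involutive i j)) xj)

        free₂ : ∀ {w x} → Far w → Far x → (∀ i → w ≁ κ i) → (∀ j → w ≁ ℓ j) → x ~ κ (π 2F) → ¬ w ~ x
        free₂ fw fx wκ wℓ x2 wx = T.no-contact₂ 0F (far 0F fw) (far 0F fx) wx (λ i → wκ _) (λ j → wℓ _) (onlyπ 0F (proj₁ fx) x2)

        only-ℓ : ∀ {w x j} → Far w → Far x → w ~ x → (∀ i → w ≁ κ i) → w ~ ℓ j → x ~ ℓ j
        only-ℓ {j = j} fw fx wx wκ wj = T.l-contact₀ j (far j fw) (far j fx) wx (λ i → wκ _) (onlyℓ j (proj₂ fw) wj)

      module I = At id id κ₂≁ κ₃≁
      module X = At cross cross-injective κ₃≁ κ₂≁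

      free-κ⇒free-ℓ : ∀ {w} → Far w → (∀ i → w ≁ κ i) → ∀ j → w ≁ ℓ j
      free-κ⇒free-ℓ {w} fw wκ j = ¬~⇒≁ impossible
        where
        impossible : ¬ w ~ ℓ j
        impossible wj with y , wy , y≢ , y≁ ← escape {G = G} df wj (nonsimplicial w) | position y | M.position y
        ... | inj₁ (i , refl) | _ = ~⇒¬≁ wy (wκ i)
        ... | inj₂ _ | inj₁ (i , refl) = y≢ (cong ℓ (M.unique-contact (proj₂ fw) wy wj))
        ... | inj₂ oy | inj₂ oy′ = ~⇒¬≁ (I.only-ℓ fw (oy , oy′) wy wκ wj) y≁

      Free : Fin n → Set
      Free w = ∀ i → w ≁ κ i

      in-Free = colour-within {G = G} (λ w → 𝔽.all? λ i → adj G w (κ i) 𝔹.≟ false) 2 df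
        (λ { (fa ∷ fb ∷ fc ∷ fd ∷ []) p → All.head av _
             ( (κ-~ {0F} {1F} (λ ()) ∷ ≁-sym (fa 0F) ∷ ≁-sym (fb 0F) ∷ ≁-sym (fc 0F) ∷ ≁-sym (fd 0F) ∷ [])
             , (≁-sym (fa 1F) ∷ ≁-sym (fb 1F) ∷ ≁-sym (fc 1F) ∷ ≁-sym (fd 1F) ∷ []) , p) })
        (λ vs _ → All.head (All.tail av) vs)

      data Kind (w : Fin n) : Set where
        inK   : ∀ i → w ≡ κ i → Kind w
        inL   : ∀ j → w ≡ ℓ j → Kind w
        typed : ∀ i → Far w → w ~ κ i → Kind w
        free  : Far w → Free w → Kind w

      kind : ∀ w → Kind w
      kind w with position w | M.position w | contact w
      ... | inj₁ (i , e) | _            | _             = inK i e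
      ... | inj₂ _       | inj₁ (j , e) | _             = inL j e
      ... | inj₂ o       | inj₂ o′      | inj₁ (i , wi) = typed i (o , o′) wi
      ... | inj₂ o       | inj₂ o′      | inj₂ none     = free (o , o′) none

      -- L takes colours 0 to 3; `κ 2F` and `κ 3F`, anticomplete to L, reuse 0 and 1. Colours 4 and
      -- 5 serve `κ 0F`, `κ 1F` and the typed vertices, which avoid the colour of their contact.
      -- Types 0 and 3, and types 1 and 2, may share a colour: off the cliques, neighbours of a
      -- vertex touching `κ 0F` or `κ 1F` touch the same one. Free vertices meet only each other and
      -- reuse 0 to 3.
      k-colour t-colour : Fin 4 → Fin 6
      k-colour 0F = 4F
      k-colour 1F = 5F
      k-colour 2F = 0F
      k-colour 3F = 1F
      t-colour 0F = 5F
      t-colour 1F = 4F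
      t-colour 2F = 4F
      t-colour 3F = 5F

      ℓ-colour : Fin 4 → Fin 6
      ℓ-colour j = inject≤ j (ℕ.m≤n+m 4 2)

      colour : ∀ {w} → Kind w → Fin 6
      colour (inK i _)      = k-colour i
      colour (inL j _)      = ℓ-colour j
      colour (typed i _ _)  = t-colour i
      colour {w} (free _ _) = ℓ-colour (proj₁ in-Free w)

      k-injective : ∀ i j → k-colour i ≡ k-colour j → i ≡ j
      k-injective = from-yes (𝔽.all? λ i → 𝔽.all? λ j → (k-colour i ≟ k-colour j) →-dec (i ≟ j))
      ℓ-injective : ∀ i j → ℓ-colour i ≡ ℓ-colour j → i ≡ j
      ℓ-injective = from-yes (𝔽.all? λ i → 𝔽.all? λ j → (ℓ-colour i ≟ ℓ-colour j) →-dec (i ≟ j))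
      k-ℓ : ∀ i j → k-colour i ≡ ℓ-colour j → i ≡ 2F ⊎ i ≡ 3F
      k-ℓ = from-yes (𝔽.all? λ i → 𝔽.all? λ j → (k-colour i ≟ ℓ-colour j) →-dec ((i ≟ 2F) ⊎-dec (i ≟ 3F)))
      k-t : ∀ i → k-colour i ≢ t-colour i
      k-t = from-yes (𝔽.all? λ i → ¬? (k-colour i ≟ t-colour i))
      ℓ-t : ∀ j i → ℓ-colour j ≢ t-colour i
      ℓ-t = from-yes (𝔽.all? λ j → 𝔽.all? λ i → ¬? (ℓ-colour j ≟ t-colour i))

      κ-ℓ : ∀ i j → κ i ~ ℓ j → k-colour i ≢ ℓ-colour j
      κ-ℓ i j ij e with k-ℓ i j e
      ... | inj₁ refl = ~⇒¬≁ ij (κ₂≁ j)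
      ... | inj₂ refl = ~⇒¬≁ ij (κ₃≁ j)

      κ-typed : ∀ {w} i j → Far w → w ~ κ j → κ i ~ w → k-colour i ≢ t-colour j
      κ-typed i j fw wj iw with refl ← unique-contact (proj₁ fw) (~-sym iw) wj = k-t i

      other : ∀ {w i j} → Far w → w ~ κ i → i ≢ j → w ≁ κ j
      other fw wi i≢j = ¬~⇒≁ λ wj → i≢j (unique-contact (proj₁ fw) wi wj)

      typed-typed : ∀ {w x} i j → Far w → Far x → w ~ κ i → x ~ κ j → w ~ x → t-colour i ≢ t-colour j
      typed-typed 0F 0F fw fx wi xj wx _ = I.apart₀ fw fx wi xj wx
      typed-typed 1F 1F fw fx wi xj wx _ = X.apart₀ fw fx wi xj wx
      typed-typed 2F 2F fw fx wi xj wx _ = I.apart₂ fw fx wi xj wx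
      typed-typed 3F 3F fw fx wi xj wx _ = X.apart₂ fw fx wi xj wx
      typed-typed 0F 3F fw fx wi xj wx _ = ~⇒¬≁ (I.near₀ fw fx wx wi) (other fx xj λ ())
      typed-typed 3F 0F fw fx wi xj wx _ = ~⇒¬≁ (I.near₀ fx fw (~-sym wx) xj) (other fw wi λ ())
      typed-typed 1F 2F fw fx wi xj wx _ = ~⇒¬≁ (X.near₀ fw fx wx wi) (other fx xj λ ())
      typed-typed 2F 1F fw fx wi xj wx _ = ~⇒¬≁ (X.near₀ fx fw (~-sym wx) xj) (other fw wi λ ())
      typed-typed 0F 1F fw fx wi xj wx ()
      typed-typed 0F 2F fw fx wi xj wx ()
      typed-typed 1F 0F fw fx wi xj wx ()
      typed-typed 1F 3F fw fx wi xj wx ()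
      typed-typed 2F 0F fw fx wi xj wx ()
      typed-typed 2F 3F fw fx wi xj wx ()
      typed-typed 3F 1F fw fx wi xj wx ()
      typed-typed 3F 2F fw fx wi xj wx ()

      free-typed : ∀ {w x} j → Far w → Far x → Free w → x ~ κ j → ¬ w ~ x
      free-typed 0F fw fx wf xj wx = ~⇒¬≁ (I.near₀ fx fw (~-sym wx) xj) (wf 0F)
      free-typed 1F fw fx wf xj wx = ~⇒¬≁ (X.near₀ fx fw (~-sym wx) xj) (wf 1F)
      free-typed 2F fw fx wf xj wx = I.free₂ fw fx wf (free-κ⇒free-ℓ fw wf) xj wx
      free-typed 3F fw fx wf xj wx = X.free₂ fw fx wf (free-κ⇒free-ℓ fw wf) xj wx

      differ : ∀ {w x} (p : Kind w) (q : Kind x) → w ~ x → colour p ≢ colour q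
      differ (inK i refl) (inK j refl) wx e with refl ← k-injective i j e = ~⇒≢ wx refl
      differ (inL i refl) (inL j refl) wx e with refl ← ℓ-injective i j e = ~⇒≢ wx refl
      differ (inK i refl) (inL j refl) wx e = κ-ℓ i j wx e
      differ (inL j refl) (inK i refl) wx e = κ-ℓ i j (~-sym wx) (sym e)
      differ (inK i refl) (typed j f xj) wx e = κ-typed i j f xj wx e
      differ (typed j f xj) (inK i refl) wx e = κ-typed i j f xj (~-sym wx) (sym e)
      differ (inK i refl) (free _ f) wx _ = ~⇒¬≁ (~-sym wx) (f i)
      differ (free _ f) (inK i refl) wx _ = ~⇒¬≁ wx (f i)
      differ (inL j refl) (typed i _ _) wx e = ℓ-t j i e
      differ (typed i _ _) (inL j refl) wx e = ℓ-t j i (sym e)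
      differ (inL j refl) (free fx f) wx _ = ~⇒¬≁ (~-sym wx) (free-κ⇒free-ℓ fx f j)
      differ (free fx f) (inL j refl) wx _ = ~⇒¬≁ wx (free-κ⇒free-ℓ fx f j)
      differ (typed i fw wi) (typed j fx xj) wx e = typed-typed i j fw fx wi xj wx e
      differ (free fw f) (typed j fx xj) wx _ = free-typed j fw fx f xj wx
      differ (typed j fx xj) (free fw f) wx _ = free-typed j fw fx f xj (~-sym wx)
      differ {w} {x} (free _ f) (free _ g) wx e = proj₂ in-Free f g wx (ℓ-injective _ _ e)

    colourable : Colourable G 6
    colourable = colour ∘ kind , λ w x → differ (kind w) (kind x)

  four⇒colourable : Critical G 6 → Colourable G 6
  four⇒colourable crit with find-simplicial {G = G}
  ... | inj₁ (v , s) = remove-simplicial G crit (λ big → maximum (clique-≤ G (ℕ.m≤n+m 5 2) big)) s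
  ... | inj₂ nonsimplicial with ∃list? G (λ vs → All.all? A? vs ×-dec induces? G (complete 4) vs) 4
  ...   | no none = Groups.colourable λ vs as ind → none (vs , induces-length G (complete 4) vs ind , as , ind)
  ...   | yes (a ∷ b ∷ c ∷ d ∷ [] , _ , as , ind) =
    Pair.colourable nonsimplicial (list-clique G (a ∷ b ∷ c ∷ d ∷ []) (proj₁ (complete⇒pairs G 4 _ ind)))
      λ j → All.lookup as (∈-lookup j)

-- Six colours when the clique number is at most three

rotate : Fin 3 → Fin 3 → Fin 3
rotate 0F j  = j
rotate 1F 0F = 1F
rotate 1F 1F = 2F
rotate 1F 2F = 0F
rotate 2F 0F = 2F
rotate 2F 1F = 0F
rotate 2F 2F = 1F

rotate-injective : ∀ i {j k} → rotate i j ≡ rotate i k → j ≡ k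
rotate-injective i {j} {k} = from-yes
  (𝔽.all? λ i → 𝔽.all? λ j → 𝔽.all? λ k → (rotate i j ≟ rotate i k) →-dec (j ≟ k)) i j k

rotate-front : ∀ i → rotate i 0F ≡ i
rotate-front 0F = refl
rotate-front 1F = refl
rotate-front 2F = refl

module TwoTriangles {n} {G : Graph n} (df : Adjacency.DiamondFree G)
                    (av : Adjacency.Avoids G (P₂+P₄ ∷ complete 4 ∷ [])) {k l : Fin 3 → Fin n}
                    (k-~ : ∀ {i j} → i ≢ j → adj G (k i) (k j) ≡ true)
                    (l-~ : ∀ {i j} → i ≢ j → adj G (l i) (l j) ≡ true)
                    (k≁l : ∀ i j → adj G (k i) (l j) ≡ false) where

  open Adjacency G

  private
    env : Fin n → Fin n → ℕ → Fin n
    env w x = at (k 0F ∷ k 1F ∷ k 2F ∷ l 0F ∷ l 1F ∷ l 2F ∷ w ∷ x ∷ []) w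

    open module R w x = Refutation G df av (env w x) using () renaming (⟦_⟧ to Holds)

    frame : List Hyp
    frame = clique (0 ⋯ 2) ∷ clique (3 ⋯ 5)
          ∷ anti 0 (3 ⋯ 5) ∷ anti 1 (3 ⋯ 5) ∷ anti 2 (3 ⋯ 5)
          ∷ apart (6 ∷ 7 ∷ []) (0 ⋯ 5) ∷ star 6 [ 7 ] ∷ []

    all₃ : ∀ {P : Fin n → Set} {f : Fin 3 → Fin n} → (∀ i → P (f i)) → All P (f 0F ∷ f 1F ∷ f 2F ∷ [])
    all₃ p = p 0F ∷ p 1F ∷ p 2F ∷ []

  Far : Fin n → Set
  Far w = (∀ i → w ≢ k i) × (∀ j → w ≢ l j)

  module _ {w x} (far-w : Far w) (far-x : Far x) (wx : w ~ x) where

    private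
      frame-holds : All (Holds w x) frame
      frame-holds = AllPairs.tabulate⁺ k-~ ∷ AllPairs.tabulate⁺ l-~ ∷ all₃ (k≁l 0F) ∷ all₃ (k≁l 1F) ∷ all₃ (k≁l 2F)
        ∷ (apart-from far-w ∷ apart-from far-x ∷ []) ∷ (wx ∷ []) ∷ []
        where
        apart-from : ∀ {y} → Far y → All (y ≢_) (k 0F ∷ k 1F ∷ k 2F ∷ l 0F ∷ l 1F ∷ l 2F ∷ [])
        apart-from (yk , yl) = All.++⁺ (all₃ yk) (all₃ yl)

    -- Otherwise two vertices of L missed by `x` form an edge. It is anticomplete to the path w x k
    -- k′ if `x` touches another k in K, with k′ the third vertex, and to the path from `x` over `w`
    -- and `k 0F` into K if `x` touches none.
    near : w ~ k 0F → (∀ j → w ≁ l j) → x ~ k 0F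
    near w0 w≁l = decidable-stable (x ~? k 0F) λ x≁0 → R.refute w x
      (frame ++ star 6 [ 0 ] ∷ anti 6 (3 ⋯ 5) ∷ anti 7 [ 0 ] ∷ [])
      (on 1 6 (on 2 6 (at4 1 2 6 0 1) (dia≠ 0 1 2 6)) (on 2 6 (dia≠ 2 0 6 1) (on 2 7 (on 1 7 (dia≠ 1 2 7 0)
      (on 3 7 (on 4 7 (on 5 7 (at4 1 5 7 3 4) (dia≠ 3 4 5 7)) (on 5 7 (dia≠ 5 3 7 4) (at6 0 5 4 6 7 2 1)))
      (on 4 7 (on 5 7 (dia≠ 5 4 7 3) (at6 0 5 3 6 7 2 1)) (at6 0 4 3 6 7 2 1)))) (on 3 7 (on 4 7 (on 5 7
      (at4 1 5 7 3 4) (dia≠ 3 4 5 7)) (on 1 7 (on 5 7 (dia≠ 5 3 7 4) (at6 0 5 4 6 7 1 2)) (at6 0 1 2 6 7 3 4)))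
      (on 4 7 (on 1 7 (on 5 7 (dia≠ 5 4 7 3) (at6 0 5 3 6 7 1 2)) (at6 0 1 2 6 7 4 3)) (at6 0 4 3 7 6 0 2))))))
      (All.++⁺ frame-holds ((w0 ∷ []) ∷ all₃ w≁l ∷ (¬~⇒≁ x≁0 ∷ []) ∷ []))

    -- An edge of L missed by `w` and `x` goes with the path from `x` over `w` and `k 0F` into K. If
    -- there is none, they touch different vertices of L, and the third vertex of L starts a path
    -- over the contact of `x` to `x` and `w`, missed by `k 1F` and `k 2F`.
    not-free : w ~ k 0F → ¬ (∀ i → x ≁ k i)
    not-free w0 x≁k = R.refute w x
      (frame ++ star 6 [ 0 ] ∷ anti 7 (0 ⋯ 2) ∷ [])
      (on 2 6 (on 1 6 (at4 1 1 6 0 2) (dia≠ 0 2 1 6)) (on 1 6 (dia≠ 1 0 6 2) (on 4 6 (on 3 6 (on 5 6 (at4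
      1 5 6 3 4) (dia≠ 3 4 5 6)) (on 5 6 (dia≠ 5 4 6 3) (on 5 7 (on 3 7 (on 4 7 (dia≠ 4 7 3 6) (dia≠ 3 5 4 7))
      (at6 0 1 2 3 5 7 6)) (on 3 7 (at6 0 1 2 5 3 7 6) (at6 0 3 5 7 6 0 1))))) (on 5 6 (on 3 6 (dia≠ 3 5 6 4)
      (on 3 7 (on 4 7 (on 5 7 (dia≠ 5 7 3 6) (dia≠ 3 4 5 7)) (at6 0 1 2 4 3 7 6)) (on 4 7 (at6 0 1 2 3 4 7 6)
      (at6 0 4 3 7 6 0 1)))) (on 5 7 (on 4 7 (on 3 7 (at4 1 3 7 4 5) (dia≠ 4 5 3 7)) (at6 0 1 2 4 5 7 6)) (on
      4 7 (at6 0 1 2 5 4 7 6) (at6 0 4 5 7 6 0 1)))))))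
      (All.++⁺ frame-holds ((w0 ∷ []) ∷ all₃ x≁k ∷ []))

    -- By diamonds, `x` misses `l 0F` and some other vertex l of L. The path l, `l 0F`, `w`, `x` is
    -- anticomplete to the edge of `k 1F` and `k 2F`.
    not-both : w ~ k 0F → x ~ k 0F → ¬ w ~ l 0F
    not-both w0 x0 wl = R.refute w x
      (frame ++ star 6 (0 ∷ 3 ∷ []) ∷ star 7 [ 0 ] ∷ [])
      (on 3 7 (dia 7 6 3 0 4) (on 1 7 (on 1 6 (at4 1 1 6 0 7) (dia≠ 0 7 1 6)) (on 1 6 (dia≠ 6 0 1 7) (on 2 6
      (dia≠ 2 0 6 1) (on 2 7 (dia≠ 2 0 7 1) (on 4 6 (on 5 6 (at4 1 5 6 3 4) (dia≠ 3 4 5 6)) (on 4 7 (on 5 7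
      (dia≠ 5 4 7 3) (on 5 6 (dia≠ 5 3 6 4) (at6 0 1 2 5 3 6 7))) (at6 0 1 2 4 3 6 7))))))))
      (All.++⁺ frame-holds ((w0 ∷ wl ∷ []) ∷ (x0 ∷ []) ∷ []))

module AnticompleteTriangles {n} {G : Graph n} (df : Adjacency.DiamondFree G)
    (av : Adjacency.Avoids G (P₂+P₄ ∷ complete 4 ∷ [])) (nonsimplicial : ∀ v → NonSimplicial G v)
    (K L : HasClique G 3) (anticomplete : ∀ i j → adj G (proj₁ K i) (proj₁ L j) ≡ false) where

  open Adjacency G

  private
    maximum : ¬ HasClique G 4
    maximum = avoids⇒no-clique G (All.head (All.tail av))

    open MaximumClique {G = G} df maximum K
    module M = MaximumClique {G = G} df maximum L
    open M using () renaming (κ to ℓ; κ-~ to ℓ-~)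

    Far : Fin n → Set
    Far w = Outside w × M.Outside w

    module T (i j : Fin 3) = TwoTriangles {G = G} df av {κ ∘ rotate i} {ℓ ∘ rotate j}
      (λ p → κ-~ (p ∘ rotate-injective i)) (λ p → ℓ-~ (p ∘ rotate-injective j)) (λ _ _ → anticomplete _ _)

    far : ∀ i j {w} → Far w → T.Far i j w
    far i j (p , q) = (λ _ → p _) , λ _ → q _

    front : ∀ {w i} {f : Fin 3 → Fin n} → w ~ f i → w ~ f (rotate i 0F)
    front {w} {i} {f} = subst (λ j → w ~ f j) (sym (rotate-front i))

    back : ∀ {w i} {f : Fin 3 → Fin n} → w ~ f (rotate i 0F) → w ~ f i
    back {w} {i} {f} = subst (λ j → w ~ f j) (rotate-front i)

    typed-meets : ∀ {w i} → Far w → w ~ κ i → ∃[ j ] w ~ ℓ j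
    typed-meets {w} {i} fw wi with M.contact w
    ... | inj₁ c = c
    ... | inj₂ none with y , wy , y≢ , y≁ ← escape {G = G} df wi (nonsimplicial w) | position y | M.position y
    ...   | inj₁ (j , refl) | _ = contradiction (cong κ (unique-contact (proj₁ fw) wy wi)) y≢
    ...   | inj₂ _ | inj₁ (j , refl) = contradiction (none j) (~⇒¬≁ wy)
    ...   | inj₂ o | inj₂ o′ = contradiction y≁ (~⇒¬≁ (back {f = κ}
      (T.near i 0F (far i 0F fw) (far i 0F (o , o′)) wy (front {f = κ} wi) λ _ → none _)))

    Free : Fin n → Set
    Free w = ∀ i → w ≁ κ i

    in-Free = colour-within {G = G} (λ w → 𝔽.all? λ i → adj G w (κ i) 𝔹.≟ false) 1 df
      (λ { (fa ∷ fb ∷ fc ∷ fd ∷ []) p → All.head av _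
           ( (κ-~ {0F} {1F} (λ ()) ∷ ≁-sym (fa 0F) ∷ ≁-sym (fb 0F) ∷ ≁-sym (fc 0F) ∷ ≁-sym (fd 0F) ∷ [])
           , (≁-sym (fa 1F) ∷ ≁-sym (fb 1F) ∷ ≁-sym (fc 1F) ∷ ≁-sym (fd 1F) ∷ []) , p) })
      (λ vs _ → All.head (All.tail av) vs)

    data Kind (w : Fin n) : Set where
      inK   : ∀ i → w ≡ κ i → Kind w
      inL   : ∀ j → w ≡ ℓ j → Kind w
      typed : ∀ i → Far w → w ~ κ i → Kind w
      free  : Far w → Free w → Kind w

    kind : ∀ w → Kind w
    kind w with position w | M.position w | contact w
    ... | inj₁ (i , e) | _            | _             = inK i e
    ... | inj₂ _       | inj₁ (j , e) | _             = inL j e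
    ... | inj₂ o       | inj₂ o′      | inj₁ (i , wi) = typed i (o , o′) wi
    ... | inj₂ o       | inj₂ o′      | inj₂ none     = free (o , o′) none

    -- K and L are anticomplete and share three colours. The vertices with contact `κ i` are
    -- independent, since each also touches L, and anticomplete to the free ones, which form a
    -- K₄-free cograph; all of these share the other three.
    colour : ∀ {w} → Kind w → Fin 2 × Fin 3
    colour (inK i _)      = 0F , i
    colour (inL j _)      = 0F , j
    colour (typed i _ _)  = 1F , i
    colour {w} (free _ _) = 1F , proj₁ in-Free w

    differ : ∀ {w x} (p : Kind w) (q : Kind x) → w ~ x → colour p ≢ colour q
    differ (inK i refl) (inK j refl) wx refl = ~⇒≢ wx refl
    differ (inL i refl) (inL j refl) wx refl = ~⇒≢ wx refl
    differ (inK i refl) (inL j refl) wx _ = ~⇒¬≁ wx (anticomplete i j)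
    differ (inL j refl) (inK i refl) wx _ = ~⇒¬≁ (~-sym wx) (anticomplete i j)
    differ (inK _ _) (typed _ _ _) wx ()
    differ (inK _ _) (free _ _) wx ()
    differ (inL _ _) (typed _ _ _) wx ()
    differ (inL _ _) (free _ _) wx ()
    differ (typed _ _ _) (inK _ _) wx ()
    differ (typed _ _ _) (inL _ _) wx ()
    differ (free _ _) (inK _ _) wx ()
    differ (free _ _) (inL _ _) wx ()
    differ (typed i fw wi) (typed .i fx xi) wx refl with j , wj ← typed-meets fw wi =
      T.not-both i j (far i j fw) (far i j fx) wx (front {f = κ} wi) (front {f = κ} xi) (front {f = ℓ} wj)
    differ (typed i fw wi) (free fx f) wx _ =
      T.not-free i 0F (far i 0F fw) (far i 0F fx) wx (front {f = κ} wi) λ _ → f _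
    differ (free fx f) (typed i fw wi) wx _ =
      T.not-free i 0F (far i 0F fw) (far i 0F fx) (~-sym wx) (front {f = κ} wi) λ _ → f _
    differ {w} {x} (free _ f) (free _ g) wx e = proj₂ in-Free f g wx (cong proj₂ e)

  colourable : Colourable G 6
  colourable = (λ x → uncurry combine (colour (kind x))) , λ x y xy e →
    differ (kind x) (kind y) xy (let p , q = 𝔽.combine-injective _ _ _ _ e in cong₂ _,_ p q)

module _ {n} {G : Graph n} (df : Adjacency.DiamondFree G) (av : Adjacency.Avoids G (P₂+P₄ ∷ complete 4 ∷ [])) where

  open Adjacency G

  private
    Beside : Fin n → Fin n → Fin n → Set
    Beside a b x = x ≁ a × x ≁ b

    beside? : ∀ a b x → Dec (Beside a b x)
    beside? a b x = (adj G x a 𝔹.≟ false) ×-dec (adj G x b 𝔹.≟ false)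

    TriangleBeside : Fin n → Fin n → Set
    TriangleBeside a b = ∃[ vs ] length vs ≡ 3 × All (Beside a b) vs × Induces (complete 3) vs

    triangleBeside? : ∀ a b → Dec (TriangleBeside a b)
    triangleBeside? a b = ∃list? G (λ vs → All.all? (beside? a b) vs ×-dec induces? G (complete 3) vs) 3

  -- N(a), N(b) ∖ N(a) and the vertices nonadjacent to both are bipartite.
  no-triangle-beside⇒colourable : ∀ {a b} → a ~ b → ¬ TriangleBeside a b → Colourable G 6
  no-triangle-beside⇒colourable {a} {b} ab none =
    (λ x → uncurry combine (colour x)) , λ x y xy e →
      differ x y xy (let p , q = 𝔽.combine-injective _ _ _ _ e in cong₂ _,_ p q)
    where
    -- Diamond-freeness excludes an induced path on three vertices in a neighbourhood, and
    -- K₄-freeness a triangle.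
    in-N : ∀ v → Σ[ c ∈ (Fin n → Fin 2) ] (∀ {x y} → v ~ x → v ~ y → x ~ y → c x ≢ c y)
    in-N v = colour-within {G = G} (v ~?_) 0 df
      (λ { (va ∷ vb ∷ vc ∷ vd ∷ []) ((ab ∷ ac ∷ ad ∷ []) , (bc ∷ _) , (cd ∷ _) , _) →
           ~⇒¬≁ cd (subst (_≁ _) (df vb va vc (~-sym ab) bc ac) ad) })
      (λ { (x ∷ y ∷ z ∷ []) (vx ∷ vy ∷ vz ∷ []) i → All.head (All.tail av) (v ∷ x ∷ y ∷ z ∷ []) ((vx ∷ vy ∷ vz ∷ []) , i) })
    beside = colour-within {G = G} (beside? a b) 0 df
      (λ { ((xa , xb) ∷ (ya , yb) ∷ (za , zb) ∷ (wa , wb) ∷ []) p → All.head av _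
        ((ab ∷ ≁-sym xa ∷ ≁-sym ya ∷ ≁-sym za ∷ ≁-sym wa ∷ []) , (≁-sym xb ∷ ≁-sym yb ∷ ≁-sym zb ∷ ≁-sym wb ∷ []) , p) })
      (λ vs ps i → none (vs , induces-length G (complete 3) vs i , ps , i))
    colour : Fin n → Fin 3 × Fin 2
    colour x with x ≟ a | a ~? x | b ~? x
    ... | yes _ | _     | _     = 2F , 0F
    ... | no _  | yes _ | _     = 0F , proj₁ (in-N a) x
    ... | no _  | no _  | yes _ = 1F , proj₁ (in-N b) x
    ... | no _  | no _  | no _  = 2F , proj₁ beside x
    differ : ∀ x y → x ~ y → colour x ≢ colour y
    differ x y xy with x ≟ a | a ~? x | b ~? x | y ≟ a | a ~? y | b ~? y
    ... | yes refl | _ | _ | yes refl | _ | _ = λ _ → ~⇒≢ xy refl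
    ... | yes refl | _ | _ | no _ | yes _ | _ = λ ()
    ... | yes refl | _ | _ | no _ | no ¬ay | _ = λ _ → ¬ay xy
    ... | no _ | yes _ | _ | yes refl | _ | _ = λ ()
    ... | no _ | no ¬ax | _ | yes refl | _ | _ = λ _ → ¬ax (~-sym xy)
    ... | no _ | yes ax | _ | no _ | yes ay | _ = λ e → proj₂ (in-N a) ax ay xy (cong proj₂ e)
    ... | no _ | yes _ | _ | no _ | no _ | yes _ = λ ()
    ... | no _ | yes _ | _ | no _ | no _ | no _ = λ ()
    ... | no _ | no _ | yes _ | no _ | yes _ | _ = λ ()
    ... | no _ | no _ | yes bx | no _ | no _ | yes by = λ e → proj₂ (in-N b) bx by xy (cong proj₂ e)
    ... | no _ | no _ | yes _ | no _ | no _ | no _ = λ ()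
    ... | no _ | no _ | no _ | no _ | yes _ | _ = λ ()
    ... | no _ | no _ | no _ | no _ | no _ | yes _ = λ ()
    ... | no _ | no ax | no bx | no _ | no ay | no by = λ e → proj₂ beside
      (≁-sym (¬~⇒≁ ax) , ≁-sym (¬~⇒≁ bx)) (≁-sym (¬~⇒≁ ay) , ≁-sym (¬~⇒≁ by)) xy (cong proj₂ e)

  private
    -- For use when every edge has a triangle anticomplete to it: the triangle pqr beside xy must
    -- then miss z as well, since the edge zp would have its own triangle uvw. This produces two
    -- anticomplete triangles.
    three-triangles : ∀ {x y z p q r u v w} → AllPairs _~_ (x ∷ y ∷ z ∷ []) → AllPairs _~_ (p ∷ q ∷ r ∷ []) →
      AllPairs _~_ (u ∷ v ∷ w ∷ []) → All (Beside x y) (p ∷ q ∷ r ∷ []) → z ~ p → All (Beside z p) (u ∷ v ∷ w ∷ []) → ⊥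
    three-triangles {x} {y} {z} {p} {q} {r} {u} {v} {w} K L M KL zp zpM = refute
      (clique (0 ⋯ 2) ∷ clique (3 ⋯ 5) ∷ clique (6 ⋯ 8) ∷ star 2 [ 3 ]
        ∷ anti 0 (3 ⋯ 5) ∷ anti 1 (3 ⋯ 5) ∷ anti 2 (6 ⋯ 8) ∷ anti 3 (6 ⋯ 8) ∷ [])
      (on 2 4 (on 2 5 (at4 1 2 5 3 4) (dia 3 4 2 5 0)) (on 2 5 (dia 5 3 2 4 0) (on 5 8 (on 4 8 (dia 4 5 8 3
      6) (on 5 6 (on 5 7 (at4 1 5 7 6 8) (dia 6 8 5 7 3)) (on 5 7 (dia 7 8 5 6 3) (on 0 7 (on 1 7 (dia 1 0
      7 2 6) (on 1 6 (on 0 6 (dia 0 6 1 7 2) (on 0 8 (dia 8 7 0 6 2) (on 1 8 (dia 8 6 1 7 2) (on 4 6 (on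
      4 7 (dia 7 6 4 8 3) (at6 0 1 2 4 5 8 7)) (at6 0 0 2 4 5 8 6))))) (at6 0 6 7 1 2 3 5))) (on 0 6 (on 0 8 (dia 8
      6 0 7 2) (on 1 6 (dia 1 0 6 2 7) (on 1 7 (on 1 8 (dia 8 7 1 6 2) (on 4 6 (on 4 7 (dia 7 6 4 8 3) (at6
      0 0 2 4 5 8 7)) (at6 0 1 2 4 5 8 6))) (at6 0 3 5 1 0 6 7)))) (at6 0 6 7 0 2 3 5)))))) (on 0 6 (on 1 6 (dia 1 0
      6 2 7) (on 0 8 (on 0 7 (at4 1 0 7 6 8) (dia 6 8 0 7 2)) (on 0 7 (dia 7 6 0 8 2) (on 5 7 (on 4 7 (dia
      4 5 7 3 6) (on 4 8 (on 4 6 (dia 6 8 4 7 3) (on 5 6 (dia 6 7 5 8 3) (on 1 7 (on 1 8 (dia 8 7 1 6 2)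
      (at6 0 3 5 1 0 6 8)) (at6 0 3 4 1 0 6 7)))) (at6 0 0 2 4 5 7 8))) (at6 0 7 8 5 3 2 0))))) (on 0 8 (on 0 7 (dia
      7 8 0 6 2) (on 1 8 (dia 1 0 8 2 6) (on 1 6 (on 1 7 (dia 7 6 1 8 2) (on 5 7 (on 4 7 (dia 4 5 7 3 6)
      (on 4 6 (on 4 8 (dia 8 6 4 7 3) (at6 0 1 2 4 5 7 8)) (at6 0 4 3 7 6 1 0))) (at6 0 5 3 7 8 0 1))) (on 5 6
      (on 4 6 (dia 4 5 6 3 7) (on 4 7 (on 4 8 (dia 8 7 4 6 3) (at6 0 1 2 4 5 6 8)) (at6 0 7 6 4 3 2 0))) (at6 0 5
      3 6 8 0 1))))) (on 5 6 (on 4 6 (dia 4 5 6 3 7) (on 4 8 (on 4 7 (dia 7 8 4 6 3) (on 0 7 (on 1 7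
      (dia 1 0 7 2 6) (on 1 6 (on 1 8 (dia 8 6 1 7 2) (on 5 7 (dia 7 6 5 8 3) (at6 0 1 2 5 4 8 7))) (at6 0 3 4 1
      0 7 6))) (at6 0 7 6 0 2 3 4))) (at6 0 0 2 4 5 6 8))) (at6 0 6 8 5 3 2 0)))))))
      (K ∷ L ∷ M ∷ (zp ∷ []) ∷ All.map (≁-sym ∘ proj₁) KL ∷ All.map (≁-sym ∘ proj₂) KL
        ∷ All.map (≁-sym ∘ proj₁) zpM ∷ All.map (≁-sym ∘ proj₂) zpM ∷ [])
      where open Refutation G df av (at (x ∷ y ∷ z ∷ p ∷ q ∷ r ∷ u ∷ v ∷ w ∷ []) x)

    pairs : ∀ {x y z} → Induces (complete 3) (x ∷ y ∷ z ∷ []) → AllPairs _~_ (x ∷ y ∷ z ∷ [])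
    pairs = proj₁ ∘ complete⇒pairs G 3 _

  three⇒colourable : Critical G 6 → Colourable G 6
  three⇒colourable crit with find-simplicial {G = G}
  ... | inj₁ (v , s) = remove-simplicial G crit (λ big → avoids⇒no-clique G (All.head (All.tail av)) (clique-≤ G (ℕ.m≤n+m 4 3) big)) s
  ... | inj₂ nonsimplicial with 𝔽.any? (λ a → 𝔽.any? λ b → (a ~? b) ×-dec ¬? (triangleBeside? a b))
  ...   | yes (a , b , ab , none) = no-triangle-beside⇒colourable ab none
  ...   | no all with 𝔽.any? (λ a → 𝔽.any? (a ~?_))
  ...     | no no-edge = (λ _ → 0F) , λ a b ab → contradiction (a , b , ab) no-edge
  ...     | yes (a , b , ab) = triangle (beside ab)
    where
    beside : ∀ {a b} → a ~ b → TriangleBeside a b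
    beside {a} {b} ab = decidable-stable (triangleBeside? a b) λ none → all (a , b , ab , none)
    impossible : ∀ {x y z p q r} → AllPairs _~_ (x ∷ y ∷ z ∷ []) → AllPairs _~_ (p ∷ q ∷ r ∷ []) →
                 All (Beside x y) (p ∷ q ∷ r ∷ []) → ¬ z ~ p
    impossible K L KL zp with u ∷ v ∷ w ∷ [] , _ , zpM , i ← beside zp = three-triangles K L (pairs i) KL zp zpM
    triangle : TriangleBeside a b → Colourable G 6
    triangle (x ∷ y ∷ z ∷ [] , _ , _ , i) with pairs i
    ... | K@((xy ∷ xz ∷ []) ∷ (yz ∷ []) ∷ [] ∷ []) with beside xy
    ...   | p ∷ q ∷ r ∷ [] , _ , KL@((px , py) ∷ (qx , qy) ∷ (rx , ry) ∷ []) , i′ with pairs i′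
    ...     | L@((pq ∷ pr ∷ []) ∷ (qr ∷ []) ∷ [] ∷ []) =
      AnticompleteTriangles.colourable df av nonsimplicial
        (list-clique G (x ∷ y ∷ z ∷ []) K) (list-clique G (p ∷ q ∷ r ∷ []) L) λ i j → All.lookup (All.lookup anticomplete (∈-lookup i)) (∈-lookup j)
      where
      zp = ¬~⇒≁ (impossible K L KL)
      -- `three-triangles` singles out the first vertex of its second triangle, so q and then r are
      -- moved there.
      zq = ¬~⇒≁ (impossible K ((~-sym pq ∷ qr ∷ []) ∷ (pr ∷ []) ∷ [] ∷ []) ((qx , qy) ∷ (px , py) ∷ (rx , ry) ∷ []))
      zr = ¬~⇒≁ (impossible K ((~-sym pr ∷ ~-sym qr ∷ []) ∷ (pq ∷ []) ∷ [] ∷ []) ((rx , ry) ∷ (px , py) ∷ (qx , qy) ∷ []))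
      anticomplete : All (λ k → All (k ≁_) (p ∷ q ∷ r ∷ [])) (x ∷ y ∷ z ∷ [])
      anticomplete = All.map (≁-sym ∘ proj₁) KL ∷ All.map (≁-sym ∘ proj₂) KL ∷ (zp ∷ zq ∷ zr ∷ []) ∷ []

-- Combining the clique numbers

six-colourable : ∀ {n} (G : Graph n) → Adjacency.DiamondFree G →
  Adjacency.Avoids G (P₂+P₄ ∷ complete 7 ∷ []) → Colourable G 6
six-colourable = critical-induction _ 5 λ { G df (w ∷ k₇ ∷ []) crit →
  case hasClique? G 6 of λ
  { (yes K) → MaximumClique.six⇒colourable df (avoids⇒no-clique G k₇) K (w ∷ []) ℕ.≤-refl crit ℕ.≤-refl
  ; (no ¬6) → case hasClique? G 5 of λ
  { (yes K) → MaximumClique.five⇒colourable df ¬6 K refl (w ∷ []) (ℕ.n≤1+n 5) crit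
  ; (no ¬5) → case hasClique? G 4 of λ
  { (yes K) → FourCliques.four⇒colourable df (w ∷ no-clique⇒avoids G ¬5 ∷ []) K crit
  ; (no ¬4) → three⇒colourable df (w ∷ no-clique⇒avoids G ¬4 ∷ []) crit } } } }

-- Induction on the clique bound and, within it, on the number of vertices: a clique of full size
-- allows the cograph argument, and without one a colour can be spared.
clique-colourable : ∀ j {n} (G : Graph n) → Adjacency.DiamondFree G →
  Adjacency.Avoids G (P₂+P₄ ∷ complete (7 + j) ∷ []) → Colourable G (6 + j)
clique-colourable zero    = six-colourable
clique-colourable (suc j) = critical-induction _ (6 + j) λ { G df (w ∷ k ∷ []) crit →
  case hasClique? G (7 + j) of λ
  { (yes K) → MaximumClique.six⇒colourable df (avoids⇒no-clique G k) K (w ∷ []) ℕ.≤-refl crit (ℕ.m≤m+n 6 (suc j))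
  ; (no ¬K) → Colourable-≤ {G = G} (ℕ.n≤1+n _) (clique-colourable j G df (w ∷ no-clique⇒avoids G ¬K ∷ [])) } }

-- Kempe chains

-- Chains in the colours `a` and `b` start at the neighbours of `v` coloured `a`. A shortest one to
-- a neighbour coloured `b` has odd length and closes through `v`: length 1 is excluded by
-- `no-edge`, lengths 3 and 5 give C₅ and C₇, and six edges already contain P₂+P₄. So exchanging the
-- colours on the chains frees `a` at `v`.
module Kempe {n} {G : Graph n} (av : Adjacency.Avoids G (P₂+P₄ ∷ cycle 5 ∷ cycle 7 ∷ []))
             {k} {v : Fin n} {c : Fin n → Fin k} (off : ProperOff G v c) {a b : Fin k} (a≢b : a ≢ b)
             (no-edge : ∀ {x y} → adj G v x ≡ true → adj G v y ≡ true → adj G x y ≡ true → c x ≡ a → c y ≢ b) where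

  open Adjacency G

  private
    shade : ℕ → Fin k
    shade zero          = a
    shade (suc zero)    = b
    shade (suc (suc i)) = shade i

    -- Walks of length i that avoid v, alternate between the colours a and b,
    -- and start at a neighbour of v coloured a.
    Reach : ℕ → Fin n → Set
    Reach zero    w = v ~ w × c w ≡ a
    Reach (suc i) w = w ≢ v × (c w ≡ a ⊎ c w ≡ b) × ∃[ u ] Reach i u × u ~ w

    reach? : ∀ i w → Dec (Reach i w)
    reach? zero    w = (v ~? w) ×-dec (c w ≟ a)
    reach? (suc i) w = ¬? (w ≟ v) ×-dec ((c w ≟ a) ⊎-dec (c w ≟ b)) ×-dec 𝔽.any? λ u → reach? i u ×-dec (u ~? w)

    reach-≢ : ∀ i {w} → Reach i w → w ≢ v
    reach-≢ zero    (vw , _) = ≢-sym (~⇒≢ vw)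
    reach-≢ (suc i) (w≢v , _) = w≢v

    alternate : ∀ i {q} → q ≡ a ⊎ q ≡ b → shade i ≢ q → q ≡ shade (suc i)
    alternate zero          (inj₁ refl) s≢q = contradiction refl s≢q
    alternate zero          (inj₂ refl) _   = refl
    alternate (suc zero)    (inj₁ refl) _   = refl
    alternate (suc zero)    (inj₂ refl) s≢q = contradiction refl s≢q
    alternate (suc (suc i)) = alternate i

    reach-shade : ∀ i {w} → Reach i w → c w ≡ shade i
    reach-shade zero    (_ , cw) = cw
    reach-shade (suc i) (w≢v , col , u , r , uw) =
      alternate i col (subst (_≢ _) (reach-shade i r) (off (reach-≢ i r) w≢v uw))

    shade-a⊎b : ∀ i → shade i ≡ a ⊎ shade i ≡ b
    shade-a⊎b zero          = inj₁ refl
    shade-a⊎b (suc zero)    = inj₂ refl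
    shade-a⊎b (suc (suc i)) = shade-a⊎b i

    step : ∀ i {u w} → Reach i u → w ≢ v → c w ≡ a ⊎ c w ≡ b → u ~ w → Reach (suc i) w
    step i r w≢v col uw = w≢v , col , _ , r , uw

    Dist : ℕ → Fin n → Set
    Dist i w = Reach i w × (∀ {j} → j < i → ¬ Reach j w)

    nearest : ∀ m {i w} → i < m → Reach i w → ∃[ j ] j < m × Dist j w
    nearest (suc m) {i} {w} i<m r with ℕ.anyUpTo? (λ j → reach? j w) m
    ... | yes (j , j<m , rj) = let l , l<m , d = nearest m j<m rj in l , ℕ.m<n⇒m<1+n l<m , d
    ... | no none = i , i<m , r , λ j<i rj → none (_ , ℕ.<-≤-trans j<i (s≤s⁻¹ i<m) , rj)

    previous : ∀ i {w} → Dist (suc i) w → ∃[ u ] Dist i u × u ~ w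
    previous i ((w≢v , col , u , r , uw) , far) =
      u , (r , λ {j} j<i rj → far (s≤s j<i) (step j rj w≢v col uw)) , uw

    dist-shade : ∀ i {w} → Dist i w → c w ≡ shade i
    dist-shade i (r , _) = reach-shade i r

    skip : ∀ i j {_ : T (suc i <ᵇ j)} {u w} → Dist i u → Dist j w → u ≁ w
    skip i (suc j) {i<j} (ri , _) ((w≢v , col , _) , far) =
      ¬~⇒≁ λ uw → far (ℕ.<ᵇ⇒< (suc i) (suc j) i<j) (step i ri w≢v col uw)

    no-six : ∀ {w} → ¬ Dist 6 w
    no-six d₆ with _ , d₅ , e₅ ← previous 5 d₆ with _ , d₄ , e₄ ← previous 4 d₅ with _ , d₃ , e₃ ← previous 3 d₄
      with _ , d₂ , e₂ ← previous 2 d₃ with _ , d₁ , e₁ ← previous 1 d₂ with _ , d₀ , e₀ ← previous 0 d₁ =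
      -- Distances 0 and 1 give the P₂, distances 3 to 6 the P₄.
      All.head av _
        ( (e₀ ∷ skip 0 3 d₀ d₃ ∷ skip 0 4 d₀ d₄ ∷ skip 0 5 d₀ d₅ ∷ skip 0 6 d₀ d₆ ∷ [])
        , (skip 1 3 d₁ d₃ ∷ skip 1 4 d₁ d₄ ∷ skip 1 5 d₁ d₅ ∷ skip 1 6 d₁ d₆ ∷ [])
        , (e₃ ∷ skip 3 5 d₃ d₅ ∷ skip 3 6 d₃ d₆ ∷ []) , (e₄ ∷ skip 4 6 d₄ d₆ ∷ []) , (e₅ ∷ []) , [] , tt)

    -- A vertex coloured `a` and adjacent to `v` is itself a start, at distance 0.
    not-a : ∀ {i w} → shade (suc i) ≡ a → Dist (suc i) w → v ≁ w
    not-a {i} s≡a d@(_ , far) = ¬~⇒≁ λ vw → far z<s (vw , trans (dist-shade (suc i) d) s≡a)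

    start : ∀ {w} → Dist 0 w → v ~ w
    start ((vw , _) , _) = vw

    not-first : ∀ {w} → Dist 1 w → v ≁ w
    not-first d₁ with _ , d₀ , e₀ ← previous 0 d₁ =
      ¬~⇒≁ λ vw → no-edge (start d₀) vw e₀ (dist-shade 0 d₀) (dist-shade 1 d₁)

    not-third : ∀ {w} → Dist 3 w → v ≁ w
    not-third d₃ with _ , d₂ , e₂ ← previous 2 d₃ with _ , d₁ , e₁ ← previous 1 d₂ with _ , d₀ , e₀ ← previous 0 d₁ =
      ¬~⇒≁ λ vw → All.head (All.tail av) _
        ( (start d₀ ∷ not-first d₁ ∷ not-a refl d₂ ∷ vw ∷ [])
        , (e₀ ∷ skip 0 2 d₀ d₂ ∷ skip 0 3 d₀ d₃ ∷ []) , (e₁ ∷ skip 1 3 d₁ d₃ ∷ []) , (e₂ ∷ []) , [] , tt)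

    not-fifth : ∀ {w} → Dist 5 w → v ≁ w
    not-fifth d₅ with _ , d₄ , e₄ ← previous 4 d₅ with _ , d₃ , e₃ ← previous 3 d₄
      with _ , d₂ , e₂ ← previous 2 d₃ with _ , d₁ , e₁ ← previous 1 d₂ with _ , d₀ , e₀ ← previous 0 d₁ =
      ¬~⇒≁ λ vw → All.head (All.tail (All.tail av)) _
        ( (start d₀ ∷ not-first d₁ ∷ not-a refl d₂ ∷ not-third d₃ ∷ not-a refl d₄ ∷ vw ∷ [])
        , (e₀ ∷ skip 0 2 d₀ d₂ ∷ skip 0 3 d₀ d₃ ∷ skip 0 4 d₀ d₄ ∷ skip 0 5 d₀ d₅ ∷ [])
        , (e₁ ∷ skip 1 3 d₁ d₃ ∷ skip 1 4 d₁ d₄ ∷ skip 1 5 d₁ d₅ ∷ [])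
        , (e₂ ∷ skip 2 4 d₂ d₄ ∷ skip 2 5 d₂ d₅ ∷ []) , (e₃ ∷ skip 3 5 d₃ d₅ ∷ []) , (e₄ ∷ []) , [] , tt)

    -- No distance exceeds 5, so the bound on the length loses nothing and keeps membership
    -- decidable.
    Chain : Fin n → Set
    Chain w = ∃[ i ] i < 6 × Reach i w

    chain? : ∀ w → Dec (Chain w)
    chain? w = ℕ.anyUpTo? (λ i → reach? i w) 6

    chain-closed : ∀ {u w} → Chain u → w ≢ v → c w ≡ a ⊎ c w ≡ b → u ~ w → Chain w
    chain-closed (i , i<6 , r) w≢v col uw with j , s≤s j≤6 , d ← nearest 7 (s≤s i<6) (step i r w≢v col uw)
      with ℕ.m≤n⇒m<n∨m≡n j≤6
    ... | inj₁ j<6  = j , j<6 , proj₁ d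
    ... | inj₂ refl = contradiction d no-six

    swap : Fin k → Fin k
    swap q = if does (q ≟ a) then b else if does (q ≟ b) then a else q

    swap-a : swap a ≡ b
    swap-a rewrite dec-true (a ≟ a) refl = refl

    swap-b : swap b ≡ a
    swap-b rewrite dec-false (b ≟ a) (≢-sym a≢b) | dec-true (b ≟ b) refl = refl

    swap-involutive : ∀ q → swap (swap q) ≡ q
    swap-involutive q with q ≟ a
    ... | yes refl = swap-b
    ... | no q≢a with q ≟ b
    ...   | yes refl = swap-a
    ...   | no q≢b rewrite dec-false (q ≟ a) q≢a | dec-false (q ≟ b) q≢b = refl

    swap-a⊎b : ∀ {q} → q ≡ a ⊎ q ≡ b → swap q ≡ a ⊎ swap q ≡ b
    swap-a⊎b (inj₁ refl) = inj₂ swap-a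
    swap-a⊎b (inj₂ refl) = inj₁ swap-b

    recolour : Fin n → Fin k
    recolour w with chain? w
    ... | yes _ = swap (c w)
    ... | no _  = c w

    chain-a⊎b : ∀ {w} → Chain w → c w ≡ a ⊎ c w ≡ b
    chain-a⊎b (i , _ , r) = Sum.map (trans (reach-shade i r)) (trans (reach-shade i r)) (shade-a⊎b i)

    boundary : ∀ {x y} → Chain x → ¬ Chain y → y ≢ v → x ~ y → swap (c x) ≢ c y
    boundary sx ¬sy y≢v xy e =
      ¬sy (chain-closed sx y≢v (Sum.map (trans (sym e)) (trans (sym e)) (swap-a⊎b (chain-a⊎b sx))) xy)

    recolour-off : ProperOff G v recolour
    recolour-off {x} {y} x≢v y≢v xy with chain? x | chain? y
    ... | no _   | no _   = off x≢v y≢v xy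
    ... | yes sx | no ¬sy = boundary sx ¬sy y≢v xy
    ... | no ¬sx | yes sy = ≢-sym (boundary sy ¬sx x≢v (~-sym xy))
    ... | yes _  | yes _  = λ e → off x≢v y≢v xy
      (trans (sym (swap-involutive (c x))) (trans (cong swap e) (swap-involutive (c y))))

    near-chain : ∀ i {w} → i < 6 → Dist i w → v ~ w → c w ≡ a
    near-chain 0 _ d vw = dist-shade 0 d
    near-chain 1 _ d vw = contradiction (not-first d) (~⇒¬≁ vw)
    near-chain 2 _ d vw = dist-shade 2 d
    near-chain 3 _ d vw = contradiction (not-third d) (~⇒¬≁ vw)
    near-chain 4 _ d vw = dist-shade 4 d
    near-chain 5 _ d vw = contradiction (not-fifth d) (~⇒¬≁ vw)
    near-chain (suc (suc (suc (suc (suc (suc i)))))) (s≤s (s≤s (s≤s (s≤s (s≤s (s≤s ())))))) _ _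

    recolour-free : ∀ {w} → v ~ w → recolour w ≢ a
    recolour-free {w} vw with chain? w
    ... | no ¬s = λ e → ¬s (0 , z<s , vw , e)
    ... | yes (i , i<6 , r) with j , j<6 , d ← nearest 6 i<6 r = λ e →
      a≢b (trans (sym e) (trans (cong swap (near-chain j j<6 d vw)) swap-a))

  colourable : Colourable G k
  colourable = extend {G = G} recolour-off a recolour-free

module _ {n} {G : Graph n} (av : Adjacency.Avoids G (P₂+P₄ ∷ cycle 5 ∷ cycle 7 ∷ [])) where

  open Adjacency G

  kempe : ∀ {k v} {c : Fin n → Fin k} → ProperOff G v c → ∀ {a b} → a ≢ b →
          Colourable G k ⊎ ∃₂ λ x y → v ~ x × v ~ y × x ~ y × c x ≡ a × c y ≡ b
  kempe {v = v} {c} off {a} {b} a≢b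
    with 𝔽.any? (λ x → 𝔽.any? λ y → (v ~? x) ×-dec (v ~? y) ×-dec (x ~? y) ×-dec (c x ≟ a) ×-dec (c y ≟ b))
  ... | yes p   = inj₂ p
  ... | no none = inj₁ (Kempe.colourable {G = G} av off a≢b λ vx vy xy ca cb → none (_ , _ , vx , vy , xy , ca , cb))

-- Kempe chains at a maximum clique

module _ {a} {A : Set a} where

  all-or : ∀ {m} {B : Fin m → Set} → (∀ d → A ⊎ B d) → A ⊎ (∀ d → B d)
  all-or {zero}  f = inj₂ λ ()
  all-or {suc m} {B} f with f zero | all-or (f ∘ suc)
  ... | inj₁ p | _      = inj₁ p
  ... | inj₂ _ | inj₁ p = inj₁ p
  ... | inj₂ p | inj₂ q = inj₂ λ { zero → p ; (suc d) → q d }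

-- Colour everything but κ i; some colour γ is not used on K. Kempe chains
-- give, for each other vertex of K, an edge in the neighbourhood of κ i coloured
-- γ and like that vertex.
module Flaps {n} {G : Graph n} (df : Adjacency.DiamondFree G)
             (av : Adjacency.Avoids G (P₂+P₄ ∷ cycle 5 ∷ cycle 7 ∷ [])) {m} (maximum : ¬ HasClique G (2 + m))
             (K : HasClique G (1 + m)) (crit : Critical G (1 + m)) where

  open Adjacency G
  open MaximumClique {G = G} df maximum K

  record FlapsAt (i : Fin (1 + m)) : Set where
    field
      x y   : Fin m → Fin n
      x-out : ∀ d → Outside (x d)
      y-out : ∀ d → Outside (y d)
      ix    : ∀ d → κ i ~ x d
      iy    : ∀ d → κ i ~ y d
      xy    : ∀ d → x d ~ y d
      x≁x   : ∀ d e → x d ≁ x e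
      x≢y   : ∀ d e → x d ≢ y e
      y≢y   : ∀ {d e} → d ≢ e → y d ≢ y e

    misses : ∀ {z j} → Outside z → κ i ~ z → j ≢ i → κ j ≁ z
    misses out iz j≢i = ≁-sym (¬~⇒≁ λ zj → j≢i (unique-contact out zj (~-sym iz)))

  flaps-at : ∀ i → Colourable G (1 + m) ⊎ FlapsAt i
  flaps-at i = Sum.map id build (all-or edge)
    where
    c = proj₁ (crit (κ i))
    off = proj₂ (crit (κ i))
    L : List (Fin (1 + m))
    L = map (c ∘ κ ∘ punchIn i) (allFin m)
    -- Besides `κ i`, the clique has `m` vertices, one fewer than there are colours.
    fresh : ∃[ γ ] γ ∉ L
    fresh = free-colour L (subst (_< 1 + m) (sym (trans (length-map _ (allFin m)) (length-tabulate {n = m} id))) ℕ.≤-refl)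
    γ = proj₁ fresh
    used : ∀ d → γ ≢ c (κ (punchIn i d))
    used d e = proj₂ fresh (subst (_∈ L) (sym e) (∈-map⁺ (c ∘ κ ∘ punchIn i) (∈-allFin d)))
    off-i : ∀ {j} → j ≢ i → κ j ≢ κ i
    off-i j≢i e = j≢i (κ-injective e)
    α-injective : ∀ {j l} → j ≢ i → l ≢ i → c (κ j) ≡ c (κ l) → j ≡ l
    α-injective {j} {l} j≢i l≢i e = decidable-stable (j ≟ l) λ j≢l → off (off-i j≢i) (off-i l≢i) (κ-~ j≢l) e
    Edge : Fin m → Set
    Edge d = ∃₂ λ x y → κ i ~ x × κ i ~ y × x ~ y × c x ≡ γ × c y ≡ c (κ (punchIn i d))
    edge : ∀ d → Colourable G (1 + m) ⊎ Edge d
    edge d = kempe {G = G} av off (used d)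
    build : (∀ d → Edge d) → FlapsAt i
    build edges = record
      { x = x ; y = y ; x-out = x-out ; y-out = y-out ; ix = ix ; iy = iy ; xy = xy
      ; x≁x = λ d e → ¬~⇒≁ λ xx → off (≢-sym (~⇒≢ (ix d))) (≢-sym (~⇒≢ (ix e))) xx (trans (cx d) (sym (cx e)))
      ; x≢y = λ d e p → used e (trans (sym (cx d)) (trans (cong c p) (cy e)))
      ; y≢y = λ {d} {e} d≢e p → d≢e (𝔽.punchIn-injective i d e
          (α-injective (𝔽.punchInᵢ≢i i d) (𝔽.punchInᵢ≢i i e) (trans (sym (cy d)) (trans (cong c p) (cy e))))) }
      where
      x y : Fin m → Fin n
      x d = proj₁ (edges d)
      y d = proj₁ (proj₂ (edges d))
      ix : ∀ d → κ i ~ x d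
      ix d = proj₁ (proj₂ (proj₂ (edges d)))
      iy : ∀ d → κ i ~ y d
      iy d = proj₁ (proj₂ (proj₂ (proj₂ (edges d))))
      xy : ∀ d → x d ~ y d
      xy d = proj₁ (proj₂ (proj₂ (proj₂ (proj₂ (edges d)))))
      cx : ∀ d → c (x d) ≡ γ
      cx d = proj₁ (proj₂ (proj₂ (proj₂ (proj₂ (proj₂ (edges d))))))
      cy : ∀ d → c (y d) ≡ c (κ (punchIn i d))
      cy d = proj₂ (proj₂ (proj₂ (proj₂ (proj₂ (proj₂ (edges d))))))
      x-out : ∀ d → Outside (x d)
      x-out d j e with i ≟ j
      ... | yes refl = ~⇒≢ (ix d) (sym e)
      ... | no i≢j = used (punchOut i≢j) (trans (sym (cx d)) (trans (cong c e) (cong (c ∘ κ) (sym (𝔽.punchIn-punchOut i≢j)))))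
      y-out : ∀ d → Outside (y d)
      y-out d j e with i ≟ j
      ... | yes refl = ~⇒≢ (iy d) (sym e)
      -- Otherwise `x d`, which is outside K, would have the two contacts `κ i` and `κ j`.
      ... | no i≢j = i≢j (unique-contact (x-out d) (~-sym (ix d)) (subst (x d ~_) e (xy d)))

module _ {n} {G : Graph n} where

  open Adjacency G

  -- The triangles vab and vcd meet the triangle vxz in v only.
  Flaps : (v x z a b c d : Fin n) → Set
  Flaps v x z a b c d =
    All (v ~_) (a ∷ b ∷ c ∷ d ∷ []) × All (x ≁_) (a ∷ b ∷ c ∷ d ∷ []) × All (z ≁_) (a ∷ b ∷ c ∷ d ∷ []) ×
    a ~ b × c ~ d × All (a ≁_) (c ∷ d ∷ []) × All (b ≁_) (c ∷ d ∷ [])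

  -- The case ω = 3: each vertex of the triangle carries two flaps, one for each of the other two
  -- vertices of K.
  no-six-flaps : DiamondFree → Avoids (P₂+P₄ ∷ cycle 5 ∷ cycle 7 ∷ complete 4 ∷ []) →
    ∀ {u v w a b c d p q r s e f g h} → AllPairs _~_ (u ∷ v ∷ w ∷ []) →
    Flaps u v w a b c d → Flaps v u w p q r s → Flaps w u v e f g h → ⊥
  no-six-flaps df av {u} {v} {w} {a} {b} {c} {d} {p} {q} {r} {s} {e} {f} {g} {h} K
    (u₁ , u₂ , u₃ , ab , cd , ac , bd) (v₁ , v₂ , v₃ , pq , rs , pr , qs) (w₁ , w₂ , w₃ , ef , gh , eg , fh) =
    refute (clique (0 ⋯ 2)
           ∷ star 0 A ∷ anti 1 A ∷ anti 2 A ∷ star 3 [ 4 ] ∷ star 5 [ 6 ] ∷ anti 3 (5 ∷ 6 ∷ []) ∷ anti 4 (5 ∷ 6 ∷ [])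
           ∷ star 1 B ∷ anti 0 B ∷ anti 2 B ∷ star 7 [ 8 ] ∷ star 9 [ 10 ] ∷ anti 7 (9 ∷ 10 ∷ []) ∷ anti 8 (9 ∷ 10 ∷ [])
           ∷ star 2 C′ ∷ anti 0 C′ ∷ anti 1 C′ ∷ star 11 [ 12 ] ∷ star 13 [ 14 ] ∷ anti 11 (13 ∷ 14 ∷ []) ∷ anti 12 (13 ∷ 14 ∷ [])
           ∷ [])
      (on 8 12 (on 7 12 (dia 7 8 12 1 11) (on 8 11 (dia 11 12 8 2 7) (on 7 13 (on 7 11 (on 7 14 (dia 14
      13 7 2 8) (on 8 14 (at5 1 8 14 2 11 7) (on 8 13 (dia 8 7 13 1 14) (at6 0 13 14 12 8 1 0)))) (at6 0 11 12 13 7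
      1 0)) (on 5 8 (on 5 7 (dia 7 8 5 1 6) (on 5 11 (at5 1 5 11 2 1 8) (on 5 12 (on 6 8 (dia 6 5 8 0 7)
      (on 8 13 (on 5 13 (dia 5 8 13 12 14) (at5 1 5 0 2 13 8)) (on 5 13 (at5 1 5 13 2 1 8) (on 5 14 (on 6
      14 (dia 6 5 14 0 13) (on 6 11 (at5 1 6 11 2 14 5) (on 3 11 (at6 0 5 6 3 11 2 1) (on 3 8 (at6 0 2 11 3 8 5
      6) (on 3 7 (at5 1 3 7 8 5 0) (on 3 13 (at6 0 5 8 3 13 2 11) (at6 0 7 8 3 0 2 13))))))) (at6 0 14 13 12 5 0
      1))))) (at5 1 5 0 2 12 8)))) (on 5 12 (at5 1 5 12 8 1 0) (on 7 14 (on 7 11 (on 8 13 (at5 1 8 13 2 11 7)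
      (on 8 14 (dia 8 7 14 1 13) (at6 0 14 13 12 8 1 0))) (at6 0 11 12 14 7 1 0)) (on 7 11 (at6 0 13 14 11 7 1 0)
      (on 9 11 (at6 0 7 8 9 11 2 0) (on 10 11 (at6 0 7 8 10 11 2 0) (on 5 7 (on 5 11 (at5 1 5 11 2 1 7) (on
      5 9 (at6 0 2 11 9 5 7 8) (on 5 10 (at6 0 2 11 10 5 7 8) (at6 0 10 9 5 0 2 11)))) (on 5 11 (on 5 13 (at6 0 1
      7 13 5 11 12) (on 5 14 (at6 0 1 7 14 5 11 12) (at6 0 14 13 5 0 1 7))) (at6 0 7 8 5 0 2 11)))))))))))) (on 7 12
      (on 7 11 (dia 11 12 7 2 8) (on 9 11 (on 8 11 (on 10 11 (dia 10 9 11 1 12) (on 10 12 (at5 1 10 12 11 8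
      1) (on 9 12 (dia 12 11 9 2 10) (at6 0 9 10 7 12 2 0)))) (at6 0 8 7 9 11 2 0)) (on 10 11 (on 8 11 (on 9
      12 (at5 1 9 12 11 8 1) (on 10 12 (dia 12 11 10 2 9) (at6 0 10 9 7 12 2 0))) (at6 0 8 7 10 11 2 0)) (on 8 11
      (at6 0 9 10 8 11 2 0) (on 8 13 (at6 0 11 12 13 8 1 0) (on 8 14 (at6 0 11 12 14 8 1 0) (on 3 7 (on 3 8
      (dia 8 7 3 1 4) (on 3 11 (at5 1 3 11 2 1 7) (on 3 9 (at6 0 2 11 9 3 7 8) (on 3 10 (at6 0 2 11 10 3 7 8)
      (at6 0 10 9 3 0 2 11))))) (on 3 12 (at5 1 3 12 7 1 0) (on 3 11 (on 3 8 (at5 1 3 8 1 2 11) (on 3 13 (at6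
      0 1 8 13 3 11 12) (on 3 14 (at6 0 1 8 14 3 11 12) (at6 0 14 13 3 0 1 8)))) (on 3 8 (on 3 9 (at6 0 2 11 9 3
      8 7) (on 3 10 (at6 0 2 11 10 3 8 7) (at6 0 10 9 3 0 2 11))) (at6 0 11 12 3 0 1 8))))))))))) (on 9 12 (at6 0 7
      8 9 12 2 0) (on 10 12 (at6 0 7 8 10 12 2 0) (on 5 12 (on 5 7 (at5 1 5 7 1 2 12) (on 5 8 (at5 1 5 8 1 2
      12) (on 5 9 (at6 0 7 8 9 5 0 2) (on 4 12 (on 3 12 (dia 3 4 12 0 11) (on 4 7 (at5 1 4 7 1 2 12) (on 3
      7 (on 3 8 (dia 8 7 3 1 4) (on 3 9 (at6 0 5 12 3 9 1 8) (at6 0 5 12 3 7 1 9))) (at6 0 7 1 3 4 12 5)))) (on 3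
      12 (on 3 7 (at5 1 3 7 1 2 12) (on 3 8 (at5 1 3 8 1 2 12) (on 4 7 (on 4 8 (dia 8 7 4 1 3) (at6 0 8 1 4 3
      12 5)) (at6 0 7 1 4 3 12 5)))) (at6 0 3 4 5 12 2 1)))))) (on 5 7 (on 5 8 (dia 8 7 5 1 6) (on 5 9 (at6 0 2
      12 9 5 7 8) (on 5 10 (at6 0 2 12 10 5 7 8) (at6 0 10 9 5 0 2 12)))) (on 5 8 (on 5 9 (at6 0 2 12 9 5 8 7)
      (on 5 10 (at6 0 2 12 10 5 8 7) (at6 0 10 9 5 0 2 12))) (at6 0 8 7 5 0 2 12))))))))
      (K ∷ u₁ ∷ u₂ ∷ u₃ ∷ (ab ∷ []) ∷ (cd ∷ []) ∷ ac ∷ bd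
         ∷ v₁ ∷ v₂ ∷ v₃ ∷ (pq ∷ []) ∷ (rs ∷ []) ∷ pr ∷ qs
         ∷ w₁ ∷ w₂ ∷ w₃ ∷ (ef ∷ []) ∷ (gh ∷ []) ∷ eg ∷ fh ∷ [])
    where
    open Refutation G df av (at (u ∷ v ∷ w ∷ a ∷ b ∷ c ∷ d ∷ p ∷ q ∷ r ∷ s ∷ e ∷ f ∷ g ∷ h ∷ []) u)
    A B C′ : List ℕ
    A = 3 ∷ 4 ∷ 5 ∷ 6 ∷ []
    B = 7 ∷ 8 ∷ 9 ∷ 10 ∷ []
    C′ = 11 ∷ 12 ∷ 13 ∷ 14 ∷ []

module _ {n} {G : Graph n} (df : Adjacency.DiamondFree G) where

  open Adjacency G

  three-flaps : (av : Avoids (P₂+P₄ ∷ cycle 5 ∷ cycle 7 ∷ complete 4 ∷ [])) →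
                HasClique G 3 → Critical G 3 → Colourable G 3
  three-flaps av@(w ∷ c₅ ∷ c₇ ∷ k₄ ∷ []) K crit with flaps-at 0F | flaps-at 1F | flaps-at 2F
    where open Flaps {G = G} df (w ∷ c₅ ∷ c₇ ∷ []) (avoids⇒no-clique G k₄) K crit
  ... | inj₁ p | _      | _      = p
  ... | inj₂ _ | inj₁ p | _      = p
  ... | inj₂ _ | inj₂ _ | inj₁ p = p
  ... | inj₂ f | inj₂ g | inj₂ h = ⊥-elim (no-six-flaps {G = G} df av
      (AllPairs.tabulate⁺ κ-~) (flaps {1F} {2F} f (λ ()) (λ ())) (flaps {0F} {2F} g (λ ()) (λ ())) (flaps {0F} {1F} h (λ ()) (λ ())))
    where
    open Flaps {G = G} df (w ∷ c₅ ∷ c₇ ∷ []) (avoids⇒no-clique G k₄) K crit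
    open MaximumClique {G = G} df (avoids⇒no-clique G k₄) K
    flaps : ∀ {j l i} (f : FlapsAt i) → j ≢ i → l ≢ i → let open FlapsAt f in
            Flaps {G = G} (κ i) (κ j) (κ l) (x 0F) (y 0F) (x 1F) (y 1F)
    flaps f j≢i l≢i =
        (ix 0F ∷ iy 0F ∷ ix 1F ∷ iy 1F ∷ [])
      , (misses (x-out 0F) (ix 0F) j≢i ∷ misses (y-out 0F) (iy 0F) j≢i ∷ misses (x-out 1F) (ix 1F) j≢i ∷ misses (y-out 1F) (iy 1F) j≢i ∷ [])
      , (misses (x-out 0F) (ix 0F) l≢i ∷ misses (y-out 0F) (iy 0F) l≢i ∷ misses (x-out 1F) (ix 1F) l≢i ∷ misses (y-out 1F) (iy 1F) l≢i ∷ [])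
      , xy 0F , xy 1F , (x≁x 0F 1F ∷ x₀≁y₁ ∷ []) , (y₀≁x₁ ∷ y₀≁y₁ ∷ [])
      where
      open FlapsAt f
      no-K₄ : ∀ {a b} → κ _ ~ a → κ _ ~ b → a ~ b → ∀ {d} → κ _ ~ d → a ~ d → ¬ b ~ d
      no-K₄ ia ib ab id ad bd = k₄ (_ ∷ _ ∷ _ ∷ _ ∷ []) ((ia ∷ ib ∷ id ∷ []) , (ab ∷ ad ∷ []) , (bd ∷ []) , [] , tt)
      distinct-ends : ∀ {a b d} → κ _ ~ a → κ _ ~ b → κ _ ~ d → a ~ b → b ≢ d → a ≁ d
      distinct-ends ia ib id ab b≢d = ¬~⇒≁ λ ad →
        b≢d (df ia ib id ab ad (¬~⇒≁ (no-K₄ ia ib ab id ad)))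
      x₀≁y₁ = distinct-ends (ix 0F) (iy 0F) (iy 1F) (xy 0F) (y≢y λ ())
      y₀≁x₁ : y 0F ≁ x 1F
      -- `x 0F` and `x 1F` have the same colour and might coincide; the diamond forces just that,
      -- against `x₀≁y₁`.
      y₀≁x₁ = ¬~⇒≁ λ yx → ~⇒¬≁ (xy 1F)
        (subst (_≁ y 1F) (df (iy 0F) (ix 0F) (ix 1F) (~-sym (xy 0F)) yx (x≁x 0F 1F)) x₀≁y₁)
      y₀≁y₁ = distinct-ends (iy 0F) (ix 0F) (iy 1F) (~-sym (xy 0F)) (x≢y 0F 1F)

  private
    Touching : (a b u v : Fin n) → Set
    Touching a b u v = a ~ u ⊎ a ~ v ⊎ b ~ u ⊎ b ~ v

    touching? : ∀ a b u v → Dec (Touching a b u v)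
    touching? a b u v = (a ~? u) ⊎-dec (a ~? v) ⊎-dec (b ~? u) ⊎-dec (b ~? v)

  -- Fix a flap at `κ 1F`. If a flap at `κ 0F` does not touch it, an outside neighbour of `κ 2F`
  -- completes a P₂+P₄ or a C₅, whichever vertices of the two flaps it meets. If two flaps at `κ 0F`
  -- touch it, a diamond or P₂+P₄ arises, the latter mostly with `κ 2F` and `κ 3F` as its P₂.
  four-flaps : (av : Avoids (P₂+P₄ ∷ cycle 5 ∷ cycle 7 ∷ complete 5 ∷ [])) →
               HasClique G 4 → Critical G 4 → Colourable G 4
  four-flaps av@(w ∷ c₅ ∷ c₇ ∷ k₅ ∷ []) K crit with flaps-at 0F | flaps-at 1F | flaps-at 2F
    where open Flaps {G = G} df (w ∷ c₅ ∷ c₇ ∷ []) (avoids⇒no-clique G k₅) K crit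
  ... | inj₁ p | _      | _      = p
  ... | inj₂ _ | inj₁ p | _      = p
  ... | inj₂ _ | inj₂ _ | inj₁ p = p
  ... | inj₂ f | inj₂ g | inj₂ h = ⊥-elim (decide (touches 0F) (touches 1F))
    where
    open Flaps {G = G} df (w ∷ c₅ ∷ c₇ ∷ []) (avoids⇒no-clique G k₅) K crit
    open MaximumClique {G = G} df (avoids⇒no-clique G k₅) K
    module F = FlapsAt f
    module H = FlapsAt g
    module I = FlapsAt h
    touches : ∀ d → Dec (Touching (F.x d) (F.y d) (H.x 0F) (H.y 0F))
    touches d = touching? _ _ _ _
    K-clique : AllPairs _~_ (κ 0F ∷ κ 1F ∷ κ 2F ∷ κ 3F ∷ [])
    K-clique = AllPairs.tabulate⁺ κ-~
    missF : ∀ j → j ≢ 0F → ∀ d → All (κ j ≁_) (F.x d ∷ F.y d ∷ [])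
    missF j j≢ d = F.misses (F.x-out d) (F.ix d) j≢ ∷ F.misses (F.y-out d) (F.iy d) j≢ ∷ []
    missH : ∀ j → j ≢ 1F → ∀ d → All (κ j ≁_) (H.x d ∷ H.y d ∷ [])
    missH j j≢ d = H.misses (H.x-out d) (H.ix d) j≢ ∷ H.misses (H.y-out d) (H.iy d) j≢ ∷ []
    missI : ∀ j → j ≢ 2F → ∀ d → All (κ j ≁_) (I.x d ∷ I.y d ∷ [])
    missI j j≢ d = I.misses (I.x-out d) (I.ix d) j≢ ∷ I.misses (I.y-out d) (I.iy d) j≢ ∷ []
    both : Touching (F.x 0F) (F.y 0F) (H.x 0F) (H.y 0F) → Touching (F.x 1F) (F.y 1F) (H.x 0F) (H.y 0F) → ⊥
    both p q = refute
      (clique (0 ⋯ 3) ∷ star 0 (4 ⋯ 7) ∷ star 1 (8 ∷ 9 ∷ [])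
        ∷ star 4 [ 5 ] ∷ star 6 [ 7 ] ∷ star 8 [ 9 ]
        ∷ anti 1 (4 ⋯ 7) ∷ anti 2 (4 ⋯ 9) ∷ anti 3 (4 ⋯ 9) ∷ anti 0 (8 ∷ 9 ∷ [])
        ∷ anti 4 [ 6 ] ∷ apart [ 5 ] [ 7 ] ∷ apart [ 4 ] [ 7 ] ∷ apart [ 6 ] [ 5 ]
        ∷ some (touch 4 5) ∷ some (touch 6 7) ∷ [])
      (on 4 7 (on 5 7 (on 4 9 (on 4 8 (dia 8 9 4 1 5) (on 5 9 (dia 5 4 9 0 8) (on 5 8 (on 7 8 (dia 7 5
      8 0 9) (on 7 9 (dia 7 4 9 0 8) (at6 0 2 3 7 4 9 8))) (at6 0 2 3 5 4 9 8)))) (on 4 8 (on 5 8 (dia 5 4 8 0 9)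
      (on 5 9 (on 7 9 (dia 7 5 9 0 8) (on 7 8 (dia 7 4 8 0 9) (at6 0 2 3 7 4 8 9))) (at6 0 2 3 5 4 8 9))) (on
      5 8 (on 5 9 (dia 9 8 5 1 4) (at6 0 2 3 9 8 5 4)) (on 5 9 (at6 0 2 3 4 5 9 8) (clause 0))))) (dia≠ 0 4 5 7))
      (on 5 7 (dia≠ 5 0 7 4) (on 5 6 (dia 5 0 6 4 7) (on 4 9 (on 5 9 (dia 5 4 9 0 8) (on 6 9 (at6 0 2 3 6 9
      4 5) (on 7 9 (at6 0 2 3 7 9 4 5) (at6 0 7 6 4 9 1 2)))) (on 7 9 (on 5 9 (at6 0 2 3 4 5 9 7) (at6 0 5 4 7 9
      1 2)) (on 6 9 (on 5 9 (at6 0 2 3 5 9 6 7) (at6 0 5 4 6 9 1 2)) (on 5 9 (at6 0 6 7 5 9 1 2) (on 5 8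
      (on 4 8 (dia 4 5 8 0 9) (at6 0 2 3 4 5 8 9)) (on 4 8 (at6 0 2 3 5 4 8 9) (clause 0))))))))))
      (K-clique ∷ (F.ix 0F ∷ F.iy 0F ∷ F.ix 1F ∷ F.iy 1F ∷ []) ∷ (H.ix 0F ∷ H.iy 0F ∷ [])
        ∷ (F.xy 0F ∷ []) ∷ (F.xy 1F ∷ []) ∷ (H.xy 0F ∷ [])
        ∷ All.++⁺ (missF 1F (λ ()) 0F) (missF 1F (λ ()) 1F)
        ∷ All.++⁺ (missF 2F (λ ()) 0F) (All.++⁺ (missF 2F (λ ()) 1F) (missH 2F (λ ()) 0F))
        ∷ All.++⁺ (missF 3F (λ ()) 0F) (All.++⁺ (missF 3F (λ ()) 1F) (missH 3F (λ ()) 0F))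
        ∷ missH 0F (λ ()) 0F
        ∷ (F.x≁x 0F 1F ∷ []) ∷ ((F.y≢y {0F} {1F} (λ ()) ∷ []) ∷ []) ∷ ((F.x≢y 0F 1F ∷ []) ∷ []) ∷ ((F.x≢y 1F 0F ∷ []) ∷ [])
        ∷ holds 4 5 p ∷ holds 6 7 q ∷ [])
      where
      env : ℕ → Fin n
      env = at (κ 0F ∷ κ 1F ∷ κ 2F ∷ κ 3F ∷ F.x 0F ∷ F.y 0F ∷ F.x 1F ∷ F.y 1F ∷ H.x 0F ∷ H.y 0F ∷ []) (κ 0F)
      open Refutation G df av env
      touch : ℕ → ℕ → List Lit
      touch a b = (a , 8 , true) ∷ (a , 9 , true) ∷ (b , 8 , true) ∷ (b , 9 , true) ∷ []
      holds : ∀ a b → Touching (env a) (env b) (H.x 0F) (H.y 0F) → ⟦ some (touch a b) ⟧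
      holds a b (inj₁ p)               = here p
      holds a b (inj₂ (inj₁ p))        = there (here p)
      holds a b (inj₂ (inj₂ (inj₁ p))) = there (there (here p))
      holds a b (inj₂ (inj₂ (inj₂ p))) = there (there (there (here p)))
    apart-from : ∀ {d} → ¬ Touching (F.x d) (F.y d) (H.x 0F) (H.y 0F) → ⊥
    apart-from {d} none = refute
      (clique (0 ⋯ 3) ∷ star 0 (4 ∷ 5 ∷ []) ∷ star 1 (6 ∷ 7 ∷ []) ∷ star 2 I-ends
        ∷ star 4 [ 5 ] ∷ star 6 [ 7 ] ∷ star 8 [ 9 ] ∷ star 10 [ 11 ] ∷ star 12 [ 13 ]
        ∷ anti 1 (4 ∷ 5 ∷ []) ∷ anti 2 (4 ∷ 5 ∷ []) ∷ anti 3 (4 ∷ 5 ∷ [])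
        ∷ anti 0 (6 ∷ 7 ∷ []) ∷ anti 2 (6 ∷ 7 ∷ []) ∷ anti 3 (6 ∷ 7 ∷ [])
        ∷ anti 0 I-ends ∷ anti 1 I-ends ∷ anti 3 I-ends
        ∷ anti 4 (6 ∷ 7 ∷ []) ∷ anti 5 (6 ∷ 7 ∷ [])
        ∷ anti 8 (10 ∷ 12 ∷ []) ∷ anti 10 [ 12 ] ∷ apart [ 9 ] (11 ∷ 13 ∷ []) ∷ apart [ 11 ] [ 13 ]
        ∷ apart (8 ∷ 10 ∷ 12 ∷ []) (9 ∷ 11 ∷ 13 ∷ []) ∷ [])
      (on 6 10 (on 4 10 (at5 1 4 10 6 1 0) (on 5 10 (at5 1 5 10 6 1 0) (at6 0 5 4 6 10 2 3))) (on 7 10 (on 4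
      10 (at5 1 4 10 7 1 0) (on 5 10 (at5 1 5 10 7 1 0) (at6 0 5 4 10 2 1 6))) (on 4 10 (at6 0 6 7 4 10 2 3) (at6 0
      6 7 4 0 2 10))))
      (K-clique ∷ (F.ix d ∷ F.iy d ∷ []) ∷ (H.ix 0F ∷ H.iy 0F ∷ []) ∷ (I.ix 0F ∷ I.iy 0F ∷ I.ix 1F ∷ I.iy 1F ∷ I.ix 2F ∷ I.iy 2F ∷ [])
        ∷ (F.xy d ∷ []) ∷ (H.xy 0F ∷ []) ∷ (I.xy 0F ∷ []) ∷ (I.xy 1F ∷ []) ∷ (I.xy 2F ∷ [])
        ∷ missF 1F (λ ()) d ∷ missF 2F (λ ()) d ∷ missF 3F (λ ()) d
        ∷ missH 0F (λ ()) 0F ∷ missH 2F (λ ()) 0F ∷ missH 3F (λ ()) 0F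
        ∷ missI-all 0F (λ ()) ∷ missI-all 1F (λ ()) ∷ missI-all 3F (λ ())
        ∷ (¬~⇒≁ (none ∘ inj₁) ∷ ¬~⇒≁ (none ∘ inj₂ ∘ inj₁) ∷ [])
        ∷ (¬~⇒≁ (none ∘ inj₂ ∘ inj₂ ∘ inj₁) ∷ ¬~⇒≁ (none ∘ inj₂ ∘ inj₂ ∘ inj₂) ∷ [])
        ∷ (I.x≁x 0F 1F ∷ I.x≁x 0F 2F ∷ []) ∷ (I.x≁x 1F 2F ∷ [])
        ∷ ((I.y≢y {0F} {1F} (λ ()) ∷ I.y≢y {0F} {2F} (λ ()) ∷ []) ∷ []) ∷ ((I.y≢y {1F} {2F} (λ ()) ∷ []) ∷ [])
        ∷ (All.tabulate⁺ (I.x≢y 0F) ∷ All.tabulate⁺ (I.x≢y 1F) ∷ All.tabulate⁺ (I.x≢y 2F) ∷ []) ∷ [])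
      where
      open Refutation G df av (at (κ 0F ∷ κ 1F ∷ κ 2F ∷ κ 3F ∷ F.x d ∷ F.y d ∷ H.x 0F ∷ H.y 0F
        ∷ I.x 0F ∷ I.y 0F ∷ I.x 1F ∷ I.y 1F ∷ I.x 2F ∷ I.y 2F ∷ []) (κ 0F))
      I-ends : List ℕ
      I-ends = 8 ∷ 9 ∷ 10 ∷ 11 ∷ 12 ∷ 13 ∷ []
      missI-all : ∀ j → j ≢ 2F → All (κ j ≁_) (I.x 0F ∷ I.y 0F ∷ I.x 1F ∷ I.y 1F ∷ I.x 2F ∷ I.y 2F ∷ [])
      missI-all j j≢ = All.++⁺ (missI j j≢ 0F) (All.++⁺ (missI j j≢ 1F) (missI j j≢ 2F))

    decide : Dec (Touching (F.x 0F) (F.y 0F) (H.x 0F) (H.y 0F)) → Dec (Touching (F.x 1F) (F.y 1F) (H.x 0F) (H.y 0F)) → ⊥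
    decide (no p)  _       = apart-from p
    decide (yes _) (no q)  = apart-from q
    decide (yes p) (yes q) = both p q

  -- A path outside K makes the outside neighbours of `κ 0F` independent, whereas a flap is an edge
  -- among them. Without such a path the cograph argument applies.
  five-flaps : (av : Avoids (P₂+P₄ ∷ cycle 5 ∷ cycle 7 ∷ complete 6 ∷ [])) →
               HasClique G 5 → Critical G 5 → Colourable G 5
  five-flaps (w ∷ c₅ ∷ c₇ ∷ k₆ ∷ []) K crit with path-outside?
    where open MaximumClique {G = G} df (avoids⇒no-clique G k₆) K
  ... | no none = MaximumClique.no-path⇒colourable {G = G} df (avoids⇒no-clique G k₆) K (w ∷ []) ℕ.≤-refl crit (ℕ.n≤1+n 4) none
  ... | yes (x , out , p) with flaps-at 0F
    where open Flaps {G = G} df (w ∷ c₅ ∷ c₇ ∷ []) (avoids⇒no-clique G k₆) K crit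
  ...   | inj₁ q = q
  ...   | inj₂ f = ⊥-elim (contacts-independent (w ∷ []) ℕ.≤-refl out p 0F (y-out 0F) (x-out 0F) (~-sym (iy 0F)) (~-sym (ix 0F)) (~-sym (xy 0F)))
    where
    open Flaps.FlapsAt f
    open MaximumClique {G = G} df (avoids⇒no-clique G k₆) K

-- Colourings of graphs without odd holes

-- C₅ and C₇ stand for all odd holes, as longer ones contain P₂+P₄; odd antiholes on at least seven
-- vertices contain a diamond. The last entry bounds the clique number by `k`.
Berge : ℕ → List Shape
Berge k = P₂+P₄ ∷ cycle 5 ∷ cycle 7 ∷ complete (1 + k) ∷ []

colourable-by : ∀ k → (∀ {n} (G : Graph n) → Adjacency.DiamondFree G → Adjacency.Avoids G (Berge k) → Colourable G k) →
  (∀ {n} {G : Graph n} → Adjacency.DiamondFree G → Adjacency.Avoids G (Berge (1 + k)) → HasClique G (1 + k) →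
    Critical G (1 + k) → Colourable G (1 + k)) →
  ∀ {n} (G : Graph n) → Adjacency.DiamondFree G → Adjacency.Avoids G (Berge (1 + k)) → Colourable G (1 + k)
colourable-by k smaller largest = critical-induction (Berge (1 + k)) k step
  where
  step : ∀ {n} (G : Graph n) → Adjacency.DiamondFree G → Adjacency.Avoids G (Berge (1 + k)) → Critical G (1 + k) → Colourable G (1 + k)
  step G df av@(w ∷ c₅ ∷ c₇ ∷ _) crit with hasClique? G (1 + k)
  ... | yes K = largest df av K crit
  ... | no ¬K = Colourable-≤ {G = G} (ℕ.n≤1+n k) (smaller G df (w ∷ c₅ ∷ c₇ ∷ no-clique⇒avoids G ¬K ∷ []))

berge-colourable : ∀ k {n} (G : Graph n) → Adjacency.DiamondFree G → Adjacency.Avoids G (Berge k) → Colourable G k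
berge-colourable 0 {zero} G df av = (λ ()) , λ ()
berge-colourable 0 {suc n} G df (_ ∷ _ ∷ _ ∷ k₁ ∷ []) = contradiction ([] , tt) (k₁ (zero ∷ []))
berge-colourable 1 G df (_ ∷ _ ∷ _ ∷ k₂ ∷ []) = (λ _ → 0F) , λ x y xy → contradiction ((xy ∷ []) , [] , tt) (k₂ (x ∷ y ∷ []))
berge-colourable 2 = colourable-by 1 (berge-colourable 1) two-flaps
  where
  two-flaps : ∀ {n} {G : Graph n} → Adjacency.DiamondFree G → Adjacency.Avoids G (Berge 2) → HasClique G 2 →
              Critical G 2 → Colourable G 2
  two-flaps {G = G} df (w ∷ c₅ ∷ c₇ ∷ k₃ ∷ []) K crit =
    [ id , (λ f → let open Flaps.FlapsAt f in contradiction ((ix 0F ∷ iy 0F ∷ []) , (xy 0F ∷ []) , [] , tt) (k₃ (_ ∷ _ ∷ _ ∷ []))) ]′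
      (Flaps.flaps-at {G = G} df (w ∷ c₅ ∷ c₇ ∷ []) (avoids⇒no-clique G k₃) K crit 0F)
berge-colourable 3 = colourable-by 2 (berge-colourable 2) λ {_} {G} → three-flaps {G = G}
berge-colourable 4 = colourable-by 3 (berge-colourable 3) λ {_} {G} → four-flaps {G = G}
berge-colourable 5 = colourable-by 4 (berge-colourable 4) λ {_} {G} → five-flaps {G = G}
berge-colourable (suc (suc (suc (suc (suc (suc j)))))) G df (w ∷ _ ∷ _ ∷ k ∷ []) = clique-colourable j G df (w ∷ k ∷ [])

-- Graphs with an induced 7-cycle and no induced 5-cycle

module FirstFit {n} {G : Graph n} where

  open Adjacency G

  Misses Meets : (p q x : Fin n) → Set
  Misses p q x = x ≁ p × x ≁ q
  Meets p q x = x ~ p ⊎ x ~ q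

  misses-or-meets : ∀ p q x → Misses p q x ⊎ Meets p q x
  misses-or-meets p q x with x ~? p | x ~? q
  ... | yes xp | _      = inj₂ (inj₁ xp)
  ... | no _   | yes xq = inj₂ (inj₂ xq)
  ... | no x≁p | no x≁q = inj₁ (¬~⇒≁ x≁p , ¬~⇒≁ x≁q)

  module _ {p q r t : Fin n}
    (class₀ : ∀ {x y} → x ~ y → Misses p q x → ¬ Misses p q y)
    (class₁ : ∀ {x y} → x ~ y → Meets p q x → Meets p q y → Misses r t x → ¬ Misses r t y)
    (class₂ : ∀ {x y} → x ~ y → Meets p q x → Meets p q y → Meets r t x → ¬ Meets r t y) where

    three-colourable : Colourable G 3
    three-colourable = c , proper
      where
      c : Fin n → Fin 3
      c x with misses-or-meets p q x | misses-or-meets r t x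
      ... | inj₁ _ | _      = 0F
      ... | inj₂ _ | inj₁ _ = 1F
      ... | inj₂ _ | inj₂ _ = 2F
      proper : ∀ x y → x ~ y → c x ≢ c y
      proper x y xy with misses-or-meets p q x | misses-or-meets r t x | misses-or-meets p q y | misses-or-meets r t y
      ... | inj₁ a | _      | inj₁ b | _      = λ _ → class₀ xy a b
      ... | inj₁ _ | _      | inj₂ _ | inj₁ _ = λ ()
      ... | inj₁ _ | _      | inj₂ _ | inj₂ _ = λ ()
      ... | inj₂ _ | inj₁ _ | inj₁ _ | _      = λ ()
      ... | inj₂ _ | inj₂ _ | inj₁ _ | _      = λ ()
      ... | inj₂ a | inj₁ u | inj₂ b | inj₁ v = λ _ → class₁ xy a b u v
      ... | inj₂ _ | inj₁ _ | inj₂ _ | inj₂ _ = λ ()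
      ... | inj₂ _ | inj₂ _ | inj₂ _ | inj₁ _ = λ ()
      ... | inj₂ a | inj₂ u | inj₂ b | inj₂ v = λ _ → class₂ xy a b u v

names : ℕ → List ℕ
names = List.applyUpTo (2 +_)

applyUpTo-at : ∀ {a} {A : Set a} (xs : List A) d → List.applyUpTo (at xs d) (length xs) ≡ xs
applyUpTo-at []       d = refl
applyUpTo-at (x ∷ xs) d = cong (x ∷_) (applyUpTo-at xs d)

-- The vertices of an induced subgraph s are named 2, 3, …, and the ends of a
-- further edge 0 and 1. Colour 0 is given to the vertices missing p and q, and
-- colour 1 to the remaining ones missing r and t.
module ByClasses {n} {G : Graph n} (df : Adjacency.DiamondFree G) {ps : List Shape} (av : Adjacency.Avoids G ps)
                 (s : Shape) (p q r t : ℕ) {v : Fin n} {vs : List (Fin n)} (ind : Adjacency.Induces G s (v ∷ vs)) where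

  open Adjacency G
  open FirstFit {G = G}
  module R (x y : Fin n) = Refutation G df av (at (x ∷ y ∷ v ∷ vs) v)

  misses meets : (x p q : ℕ) → Hyp
  misses x p q = anti x (2 + p ∷ 2 + q ∷ [])
  meets x p q = some ((x , 2 + p , true) ∷ (x , 2 + q , true) ∷ [])

  hyps₀ hyps₁ hyps₂ : List Hyp
  hyps₀ = misses 0 p q ∷ misses 1 p q ∷ shape s (names (length s)) ∷ star 0 [ 1 ] ∷ []
  hyps₁ = meets 0 p q ∷ meets 1 p q ∷ misses 0 r t ∷ misses 1 r t ∷ shape s (names (length s)) ∷ star 0 [ 1 ] ∷ []
  hyps₂ = meets 0 p q ∷ meets 1 p q ∷ meets 0 r t ∷ meets 1 r t ∷ shape s (names (length s)) ∷ star 0 [ 1 ] ∷ []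

  three-colourable-by : (C₀ C₁ C₂ : Cert) →
    (∀ x y → T (R.checks x y hyps₀ C₀)) → (∀ x y → T (R.checks x y hyps₁ C₁)) → (∀ x y → T (R.checks x y hyps₂ C₂)) →
    Colourable G 3
  three-colourable-by C₀ C₁ C₂ ok₀ ok₁ ok₂ = three-colourable {p = vertex p} {vertex q} {vertex r} {vertex t}
    (λ {x} {y} xy (xp , xq) (yp , yq) → R.refute x y hyps₀ C₀ {ok₀ x y}
      ((xp ∷ xq ∷ []) ∷ (yp ∷ yq ∷ []) ∷ named x y ∷ (xy ∷ []) ∷ []))
    (λ {x} {y} xy mx my (xr , xt) (yr , yt) → R.refute x y hyps₁ C₁ {ok₁ x y}
      (one {x} {y} {0} mx ∷ one {x} {y} {1} my ∷ (xr ∷ xt ∷ []) ∷ (yr ∷ yt ∷ []) ∷ named x y ∷ (xy ∷ []) ∷ []))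
    (λ {x} {y} xy mx my mx′ my′ → R.refute x y hyps₂ C₂ {ok₂ x y}
      (one {x} {y} {0} mx ∷ one {x} {y} {1} my ∷ one {x} {y} {0} mx′ ∷ one {x} {y} {1} my′ ∷ named x y ∷ (xy ∷ []) ∷ []))
    where
    vertex : ℕ → Fin n
    vertex = at (v ∷ vs) v
    named : ∀ x y → Induces s (map (at (x ∷ y ∷ v ∷ vs) v) (names (length s)))
    named x y = subst (Induces s) (sym (trans (map-applyUpTo (2 +_) (at (x ∷ y ∷ v ∷ vs) v) (length s))
      (trans (cong (List.applyUpTo vertex) (sym (induces-length G s (v ∷ vs) ind))) (applyUpTo-at (v ∷ vs) v)))) ind
    one : ∀ {x y i p q} → Meets (vertex p) (vertex q) (at (x ∷ y ∷ v ∷ vs) v i) → R.⟦_⟧ x y (meets i p q)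
    one (inj₁ e) = here e
    one (inj₂ e) = there (here e)

attach : Shape → List Bool → Shape
attach s bs = List.zipWith List._∷ʳ_ s bs ++ [] ∷ []

private
  pattern O = false
  pattern I = true

-- A vertex attached to positions 0, 1, 3 or 0, 1, 3, 5 of the cycle, and a second one attached to
-- 2, 4, 5. Most such extensions are treated on their own, so that their absence narrows the
-- possible neighbourhoods on the cycle in the remaining cases.
C₇+3 C₇+4 C₇+3+3 : Shape
C₇+3   = attach (cycle 7) (I ∷ I ∷ O ∷ I ∷ O ∷ O ∷ O ∷ [])
C₇+4   = attach (cycle 7) (I ∷ I ∷ O ∷ I ∷ O ∷ I ∷ O ∷ [])
C₇+3+3 = attach C₇+3 (O ∷ O ∷ I ∷ O ∷ I ∷ I ∷ O ∷ O ∷ [])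

module _ {n} {G : Graph n} (df : Adjacency.DiamondFree G) where

  open Adjacency G

  private
    Vertices : Shape → Set
    Vertices s = ∃[ vs ] Induces s vs

  C₇+4-colourable : Avoids (P₂+P₄ ∷ cycle 5 ∷ []) → Vertices C₇+4 → Colourable G 3
  -- Vertices 0 to 6 are the cycle, and 7 is the attached vertex.
  C₇+4-colourable av (_ ∷ _ , ind) = ByClasses.three-colourable-by {G = G} df av C₇+4 0 4 6 7 ind
    (on 0 3 (on 0 9 (dia 9 3 0 2 1) (on 0 5 (on 0 8 (at5 1 0 8 2 9 5) (on 0 7 (at5 1 0 7 8 2 3) (on 1 7
    (on 1 5 (on 1 3 (dia 1 0 3 5 2) (on 1 9 (dia 1 9 5 7 0) (at5 1 1 0 3 9 7))) (at5 1 1 0 5 6 7)) (on 1 3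
    (on 1 9 (dia 1 3 9 0 2) (at6 0 1 0 2 9 7 6)) (at6 0 6 7 1 0 3 2))))) (on 0 8 (on 0 7 (on 0 4 (at5 1 0 4
    5 6 7) (on 1 8 (on 1 3 (dia 1 0 3 8 4) (on 1 4 (at5 1 1 4 3 2 8) (on 1 5 (at5 1 1 5 4 3 0) (at6 0 1 8 6
    5 4 3)))) (on 1 5 (on 1 7 (dia 7 0 1 8 5) (at5 1 1 0 7 6 5)) (at6 0 5 6 1 0 8 2)))) (at5 1 0 3 9 7 8)) (at6 0
    5 6 0 3 2 8)))) (on 0 5 (on 0 7 (on 0 9 (dia 0 9 5 7 4) (on 0 4 (at5 1 0 4 3 9 7) (on 1 7 (on 1 5
    (dia 1 0 5 7 4) (on 1 3 (on 1 4 (at5 1 1 4 5 6 7) (at5 1 1 0 5 4 3)) (at6 0 3 2 1 0 5 6))) (on 1 3 (on 1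
    9 (dia 9 3 1 2 0) (at5 1 1 0 7 9 3)) (at6 0 3 2 1 0 7 6))))) (at6 0 2 3 0 5 6 7)) (on 0 7 (at6 0 2 3 0 7 6 5)
    (on 0 4 (at6 0 6 7 0 4 3 2) (on 0 8 (at6 0 5 6 0 8 2 3) (on 1 7 (on 1 3 (on 1 5 (on 1 4 (dia 1 4 3
    5 2) (on 1 8 (on 1 9 (dia 1 9 3 5 2) (at5 1 1 5 9 2 8)) (at6 0 8 2 0 1 5 4))) (at6 0 5 6 0 1 3 2)) (at6 0 3 2
    0 1 7 6)) (on 1 3 (at6 0 6 7 0 1 3 2) (on 1 4 (at6 0 6 7 1 4 3 2) (on 1 5 (at6 0 2 3 1 5 6 7) (at6 0 1 0 5
    4 3 2))))))))))
    (on 1 3 (on 1 2 (dia 2 3 1 9 0) (on 1 6 (on 1 5 (on 1 7 (dia 1 6 7 5 8) (at5 1 1 3 9 7 6)) (at5 1 1 3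
    9 5 6)) (clause 1))) (on 0 3 (on 0 2 (dia 2 3 0 9 1) (on 0 6 (on 0 5 (on 0 7 (dia 0 6 7 5 8) (at5 1 0
    3 9 7 6)) (at5 1 0 3 9 5 6)) (clause 0))) (on 1 7 (on 1 4 (at5 1 1 4 3 9 7) (on 1 2 (on 1 5 (at5 1 1 5 4
    3 2) (on 0 7 (on 0 2 (dia 0 1 2 7 3) (on 0 4 (at5 1 0 4 3 2 1) (on 0 5 (at5 1 0 5 9 2 1) (at6 0 0 7 5 4
    3 2)))) (on 0 4 (on 0 2 (on 0 5 (at5 1 0 5 9 7 1) (at5 1 0 2 9 5 4)) (at5 1 0 1 2 3 4)) (at6 0 4 3 0 1 7
    8)))) (on 1 5 (on 1 6 (dia 1 6 5 7 4) (clause 1)) (at6 0 1 7 5 4 3 2)))) (on 0 7 (on 0 4 (at5 1 0 4 3 9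
    7) (on 1 4 (on 0 2 (on 0 5 (at5 1 0 5 4 3 2) (on 1 2 (on 1 5 (at5 1 1 5 9 7 0) (at5 1 1 2 9 5 4))
    (at5 1 1 0 2 3 4))) (on 0 5 (on 0 6 (dia 0 6 5 7 4) (clause 0)) (at6 0 0 7 5 4 3 2))) (at6 0 4 3 1 0 7 8)))
    (at6 0 0 1 8 7 9 3)))))
    (on 1 9 (on 1 2 (on 1 5 (dia 1 9 5 2 4) (on 1 7 (dia 1 9 7 2 6) (on 1 8 (dia 1 2 8 9 3) (on 1 4
    (on 1 3 (dia 1 3 2 4 8) (fuse 2 9 1 3 (on 1 6 (clash 3 1 6) (on 0 9 (on 0 4 (dia 0 1 4 9 2) (on 0 5
    (dia 0 9 5 1 6) (on 0 6 (at5 1 0 6 5 4 1) (on 0 2 (on 0 7 (dia 0 9 7 1 6) (at6 0 0 2 7 6 5 4)) (clause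
    0))))) (on 0 8 (on 0 2 (dia 0 2 1 8 4) (on 0 5 (at5 1 0 5 9 2 8) (on 0 6 (at5 1 0 6 5 9 1) (clause 0))))
    (clause 2)))))) (at6 0 4 5 1 2 8 7))))) (on 1 6 (on 1 3 (dia 3 9 1 2 6) (on 0 9 (on 0 2 (dia 0 9 2 1 3)
    (on 0 6 (dia 0 1 6 9 2) (clause 0))) (on 0 8 (on 0 2 (on 0 3 (dia 0 2 3 8 4) (on 0 7 (dia 0 8 7 2 6)
    (on 0 5 (at5 1 0 5 9 7 8) (on 0 4 (at5 1 0 4 5 9 2) (on 0 6 (at5 1 0 6 5 9 2) (at6 0 3 4 0 8 7 6))))))
    (on 0 6 (on 1 8 (dia 1 0 8 6 2) (at5 1 1 0 8 2 9)) (clause 0))) (clause 2)))) (clause 1))) (on 1 8 (on 1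
    7 (on 1 2 (dia 1 8 2 7 3) (on 1 6 (dia 1 7 6 8 5) (clause 1))) (on 1 3 (at5 1 1 3 9 7 8) (on 1 5 (at5 1
    1 5 9 7 8) (on 1 6 (on 1 2 (at5 1 1 2 9 5 6) (on 0 6 (on 0 7 (dia 0 6 7 1 9) (on 0 8 (dia 0 1 8 6 2)
    (on 0 2 (at5 1 0 2 8 7 6) (on 0 9 (at5 1 0 9 2 8 1) (clause 2))))) (on 0 2 (on 0 8 (dia 0 8 1 2 6)
    (on 0 9 (on 0 5 (dia 0 9 5 2 4) (at5 1 0 1 6 5 9)) (clause 2))) (clause 0)))) (at6 0 1 8 6 5 9 3))))) (clause
    3)))
    (λ _ _ → tt) (λ _ _ → tt) (λ _ _ → tt)

  C₇+3+3-colourable : Avoids (P₂+P₄ ∷ cycle 5 ∷ []) → Vertices C₇+3+3 → Colourable G 3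
  C₇+3+3-colourable av (_ ∷ _ , ind) = ByClasses.three-colourable-by {G = G} df av C₇+3+3 0 4 1 5 ind
    (on 1 3 (on 1 9 (dia 9 3 1 2 0) (on 1 10 (on 1 7 (dia 7 10 1 6 0) (on 0 3 (on 0 9 (dia 0 3 9 1 2)
    (on 0 10 (dia 0 1 10 3 6) (at6 0 2 9 0 1 10 6))) (on 0 7 (on 0 5 (on 0 10 (dia 0 10 1 7 3) (at6 0 2 3 10
    7 0 5)) (at6 0 2 3 0 7 6 5)) (at6 0 7 6 0 1 3 2)))) (on 1 4 (at6 0 2 9 1 4 10 6) (on 1 7 (at6 0 2 9 1 7 10 4)
    (on 1 5 (at6 0 7 10 1 5 9 2) (at6 0 7 10 1 3 9 5)))))) (on 1 7 (on 1 5 (on 1 10 (dia 10 7 1 6 0) (at6 0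
    2 3 10 7 1 5)) (at6 0 2 3 1 7 6 5)) (on 1 4 (at6 0 6 7 1 4 3 2) (on 1 5 (at6 0 2 3 1 5 6 7) (on 1 9 (at6 0
    6 7 1 9 3 4) (on 0 3 (on 0 5 (on 0 7 (on 0 9 (dia 0 9 3 5 2) (at6 0 9 2 1 0 7 6)) (at6 0 7 6 1 0 3 2))
    (at6 0 5 6 1 0 3 2)) (on 0 5 (at6 0 2 3 1 0 5 6) (on 0 4 (on 0 7 (at6 0 2 3 0 7 6 5) (at6 0 7 6 0 4 3 2))
    (at6 0 0 1 5 4 3 2)))))))))
    (on 0 9 (on 0 2 (dia 2 9 0 3 1) (on 0 6 (on 0 10 (dia 10 6 0 7 1) (on 1 9 (on 1 2 (dia 1 9 2 0 3)
    (on 1 6 (dia 1 0 6 9 7) (clause 1))) (on 1 10 (on 1 2 (on 1 4 (on 0 4 (dia 4 1 0 10 9) (at5 1 0 1 4 3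
    9)) (at5 1 1 2 3 4 10)) (at6 0 2 3 0 1 10 7)) (at6 0 10 7 1 0 9 3)))) (clause 0))) (on 0 6 (on 0 8 (on 0 10
    (dia 10 6 0 7 1) (at6 0 3 9 10 6 0 8)) (at6 0 3 9 0 6 7 8)) (on 0 2 (on 0 4 (at6 0 6 7 0 4 3 9) (at6 0 6 7 0 2
    3 4)) (clause 0))))
    (on 0 3 (on 0 2 (on 0 4 (dia 0 3 4 2 5) (on 0 8 (dia 0 2 8 3 7) (on 0 10 (on 0 7 (on 0 6 (on
    0 5 (dia 0 6 5 7 4) (at5 1 0 3 4 5 6)) (dia 7 10 0 6 2)) (at5 1 0 2 8 7 10)) (on 0 6 (at5 1 0 6 10 4 3) (on 0
    7 (at5 1 0 7 10 4 3) (on 0 5 (on 1 2 (on 1 5 (dia 1 0 5 2 4) (on 1 8 (dia 1 2 8 0 7) (on 1 3 (on 1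
    4 (dia 1 3 4 0 10) (on 1 6 (at5 1 1 6 5 4 3) (on 1 7 (at5 1 1 7 6 5 0) (at6 0 4 5 1 2 8 7)))) (fuse 0 2 1 3
    (on 1 7 (clash 3 1 7) (clause 3)))))) (on 1 6 (on 1 3 (dia 3 0 1 2 6) (on 1 7 (on 1 8 (dia 1 7 8 6 2)
    (at5 1 1 0 2 8 7)) (clause 3))) (clause 1))) (at6 0 7 8 0 3 4 5))))))) (on 0 6 (on 0 9 (dia 9 3 0 2 6) (on
    0 5 (on 0 4 (dia 0 4 3 5 2) (on 0 8 (at5 1 0 8 2 9 5) (on 0 10 (dia 0 6 10 5 7) (at6 0 2 8 0 6 10 4))))
    (at5 1 0 3 9 5 6))) (clause 0))) (on 0 7 (on 0 2 (on 0 9 (dia 9 2 0 3 7) (on 0 6 (on 0 5 (dia 0 6 5 7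
    4) (at5 1 0 2 9 5 6)) (on 1 2 (on 1 3 (dia 1 2 3 0 9) (on 1 7 (dia 1 0 7 2 6) (clause 3))) (on 1 6
    (on 1 7 (dia 1 7 0 6 2) (on 1 3 (on 1 9 (dia 9 3 1 2 6) (on 1 4 (at6 0 2 9 4 1 6 7) (on 1 5 (on 0
    5 (dia 5 1 0 6 2) (at5 1 0 1 5 9 2)) (at5 1 1 3 4 5 6)))) (clause 3))) (clause 1))))) (on 0 6 (on 0 5 (dia 0 6
    5 7 4) (on 0 4 (on 0 8 (dia 0 7 8 6 2) (on 0 9 (at5 1 0 9 2 8 7) (on 1 6 (on 1 4 (dia 1 0 4 6 3)
    (on 1 5 (dia 1 6 5 0 9) (on 1 3 (at5 1 1 3 4 5 6) (on 1 2 (at5 1 1 2 3 4 0) (on 1 7 (at6 0 1 7 2 3 4 5)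
    (clause 3)))))) (on 1 2 (on 1 7 (dia 7 0 1 6 2) (on 1 3 (on 1 8 (dia 1 2 8 3 7) (at5 1 1 0 7 8 2))
    (clause 3))) (clause 1))))) (at6 0 0 7 5 4 3 2))) (clause 0))) (clause 2)))
    (λ _ _ → tt) (λ _ _ → tt) (λ _ _ → tt)

  C₇+3-colourable : Avoids (P₂+P₄ ∷ cycle 5 ∷ C₇+4 ∷ C₇+3+3 ∷ []) → Vertices C₇+3 → Colourable G 3
  C₇+3-colourable av (_ ∷ _ , ind) = ByClasses.three-colourable-by {G = G} df av C₇+3 1 5 4 6 ind
    (on 0 2 (on 0 9 (dia 9 2 0 3 1) (on 0 4 (on 0 5 (on 0 6 (dia 0 5 6 4 7) (at6 0 6 7 4 0 2 9)) (at5 1 0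
    2 9 5 4)) (on 0 5 (at5 1 0 5 4 3 2) (on 0 6 (at5 1 0 6 5 9 2) (at6 0 0 2 7 6 5 4))))) (on 0 6 (on 0 8
    (on 0 4 (at5 1 0 4 3 2 8) (on 1 8 (on 1 2 (dia 1 8 2 0 3) (on 1 6 (dia 1 0 6 8 5) (at6 0 2 3 1 0 6 7)))
    (on 1 4 (on 1 9 (on 1 2 (dia 2 9 1 3 0) (on 1 6 (on 0 9 (dia 0 1 9 6 2) (at5 1 0 1 9 2 8)) (at6 0 2 3
    1 0 6 7))) (at6 0 7 8 1 4 3 9)) (at6 0 4 3 1 0 8 7)))) (on 0 4 (on 0 9 (on 1 4 (on 1 6 (dia 1 0 6 4 7)
    (on 1 2 (on 1 8 (at5 1 1 8 7 6 0) (on 1 9 (dia 1 9 0 2 4) (at6 0 7 8 1 0 9 3))) (at6 0 6 7 1 4 3 2)))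
    (on 1 2 (at5 1 1 2 3 4 0) (on 1 6 (on 1 8 (on 1 9 (dia 1 0 9 6 2) (at5 1 1 0 9 2 8)) (at6 0 3 4 1 6 7
    8)) (at6 0 2 3 1 0 6 7)))) (at6 0 7 8 0 4 3 9)) (at6 0 0 6 4 3 2 8))) (on 0 4 (at6 0 6 7 0 4 3 2) (on 0 5 (at6
    0 2 3 0 5 6 7) (on 0 9 (at6 0 6 7 0 9 3 4) (on 1 9 (on 1 2 (dia 2 9 1 3 0) (on 1 6 (at6 0 2 3 0 1 6 7)
    (at6 0 6 7 0 1 9 2))) (on 1 6 (at6 0 3 9 0 1 6 7) (on 1 2 (at6 0 6 7 0 1 2 3) (on 1 4 (at6 0 6 7 1 4 3 2)
    (on 1 5 (at6 0 2 3 1 5 6 7) (at6 0 1 0 5 4 3 2)))))))))))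
    (on 0 7 (on 0 9 (on 0 2 (on 0 5 (dia 0 9 5 2 4) (at5 1 0 7 6 5 9)) (at5 1 0 7 8 2 9)) (on 0 3 (on 0
    2 (dia 2 3 0 9 7) (at5 1 0 3 2 8 7)) (on 0 5 (on 0 4 (on 0 2 (occurs 2 (5 ∷ 4 ∷ 3 ∷ 2 ∷ 8 ∷ 7 ∷ 6 ∷ 0 ∷
    [])) (at6 0 2 9 4 0 7 6)) (on 0 2 (at5 1 0 2 3 4 5) (on 1 5 (on 1 7 (dia 1 0 7 5 8) (on 1 2 (at5 1 1 2 8
    7 0) (on 1 3 (on 1 9 (dia 1 9 3 5 2) (at6 0 9 2 1 0 7 6)) (clause 1)))) (on 1 2 (on 1 7 (on 1 4 (at5
    1 1 4 5 6 7) (on 1 3 (at5 1 1 3 4 5 0) (on 1 9 (dia 9 2 1 3 0) (at5 1 1 0 5 9 2)))) (at5 1 1 0 7 8 2)) (at6 0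
    2 8 1 0 5 6))))) (on 0 2 (on 0 4 (at5 1 0 4 5 6 7) (on 1 2 (on 1 3 (dia 1 2 3 0 4) (on 1 7 (dia 1 0 7
    2 6) (clause 1))) (on 1 5 (on 1 7 (on 1 9 (at5 1 1 9 2 8 7) (at5 1 1 0 2 9 5)) (at5 1 1 0 7 6 5)) (at6 0 5
    6 1 0 2 8)))) (at6 0 2 3 0 7 6 5))))) (on 0 3 (on 0 5 (on 0 9 (dia 0 9 3 5 2) (on 1 7 (on 1 5 (on
    1 3 (dia 1 0 3 5 2) (on 1 2 (on 0 2 (dia 0 2 1 3 5) (occurs 2 (0 ∷ 5 ∷ 6 ∷ 7 ∷ 8 ∷ 2 ∷ 3 ∷ 1 ∷ []))) (on 0
    2 (at5 1 0 2 8 7 1) (on 1 9 (dia 1 5 9 0 2) (at6 0 9 2 0 1 7 6))))) (at5 1 1 0 5 6 7)) (on 1 3 (on 1 5 (dia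
    1 0 5 3 6) (at6 0 1 3 5 6 7 8)) (clause 1)))) (at6 0 0 3 5 6 7 8)) (clause 0)))
    (on 1 6 (on 1 5 (on 1 4 (dia 1 5 4 6 3) (on 1 7 (dia 1 6 7 5 8) (on 1 3 (on 1 9 (dia 1 9 3 5 2)
    (on 1 2 (dia 2 3 1 9 6) (on 1 8 (at5 1 1 8 2 9 5) (on 0 3 (on 0 2 (dia 0 3 2 1 8) (on 0 4 (dia 0 3 4
    1 6) (on 0 5 (dia 0 1 5 3 6) (on 0 6 (dia 0 1 6 3 5) (on 0 8 (on 0 7 (on 0 9 (dia 0 3 9 1 2) (at6 0 0
    7 2 9 5 4)) (at5 1 0 1 6 7 8)) (clause 2)))))) (on 0 7 (on 0 6 (dia 0 6 1 7 3) (on 0 8 (on 0 2 (dia 0 8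
    2 7 3) (at5 1 0 1 3 2 8)) (clause 2))) (clause 0)))))) (clause 1)))) (on 1 3 (on 1 4 (on 1 9 (dia 1 3 9 4
    2) (at5 1 1 3 9 5 6)) (at5 1 1 3 4 5 6)) (on 1 7 (on 1 8 (dia 1 7 8 6 2) (on 1 2 (on 1 9 (dia 9 2 1 3 6)
    (at5 1 1 2 9 5 6)) (on 1 4 (on 1 9 (at5 1 1 9 2 8 7) (occurs 3 (7 ∷ 1 ∷ 4 ∷ 5 ∷ 9 ∷ 2 ∷ 8 ∷ 6 ∷ 3 ∷ []))) (at6
    0 2 8 1 6 5 4)))) (clause 1)))) (on 1 8 (on 1 7 (on 1 2 (dia 1 8 2 7 3) (on 1 9 (on 1 3 (dia 3 9 1 2
    7) (on 1 4 (at5 1 1 4 3 2 8) (on 1 5 (on 0 7 (on 0 5 (dia 0 1 5 7 4) (on 0 6 (dia 0 7 6 1 8) (on 0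
    4 (at5 1 0 4 5 6 7) (on 0 3 (at5 1 0 3 4 5 1) (on 0 2 (on 0 8 (dia 0 8 1 2 5) (clause 2)) (at6 0 0 7 2 3 4
    5)))))) (on 0 3 (on 0 8 (dia 8 1 0 7 3) (on 0 2 (on 0 4 (dia 0 3 4 2 5) (on 0 5 (on 0 6 (dia 0 5 6
    1 8) (clause 2)) (at6 0 7 8 0 3 4 5))) (at5 1 0 1 8 2 3))) (clause 0))) (at6 0 2 3 1 7 6 5)))) (on 1 4 (at6 0 2 9
    4 1 7 6) (on 1 5 (at5 1 1 5 9 2 8) (at6 0 1 7 4 5 9 2))))) (on 1 3 (on 0 8 (on 0 3 (dia 0 1 3 8 4)
    (on 0 7 (dia 0 8 7 1 6) (clause 0))) (on 0 6 (on 0 7 (on 0 5 (dia 0 6 5 7 4) (on 0 2 (on 0 9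
    (on 0 3 (on 0 4 (dia 0 3 4 2 5) (at5 1 0 3 4 5 6)) (dia 2 9 0 3 6)) (at5 1 0 2 9 5 6)) (on 0 3 (at5 1 0 3 2
    8 7) (on 0 4 (on 0 9 (at5 1 0 9 2 8 7) (occurs 3 (7 ∷ 0 ∷ 4 ∷ 5 ∷ 9 ∷ 2 ∷ 8 ∷ 6 ∷ 3 ∷ []))) (at6 0 2 8 0 6 5
    4))))) (at5 1 0 1 8 7 6)) (clause 2))) (clause 1))) (clause 3)))
    (λ _ _ → tt) (λ _ _ → tt) (λ _ _ → tt)

  C₇-colourable : Avoids (P₂+P₄ ∷ cycle 5 ∷ C₇+4 ∷ C₇+3 ∷ []) → Vertices (cycle 7) → Colourable G 3
  -- The second test needs only one vertex of the cycle, which is given twice.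
  C₇-colourable av (_ ∷ _ , ind) = ByClasses.three-colourable-by {G = G} df av (cycle 7) 0 3 1 1 ind
    (on 1 8 (on 1 3 (on 1 6 (on 1 4 (on 1 7 (dia 1 7 6 8 5) (occurs 2 (3 ∷ 4 ∷ 5 ∷ 6 ∷ 7 ∷ 8 ∷ 2 ∷ 1 ∷
    []))) (at5 1 1 3 4 5 6)) (on 1 4 (on 1 7 (at5 1 1 7 6 5 4) (occurs 3 (4 ∷ 3 ∷ 2 ∷ 8 ∷ 7 ∷ 6 ∷ 5 ∷ 1 ∷ [])))
    (on 1 7 (occurs 3 (7 ∷ 8 ∷ 2 ∷ 3 ∷ 4 ∷ 5 ∷ 6 ∷ 1 ∷ [])) (on 0 8 (on 0 3 (dia 0 1 3 8 4) (on 0 4 (at5 1 0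
    4 3 2 8) (on 0 6 (occurs 3 (0 ∷ 8 ∷ 2 ∷ 3 ∷ 4 ∷ 5 ∷ 6 ∷ 1 ∷ [])) (at6 0 0 8 6 5 4 3)))) (on 0 4 (on 0 3
    (dia 0 3 1 4 8) (on 0 6 (on 0 7 (occurs 2 (7 ∷ 6 ∷ 5 ∷ 4 ∷ 3 ∷ 1 ∷ 8 ∷ 0 ∷ [])) (at5 1 0 1 8 7 6)) (at6 0 2 8
    0 4 5 6))) (at6 0 4 5 0 1 8 2)))))) (on 1 4 (at5 1 1 4 3 2 8) (on 1 6 (on 0 3 (on 0 8 (on 0 6 (dia 0
    1 6 8 5) (on 0 4 (at5 1 0 4 5 6 1) (occurs 3 (1 ∷ 8 ∷ 2 ∷ 3 ∷ 4 ∷ 5 ∷ 6 ∷ 0 ∷ [])))) (at5 1 0 1 8 2 3)) (on 0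
    4 (on 0 6 (on 0 8 (dia 0 1 8 6 2) (occurs 3 (1 ∷ 6 ∷ 5 ∷ 4 ∷ 3 ∷ 2 ∷ 8 ∷ 0 ∷ []))) (at6 0 2 3 0 1 6 5)) (at6 0
    0 1 5 4 3 2))) (at6 0 1 8 6 5 4 3)))) (on 1 4 (on 1 6 (on 1 3 (on 1 7 (at5 1 1 7 8 2 3) (occurs 3 (3 ∷ 4
    ∷ 5 ∷ 6 ∷ 7 ∷ 8 ∷ 2 ∷ 1 ∷ []))) (on 1 7 (occurs 3 (7 ∷ 6 ∷ 5 ∷ 4 ∷ 3 ∷ 2 ∷ 8 ∷ 1 ∷ [])) (on 0 6 (on 0 4
    (dia 0 1 4 6 3) (on 0 3 (at5 1 0 3 4 5 6) (on 0 7 (dia 0 6 7 1 8) (on 0 8 (occurs 3 (0 ∷ 6 ∷ 5 ∷ 4 ∷ 3 ∷ 2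
    ∷ 8 ∷ 1 ∷ [])) (at6 0 3 4 0 6 7 8))))) (on 0 3 (on 0 4 (dia 0 4 1 3 6) (on 0 8 (on 0 7 (occurs 2 (7 ∷ 8
    ∷ 2 ∷ 3 ∷ 4 ∷ 1 ∷ 6 ∷ 0 ∷ [])) (at5 1 0 1 6 7 8)) (at6 0 5 6 0 3 2 8))) (at6 0 3 2 0 1 6 5))))) (at6 0 2 8 1 4 5 6))
    (on 1 6 (at6 0 2 8 1 6 5 4) (on 1 3 (at6 0 5 6 1 3 2 8) (on 0 6 (on 0 3 (on 0 4 (on 0 8 (on 0 7
    (dia 0 7 6 8 5) (occurs 2 (3 ∷ 4 ∷ 5 ∷ 6 ∷ 7 ∷ 8 ∷ 2 ∷ 0 ∷ []))) (at6 0 8 2 1 0 4 5)) (at5 1 0 3 4 5 6)) (at6 0 3 2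
    1 0 6 5)) (on 0 3 (at6 0 5 6 1 0 3 2) (on 0 4 (on 0 7 (at6 0 2 3 0 7 6 5) (at6 0 7 6 0 4 3 2)) (at6 0 0 1 5
    4 3 2))))))))
    (on 0 2 (on 0 7 (on 0 8 (dia 0 8 2 7 3) (on 0 5 (on 0 4 (on 0 6 (dia 0 6 5 7 4) (occurs 2 (4 ∷ 5 ∷
    6 ∷ 7 ∷ 8 ∷ 2 ∷ 3 ∷ 0 ∷ []))) (at5 1 0 2 3 4 5)) (on 0 4 (on 0 6 (occurs 2 (6 ∷ 7 ∷ 8 ∷ 2 ∷ 3 ∷ 4 ∷ 5 ∷ 0 ∷
    [])) (at5 1 0 4 5 6 7)) (on 0 6 (occurs 3 (6 ∷ 7 ∷ 8 ∷ 2 ∷ 3 ∷ 4 ∷ 5 ∷ 0 ∷ [])) (on 1 2 (on 1 7 (dia 1 0 7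
    2 6) (on 1 6 (on 1 4 (on 1 5 (dia 1 5 4 6 3) (occurs 2 (0 ∷ 2 ∷ 3 ∷ 4 ∷ 5 ∷ 6 ∷ 7 ∷ 1 ∷ []))) (on 1 5
    (at5 1 1 5 4 3 2) (occurs 3 (2 ∷ 0 ∷ 7 ∷ 6 ∷ 5 ∷ 4 ∷ 3 ∷ 1 ∷ [])))) (on 1 4 (on 1 5 (at5 1 1 5 6 7 0) (occurs
    3 (0 ∷ 2 ∷ 3 ∷ 4 ∷ 5 ∷ 6 ∷ 7 ∷ 1 ∷ []))) (at6 0 6 7 1 2 3 4)))) (on 1 4 (at5 1 1 4 3 2 0) (on 1 5 (on 1 7
    (on 1 6 (dia 1 6 5 7 4) (occurs 3 (0 ∷ 7 ∷ 6 ∷ 5 ∷ 4 ∷ 3 ∷ 2 ∷ 1 ∷ []))) (on 1 6 (occurs 3 (5 ∷ 6 ∷ 7 ∷ 0 ∷ 2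
    ∷ 3 ∷ 4 ∷ 1 ∷ [])) (at6 0 2 3 1 5 6 7))) (clause 1)))))))) (on 0 6 (on 0 8 (on 0 4 (on 0 5 (dia 0 5 4 6
    3) (occurs 2 (2 ∷ 8 ∷ 7 ∷ 6 ∷ 5 ∷ 4 ∷ 3 ∷ 0 ∷ []))) (on 0 5 (at5 1 0 5 4 3 2) (occurs 3 (2 ∷ 8 ∷ 7 ∷ 6 ∷ 5 ∷ 4 ∷
    3 ∷ 0 ∷ [])))) (at5 1 0 2 8 7 6)) (on 0 4 (on 0 5 (on 0 8 (at5 1 0 8 7 6 5) (occurs 3 (5 ∷ 4 ∷ 3 ∷ 2 ∷ 8 ∷
    7 ∷ 6 ∷ 0 ∷ []))) (on 0 8 (occurs 3 (8 ∷ 2 ∷ 3 ∷ 4 ∷ 5 ∷ 6 ∷ 7 ∷ 0 ∷ [])) (on 1 2 (on 1 4 (dia 1 0 4 2 5)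
    (on 1 5 (at5 1 1 5 4 3 2) (on 1 6 (at5 1 1 6 5 4 0) (on 1 7 (occurs 3 (1 ∷ 2 ∷ 3 ∷ 4 ∷ 5 ∷ 6 ∷ 7 ∷ 0 ∷ []))
    (at6 0 1 2 7 6 5 4))))) (on 1 5 (on 1 4 (dia 1 4 0 5 2) (on 1 8 (on 1 6 (on 1 7 (dia 1 7 6 8 5)
    (occurs 2 (5 ∷ 6 ∷ 7 ∷ 8 ∷ 2 ∷ 0 ∷ 4 ∷ 1 ∷ []))) (on 1 7 (occurs 2 (7 ∷ 8 ∷ 2 ∷ 0 ∷ 4 ∷ 5 ∷ 6 ∷ 1 ∷ [])) (at6 0 3
    4 1 8 7 6))) (on 1 6 (at6 0 1 6 8 2 3 4) (on 1 7 (at5 1 1 7 8 2 0) (at6 0 2 3 1 5 6 7))))) (clause 1))))) (at6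
    0 6 7 0 2 3 4)))) (on 0 5 (on 0 6 (on 0 4 (dia 0 5 4 6 3) (on 0 7 (dia 0 6 7 5 8) (on 0 8 (occurs 3
    (5 ∷ 6 ∷ 7 ∷ 8 ∷ 2 ∷ 3 ∷ 4 ∷ 0 ∷ [])) (at6 0 3 4 0 6 7 8)))) (on 0 7 (on 0 4 (on 0 8 (at5 1 0 8 2 3 4)
    (occurs 3 (4 ∷ 5 ∷ 6 ∷ 7 ∷ 8 ∷ 2 ∷ 3 ∷ 0 ∷ []))) (on 0 8 (occurs 3 (8 ∷ 7 ∷ 6 ∷ 5 ∷ 4 ∷ 3 ∷ 2 ∷ 0 ∷ [])) (on 1
    5 (on 1 4 (dia 1 5 4 0 3) (on 1 2 (at5 1 1 2 3 4 5) (on 1 7 (dia 1 0 7 5 8) (on 1 8 (occurs 3 (5 ∷ 0 ∷ 7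
    ∷ 8 ∷ 2 ∷ 3 ∷ 4 ∷ 1 ∷ [])) (at6 0 3 4 1 0 7 8))))) (on 1 2 (on 1 7 (on 1 8 (dia 1 8 2 7 3) (on 1 4
    (occurs 2 (7 ∷ 0 ∷ 5 ∷ 4 ∷ 3 ∷ 2 ∷ 8 ∷ 1 ∷ [])) (occurs 3 (0 ∷ 7 ∷ 8 ∷ 2 ∷ 3 ∷ 4 ∷ 5 ∷ 1 ∷ [])))) (on 1 8 (on
    1 4 (occurs 2 (8 ∷ 2 ∷ 3 ∷ 4 ∷ 5 ∷ 0 ∷ 7 ∷ 1 ∷ [])) (occurs 3 (2 ∷ 8 ∷ 7 ∷ 0 ∷ 5 ∷ 4 ∷ 3 ∷ 1 ∷ []))) (at5 1 1 0 7 8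
    2))) (clause 1))))) (at6 0 2 3 0 5 6 7))) (clause 0)))
    (on 0 3 (on 1 3 (on 1 5 (on 0 5 (dia 0 1 5 3 6) (on 0 2 (on 0 4 (dia 0 3 4 2 5) (on 0 6 (at5 1 0
    6 5 4 3) (on 0 7 (on 0 8 (dia 0 8 2 7 3) (occurs 3 (3 ∷ 2 ∷ 8 ∷ 7 ∷ 6 ∷ 5 ∷ 4 ∷ 0 ∷ []))) (at6 0 0 2 7 6 5
    4)))) (clause 0))) (on 1 2 (on 1 4 (dia 1 3 4 2 5) (on 1 6 (at5 1 1 6 5 4 3) (on 1 7 (on 1 8 (dia 1 8
    2 7 3) (occurs 3 (3 ∷ 2 ∷ 8 ∷ 7 ∷ 6 ∷ 5 ∷ 4 ∷ 1 ∷ []))) (at6 0 1 2 7 6 5 4)))) (clause 1))) (clause 3)) (clause 2))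
    (λ _ _ → tt) (λ _ _ → tt) (λ _ _ → tt)

  seven-cycle⇒three-colourable : Avoids (P₂+P₄ ∷ cycle 5 ∷ []) → Vertices (cycle 7) → Colourable G 3
  seven-cycle⇒three-colourable av@(w ∷ c₅ ∷ []) c₇ with occurs? G C₇+4 | occurs? G C₇+3+3 | occurs? G C₇+3
  ... | yes i | _     | _     = C₇+4-colourable av i
  ... | no _  | yes i | _     = C₇+3+3-colourable av i
  ... | no h  | no f  | yes i = C₇+3-colourable (w ∷ c₅ ∷ (λ vs i → h (vs , i)) ∷ (λ vs i → f (vs , i)) ∷ []) i
  ... | no h  | no _  | no g  = C₇-colourable (w ∷ c₅ ∷ (λ vs i → h (vs , i)) ∷ (λ vs i → g (vs , i)) ∷ []) c₇

-- Induced subgraphs and shapes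

-- On closed graphs this evaluates: the shapes of `P 2 ⊕ P 4`, `C 5` and `C 7` agree with `P₂+P₄`,
-- `cycle 5` and `cycle 7` by computation.
shapeOf : ∀ {m} → Graph m → Shape
shapeOf {zero}  H = []
shapeOf {suc m} H = List.tabulate (λ j → adj H zero (suc j)) ∷ shapeOf (delete H zero)

module _ {n} (G : Graph n) where

  open Adjacency G

  realise : ∀ {m} (H : Graph m) vs → Induces (shapeOf H) vs →
            Σ[ f ∈ (Fin m → Fin n) ] vs ≡ List.tabulate f × (∀ i j → adj H i j ≡ adj G (f i) (f j))
  realise {zero}  H []       _       = (λ ()) , refl , λ ()
  realise {suc m} H (v ∷ vs) (p , q) with f , refl , e ← realise (delete H zero) vs q = f′ , refl , e′
    where
    f′ : Fin (suc m) → Fin n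
    f′ zero    = v
    f′ (suc i) = f i
    e′ : ∀ i j → adj H i j ≡ adj G (f′ i) (f′ j)
    e′ zero    zero    = trans (adj-irr H zero) (sym (adj-irr G v))
    e′ zero    (suc j) = sym (Pointwise.tabulate⁻ p j)
    e′ (suc i) zero    = trans (adj-sym H (suc i) zero) (trans (sym (Pointwise.tabulate⁻ p i)) (adj-sym G v (f i)))
    e′ (suc i) (suc j) = e i j

  embedding-induces : ∀ {m} (H : Graph m) (f : Fin m → Fin n) → (∀ i j → adj H i j ≡ adj G (f i) (f j)) →
                      Induces (shapeOf H) (List.tabulate f)
  embedding-induces {zero}  H f e = tt
  embedding-induces {suc m} H f e =
      Pointwise.tabulate⁺ (λ j → sym (e zero (suc j)))
    , embedding-induces (delete H zero) (f ∘ suc) (λ i j → e (suc i) (suc j))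

  contains⇒induces : ∀ {m} {H : Graph m} → Contains G H → ∃[ vs ] Induces (shapeOf H) vs
  contains⇒induces {H = H} (f , _ , e) = List.tabulate f , embedding-induces H f e

  -- Two vertices with the same image have the same neighbours, so an adjacency-preserving map from
  -- a twin-free graph is injective.
  TwinFree : ∀ {m} → Graph m → Set
  TwinFree H = ∀ i j → (∀ l → adj H i l ≡ adj H j l) → i ≡ j

  induces⇒contains : ∀ {m} {H : Graph m} → TwinFree H → ∃[ vs ] Induces (shapeOf H) vs → Contains G H
  induces⇒contains {H = H} twin-free (vs , ind) with f , _ , e ← realise H vs ind =
    f , (λ {i} {j} fi≡fj → twin-free i j λ l →
      trans (e i l) (trans (cong (λ u → adj G u (f l)) fi≡fj) (sym (e j l)))) , e

  -- The tips 2 and 3 are the only twins of K₄ - e, so injectivity of the embedding rests on c ≢ d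
  -- there and on adjacency elsewhere.
  K₄-e-free⇒DiamondFree : ¬ Contains G K4-e → DiamondFree
  K₄-e-free⇒DiamondFree none {x} {y} {c} {d} xy xc xd yc yd cd = decidable-stable (c ≟ d) λ c≢d →
    case realise K4-e (x ∷ y ∷ c ∷ d ∷ []) ((xy ∷ xc ∷ xd ∷ []) , (yc ∷ yd ∷ []) , (cd ∷ []) , [] , tt) of λ
      { (f , eq , e) → none (f , (λ {i} {j} → injective f e (tips c≢d f eq) i j) , e) }
    where
    adjacent-or-tips : ∀ i j → i ≡ j ⊎ adj K4-e i j ≡ true ⊎ (i ≡ 2F × j ≡ 3F) ⊎ (i ≡ 3F × j ≡ 2F)
    adjacent-or-tips = from-yes (𝔽.all? λ i → 𝔽.all? λ j →
      (i ≟ j) ⊎-dec (adj K4-e i j 𝔹.≟ true) ⊎-dec ((i ≟ 2F) ×-dec (j ≟ 3F)) ⊎-dec ((i ≟ 3F) ×-dec (j ≟ 2F)))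
    tips : c ≢ d → (f : Fin 4 → Fin n) → x ∷ y ∷ c ∷ d ∷ [] ≡ List.tabulate f → f 2F ≢ f 3F
    tips c≢d f eq e = c≢d (trans (cong (λ l → at l x 2) eq) (trans e (sym (cong (λ l → at l x 3) eq))))
    injective : (f : Fin 4 → Fin n) → (∀ i j → adj K4-e i j ≡ adj G (f i) (f j)) → f 2F ≢ f 3F →
                ∀ i j → f i ≡ f j → i ≡ j
    injective f e f₂≢f₃ i j fi≡fj with adjacent-or-tips i j
    ... | inj₁ i≡j = i≡j
    ... | inj₂ (inj₁ ij) = contradiction fi≡fj (~⇒≢ (trans (sym (e i j)) ij))
    ... | inj₂ (inj₂ (inj₁ (refl , refl))) = contradiction fi≡fj f₂≢f₃
    ... | inj₂ (inj₂ (inj₂ (refl , refl))) = contradiction (sym fi≡fj) f₂≢f₃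

-- Chromatic and clique numbers

∃vec? : ∀ {k m} {P : Vec (Fin k) m → Set} → (∀ v → Dec (P v)) → Dec (∃ P)
∃vec? {m = zero}  P? = map′ ([] ,_) (λ { ([] , p) → p }) (P? [])
∃vec? {m = suc m} P? = map′ (λ (x , v , p) → x ∷ v , p) (λ { (x ∷ v , p) → x , v , p })
                            (𝔽.any? λ x → ∃vec? (P? ∘ (x ∷_)))

module _ {n} (G : Graph n) where

  open Adjacency G

  -- Colourings are searched as vectors, which can be enumerated entry by entry.
  colourable? : ∀ k → Dec (Colourable G k)
  colourable? k = map′ (λ (v , proper) → Vec.lookup v , proper)
    (λ (c , proper) → Vec.tabulate c , λ i j ij e →
      proper i j ij (trans (sym (lookup∘tabulate c i)) (trans e (lookup∘tabulate c j))))
    (∃vec? λ v → 𝔽.all? λ i → 𝔽.all? λ j → (i ~? j) →-dec ¬? (Vec.lookup v i ≟ Vec.lookup v j))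

  chromatic : ∀ m {k} → k < m → Colourable G k → ∃[ j ] IsChromaticNumber G j × j < m
  chromatic (suc m) {k} k<m col with ℕ.anyUpTo? colourable? m
  ... | yes (j , j<m , col′) = let l , χ , l<m = chromatic m j<m col′ in l , χ , ℕ.m<n⇒m<1+n l<m
  ... | no none = k , (col , λ j col′ → ℕ.≮⇒≥ λ j<k → none (j , ℕ.<-≤-trans j<k (s≤s⁻¹ k<m) , col′)) , k<m

  colourable⇒ChiLe : ∀ {k} → Colourable G k → ChiLe G k
  colourable⇒ChiLe {k} col = let j , χ , j<1+k = chromatic (suc k) (ℕ.n<1+n k) col in j , χ , s≤s⁻¹ j<1+k

  clique≤colours : ∀ {j k} → HasClique G j → Colourable G k → j ≤ k
  clique≤colours (f , _ , f-adj) (c , proper) = 𝔽.injective⇒≤ {f = c ∘ f}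
    λ {x} {y} e → decidable-stable (x ≟ y) λ x≢y → proper _ _ (f-adj x y x≢y) e

  colourable⇒ChiEqOmega : ∀ {k} → IsCliqueNumber G k → Colourable G k → ChiEqOmega G
  colourable⇒ChiEqOmega ω@(K , _) col = _ , (col , λ j → clique≤colours K) , ω

  clique-number : ∀ b → (∀ j → HasClique G j → j ≤ b) → ∃ (IsCliqueNumber G)
  clique-number zero bound = zero , ((λ ()) , (λ { {()} }) , λ ()) , bound
  clique-number (suc b) bound with hasClique? G (suc b)
  ... | yes K = suc b , K , bound
  ... | no ¬K = clique-number b λ j K → ℕ.≤-pred (ℕ.≤∧≢⇒< (bound j K) λ { refl → ¬K K })

  clique-number⇒avoids : ∀ {k} → IsCliqueNumber G k → ∀ vs → ¬ Induces (complete (suc k)) vs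
  clique-number⇒avoids (_ , largest) = no-clique⇒avoids G λ K → ℕ.<-irrefl refl (largest _ K)

twinFree? : ∀ {m} (H : Graph m) → Dec (∀ i j → (∀ l → adj H i l ≡ adj H j l) → i ≡ j)
twinFree? H = 𝔽.all? λ i → 𝔽.all? λ j → (𝔽.all? λ l → adj H i l 𝔹.≟ adj H j l) →-dec (i ≟ j)

module _ {n} (G : Graph n) where

  open Adjacency G

  free⇒avoids : ¬ Contains G (P 2 ⊕ P 4) → Avoids (P₂+P₄ ∷ [])
  free⇒avoids none = (λ vs i → none (induces⇒contains G {H = P 2 ⊕ P 4} (from-yes (twinFree? (P 2 ⊕ P 4))) (vs , i))) ∷ []

  C₅-contained : ∃[ vs ] Induces (cycle 5) vs → Contains G (C 5)
  C₅-contained = induces⇒contains G {H = C 5} (from-yes (twinFree? (C 5)))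

  C₇-contained : ∃[ vs ] Induces (cycle 7) vs → Contains G (C 7)
  C₇-contained = induces⇒contains G {H = C 7} (from-yes (twinFree? (C 7)))

  berge⇒ChiEqOmega : DiamondFree → Avoids (P₂+P₄ ∷ cycle 5 ∷ cycle 7 ∷ []) → ChiEqOmega G
  berge⇒ChiEqOmega df (w ∷ c₅ ∷ c₇ ∷ []) with k , ω ← clique-number G n (λ j (_ , inj , _) → 𝔽.injective⇒≤ inj) =
    colourable⇒ChiEqOmega G ω (berge-colourable k G df (w ∷ c₅ ∷ c₇ ∷ clique-number⇒avoids G ω ∷ []))

  colourable-by-ω : DiamondFree → Avoids (P₂+P₄ ∷ []) → ∀ {k} → IsCliqueNumber G k → ChiLe G 6 ⊎ ChiEqOmega G
  colourable-by-ω df (w ∷ []) {k} ω with ℕ.≤-total k 6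
  ... | inj₁ k≤6 = inj₁ (colourable⇒ChiLe G (six-colourable G df (w ∷ few ∷ [])))
    where
    few : ∀ vs → ¬ Induces (complete 7) vs
    few = no-clique⇒avoids G λ K → ℕ.<⇒≱ (s≤s k≤6) (proj₂ ω 7 K)
  ... | inj₂ 6≤k with j , refl ← ℕ.m≤n⇒∃[o]m+o≡n 6≤k =
    inj₂ (colourable⇒ChiEqOmega G ω (clique-colourable j G df (w ∷ clique-number⇒avoids G ω ∷ [])))

-- The conditions in (ii) and (iii) appear as conjuncts. Read as an implication, (ii) would hold for
-- every C₅-free graph and the disjunction would say little.
theorem1p2 : ∀ {n} (G : Graph n) → Free₂ G (P 2 ⊕ P 4) K4-e → OmegaGe G 3 →
    Perfect G
    ⊎ (Contains G (C 5) × (ChiLe G 6 ⊎ ChiEqOmega G))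
    ⊎ (¬ Contains G (C 5) × Contains G (C 7) × ChiLe G 3)
theorem1p2 G (no-P₂+P₄ , no-K₄-e) (_ , ω , _) = by-holes (occurs? G (cycle 5)) (occurs? G (cycle 7))
  where
  df : Adjacency.DiamondFree G
  df = K₄-e-free⇒DiamondFree G no-K₄-e
  w : Adjacency.Avoids G (P₂+P₄ ∷ [])
  w = free⇒avoids G no-P₂+P₄
  Occurs : Shape → Set
  Occurs s = ∃[ vs ] Adjacency.Induces G s vs
  by-holes : Dec (Occurs (cycle 5)) → Dec (Occurs (cycle 7)) →
    Perfect G
    ⊎ (Contains G (C 5) × (ChiLe G 6 ⊎ ChiEqOmega G))
    ⊎ (¬ Contains G (C 5) × Contains G (C 7) × ChiLe G 3)
  by-holes (yes c₅) _ = inj₂ (inj₁ (C₅-contained G c₅ , colourable-by-ω G df w ω))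
  by-holes (no ¬c₅) (yes c₇) = inj₂ (inj₂ (¬c₅ ∘ contains⇒induces G {H = C 5} , C₇-contained G c₇ ,
    colourable⇒ChiLe G (seven-cycle⇒three-colourable {G = G} df (All.head w ∷ (λ vs i → ¬c₅ (vs , i)) ∷ []) c₇)))
  -- All assumptions pass to induced subgraphs, so perfection reduces to χ = ω for graphs without
  -- odd holes.
  by-holes (no ¬c₅) (no ¬c₇) = inj₁ λ m H (f , f-inj , e) → berge⇒ChiEqOmega H
    (embedded-DiamondFree H G f f-inj e df)
    (embedded-Avoids H G f f-inj e (All.head w ∷ (λ vs i → ¬c₅ (vs , i)) ∷ (λ vs i → ¬c₇ (vs , i)) ∷ []))
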